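{- Let $r,\ell \geq 0$ be fixed integers. Then: (i) if \textsc{wc-$(r,\ell)$g} is coNP-complete, then \textsc{wc-$(r+1,\ell)$g} and \textsc{wc-$(r,\ell+1)$g} are coNP-complete; (ii) if \textsc{$(r,\ell)$wc-g} is NP-hard (resp. coNP-hard), then \textsc{$(r,\ell+1)$wc-g} is NP-hard (resp. coNP-hard); (iii) if $r \geq 1$ and \textsc{$(r,\ell)$wc-g} is NP-hard (resp. coNP-hard), then \textsc{$(r+1,\ell)$wc-g} is NP-hard (resp. coNP-hard).
   Context: All graphs are finite and simple. An $(r,\ell)$-partition of a graph $G$ is a partition of $V(G)$ into $r$ independent sets and $\ell$ cliques (parts are allowed to be empty); $G$ is an $(r,\ell)$-graph if it admits an $(r,\ell)$-partition. A graph is well-covered if all its maximal (by inclusion) independent sets have the same cardinality; it is $(r,\ell)$-well-covered if it is both an $(r,\ell)$-graph and well-covered. For fixed $r,\ell$: the problem \textsc{$(r,\ell)$wc-g} takes as input a graph $G$ and asks whether $G$ is $(r,\ell)$-well-covered; the problem \textsc{wc-$(r,\ell)$g} takes as input an $(r,\ell)$-graph $G$ together with an $(r,\ell)$-partition of $V(G)$ and asks whether $G$ is well-covered. -}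

module Defs where

open import Data.Bool using (Bool; true; false)
open import Data.Fin using (Fin; toℕ)
open import Data.Fin.Subset using (Subset; ∣_∣; _∈_; _⊆_)
open import Data.List as List using (List; []; _∷_; [_]; _++_; length; replicate; tabulate; concat; concatMap)
open import Data.Maybe using (Maybe; just; nothing)
open import Data.Nat using (ℕ; zero; suc; _+_; _*_; _≤_)
open import Data.Product using (Σ; ∃-syntax; _×_; _,_)
open import Data.Sum using (_⊎_; inj₁; inj₂)
open import Data.Vec as Vec using (Vec; _∷_)
open import Function using (_∘_; _⇔_; _↔_)
open import Level using (0ℓ)
open import Relation.Binary.PropositionalEquality using (_≡_; _≢_)
open import Relation.Nullary using (¬_)
open import Relation.Unary using (Pred)

Symbol : Set
Symbol = Maybe Bool

pattern blank = nothing

data Move : Set where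
  left stay right : Move

-- A two-way infinite tape.  `before` lists the cells to the left of the
-- head, nearest first; cells beyond the ends of the two lists are blank.
record Tape : Set where
  constructor tape
  field
    before : List Symbol
    head   : Symbol
    after  : List Symbol

open Tape public

write : Symbol → Tape → Tape
write s (tape b _ a) = tape b s a

move : Move → Tape → Tape
move left  (tape []      h a)       = tape [] blank (h ∷ a)
move left  (tape (s ∷ b) h a)       = tape b s (h ∷ a)
move stay  t                        = t
move right (tape b       h [])      = tape (h ∷ b) blank []
move right (tape b       h (s ∷ a)) = tape (h ∷ b) s a

act : Symbol × Move → Tape → Tape
act (s , m) t = move m (write s t)

record TM : Set₁ where
  field
    State     : Set
    size      : ℕ
    finite    : State ↔ Fin size
    workTapes : ℕ

  tapes : ℕ
  tapes = suc workTapes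

  -- `nothing` means that the machine halts.
  field
    start : State
    δ     : State → Vec Symbol tapes → Maybe (State × Vec (Symbol × Move) tapes)

  Config : Set
  Config = State × Vec Tape tapes

  data _⇓[_]_ : Config → ℕ → Vec Tape tapes → Set where
    halt : ∀ {q ts} →
           δ q (Vec.map head ts) ≡ nothing →
           (q , ts) ⇓[ 0 ] ts
    step : ∀ {q ts q′ as t ts′} →
           δ q (Vec.map head ts) ≡ just (q′ , as) →
           (q′ , Vec.zipWith act as ts) ⇓[ t ] ts′ →
           (q , ts) ⇓[ suc t ] ts′

blankTape : Tape
blankTape = tape [] blank []

inputTape : List Bool → Tape
inputTape []      = blankTape
inputTape (b ∷ x) = tape [] (just b) (List.map just x)

leadingBits : List Symbol → List Bool
leadingBits []            = []
leadingBits (blank ∷ _)   = []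
leadingBits (just b ∷ ss) = b ∷ leadingBits ss

-- The output is read from the head position up to the first blank.
outputTape : Tape → List Bool
outputTape t = leadingBits (head t ∷ after t)

-- Coefficients, constant term first.
Polynomial : Set
Polynomial = List ℕ

eval : Polynomial → ℕ → ℕ
eval []      n = 0
eval (a ∷ p) n = a + n * eval p n

-- The first tape carries both the input and the output.
ComputesInTime : TM → Polynomial → (List Bool → List Bool) → Set
ComputesInTime M p f = ∀ x →
  ∃[ t ] ∃[ ts ]
    (start , inputTape x ∷ Vec.replicate workTapes blankTape) ⇓[ t ] ts
    × t ≤ eval p (length x)
    × outputTape (Vec.head ts) ≡ f x
  where open TM M

PolyTime : (List Bool → List Bool) → Set₁
PolyTime f = Σ TM λ M → ∃[ p ] ComputesInTime M p f

Language : Set₁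
Language = List Bool → Set

-- The first component is self-delimiting: each bit b is written 1b, and
-- a 0 marks the end.
pair : List Bool → List Bool → List Bool
pair x u = concatMap (λ b → true ∷ b ∷ []) x ++ false ∷ u

InNP : Language → Set₁
InNP L = ∃[ p ] ∃[ V ]
  PolyTime ([_] ∘ V)
  × (∀ x → L x ⇔ (∃[ u ] length u ≤ eval p (length x) × V (pair x u) ≡ true))

-- Stated as "L is the complement of some NP language" rather than as
-- `InNP (λ x → ¬ L x)`: the two agree classically, but constructively the
-- latter would also admit languages that are not ¬¬-stable.
InCoNP : Language → Set₁
InCoNP L = Σ Language λ A → InNP A × (∀ x → L x ⇔ (¬ A x))

_≤ₚ_ : Language → Language → Set₁
A ≤ₚ B = ∃[ f ] PolyTime f × (∀ x → A x ⇔ B (f x))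

NPHard : Language → Set₁
NPHard L = ∀ A → InNP A → A ≤ₚ L

CoNPHard : Language → Set₁
CoNPHard L = ∀ A → InCoNP A → A ≤ₚ L

CoNPComplete : Language → Set₁
CoNPComplete L = InCoNP L × CoNPHard L

record Graph : Set where
  field
    order : ℕ
    adj   : Fin order → Fin order → Bool
    adj-sym    : ∀ u v → adj u v ≡ adj v u
    adj-irrefl : ∀ v → adj v v ≡ false

  Vertex : Set
  Vertex = Fin order

  Adjacent : Vertex → Vertex → Set
  Adjacent u v = adj u v ≡ true

module _ (G : Graph) where
  open Graph G

  IsIndependent : Pred Vertex 0ℓ → Set
  IsIndependent P = ∀ {u v} → P u → P v → ¬ Adjacent u v

  IsClique : Pred Vertex 0ℓ → Set
  IsClique P = ∀ {u v} → P u → P v → u ≢ v → Adjacent u v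

  IsMaximalIndependent : Subset order → Set
  IsMaximalIndependent S =
    IsIndependent (_∈ S) × (∀ T → IsIndependent (_∈ T) → S ⊆ T → T ⊆ S)

  WellCovered : Set
  WellCovered = ∀ S T → IsMaximalIndependent S → IsMaximalIndependent T → ∣ S ∣ ≡ ∣ T ∣

  -- Parts are labelled, and may be empty because `part` need not be onto.
  record Partition (r ℓ : ℕ) : Set where
    field
      part        : Vertex → Fin r ⊎ Fin ℓ
      independent : ∀ i → IsIndependent (λ v → part v ≡ inj₁ i)
      clique      : ∀ j → IsClique (λ v → part v ≡ inj₂ j)

unary : ℕ → List Bool
unary n = replicate n true ++ [ false ]

encodeGraph : Graph → List Bool
encodeGraph G = unary order ++ concat (tabulate λ u → tabulate λ v → adj u v)
  where open Graph G

encodePart : ∀ {r ℓ} → Fin r ⊎ Fin ℓ → List Bool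
encodePart (inj₁ i) = false ∷ unary (toℕ i)
encodePart (inj₂ j) = true  ∷ unary (toℕ j)

encodePartitioned : ∀ {r ℓ} (G : Graph) → Partition G r ℓ → List Bool
encodePartitioned G π = encodeGraph G ++ concat (tabulate λ v → encodePart (part v))
  where open Partition π

rℓwc-g : ℕ → ℕ → Language
rℓwc-g r ℓ x = ∃[ G ] encodeGraph G ≡ x × Partition G r ℓ × WellCovered G

-- The partition is part of the instance; as usual for languages, strings
-- that do not encode a graph with an (r,ℓ)-partition are non-members.
wc-rℓg : ℕ → ℕ → Language
wc-rℓg r ℓ x =
  ∃[ G ] Σ (Partition G r ℓ) λ π → encodePartitioned G π ≡ x × WellCovered G

{-# OPTIONS --safe #-}
module Submission where

-- Adding an empty part does not change the encoding of a partition.  For the first claim the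
-- reduction therefore only has to discard the strings that use a part number out of range, and
-- it remains to put the new problems into coNP, by a verifier for counterexamples.
--
-- For a further clique, take the disjoint union of G and K_{r+1}.  Some vertex of K_{r+1} lies
-- in one of the ℓ + 1 cliques, which then contains no vertex of G.
--
-- For a further independent set, add ℓ + 1 isolated vertices, which is harmless as r ≥ 1, and
-- join the result G′ with k isolated vertices, where k is the size of a maximal independent set
-- of G′ found greedily.  As k > ℓ, one of the new vertices lies in an independent part, which
-- then contains no vertex of G′.  The maximal independent sets of the join are those of G′ and
-- the set of all new vertices, and k is the size of the former if G′ is well-covered.
--
-- The Turing machines are compiled from a language of programs on stacks whose only loop
-- iterates its body as many times as the input has bits.

open import Defs
open import Data.Bool using (Bool; true; false; not; _∧_; _∨_; _xor_; if_then_else_)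
import Data.Bool.Properties as Bool
open import Data.Empty using (⊥-elim)
open import Data.Fin using (Fin; #_; inject₁; zero; suc; toℕ; _↑ˡ_; _↑ʳ_; punchIn; punchOut)
import Data.Fin.Properties as Fin
open import Data.Fin.Subset using (Subset; ∣_∣; _∈_)
open import Data.Fin.Subset.Properties using (∣p∣≤n)
open import Data.List as List using (List; []; _∷_; [_]; _++_; length; replicate; reverse; _ʳ++_; concat; drop)
import Data.List.Properties as List
open import Data.Maybe as Maybe using (Maybe; just; nothing)
open import Data.Nat using (ℕ; zero; suc; _+_; _*_; _≤_; _<_; z≤n; s≤s)
import Data.Nat.Properties as ℕ
open import Data.Product as Product using (Σ; ∃-syntax; _×_; _,_; proj₁; proj₂)
open import Data.Sum as Sum using (_⊎_; inj₁; inj₂)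
open import Data.Sum.Properties using (inj₁-injective; inj₂-injective)
open import Data.Sum.Function.Propositional using (_⊎-↔_)
open import Data.Nat.Solver using (module +-*-Solver)
open import Data.Unit using (⊤; tt)
open import Data.Vec as Vec using (Vec; []; _∷_; _[_]%=_; lookup; toList)
import Data.Vec.Properties as Vec
open import Data.Vec.Relation.Unary.All using (All; []; _∷_)
open import Function using (_∘_; id; _⇔_; mk⇔; _↔_; Equivalence)
open import Function.Construct.Composition using (_↔-∘_; _⇔-∘_)
open import Function.Construct.Identity using (↔-id)
open import Function.Construct.Symmetry using (↔-sym; ⇔-sym)
open import Relation.Binary.PropositionalEquality using (_≡_; _≢_; refl; sym; trans; cong; cong₂; subst; module ≡-Reasoning)
open import Relation.Binary.Definitions using (tri<; tri≈; tri>)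
open import Relation.Nullary using (¬_; Dec; yes; no; does; contradiction)
open import Relation.Nullary.Decidable using (dec-true; dec-false)

-- A language consists of strings, so a reduction also has to treat strings that encode no instance.
-- The programs only recognise the syntax `Shape`, a square Boolean matrix followed, where required,
-- by part codes in range, and send every other string to the empty string, which encodes nothing.
-- Symmetry and irreflexivity are not tested by the reductions: every transformation of matrices
-- preserves and reflects them. For membership in coNP their failure is one more kind of
-- counterexample. Maximal independent sets are replaced by independent dominating sets (`Kernel`),
-- a notion that does not quantify over sets and can be tested vertex by vertex. The number k of
-- joined vertices cannot be a constant, since it has to equal the size of the maximal independent
-- sets of G′. One such set is enough to find it: if G′ is not well-covered, the join is not
-- well-covered for any k. The numbers r + 1 and ℓ + 1 come from the pigeonhole principle, and r ≥ 1
-- provides an independent part for the isolated vertices.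

-- Machines and their combinators

-- Turing machines with the number of tapes as an index, so that they can be combined and given
-- further tapes; `toTM` and `fromTM` translate.
record Machine (m : ℕ) : Set₁ where
  field
    State  : Set
    size   : ℕ
    finite : State ↔ Fin size
    start  : State
    δ      : State → Vec Symbol m → Maybe (State × Vec (Symbol × Move) m)

open Machine

data Run {m} (M : Machine m) : State M → Vec Tape m → ℕ → Vec Tape m → Set where
  halt : ∀ {q ts} → δ M q (Vec.map head ts) ≡ nothing → Run M q ts 0 ts
  step : ∀ {q ts q′ as t ts′} → δ M q (Vec.map head ts) ≡ just (q′ , as) →
         Run M q′ (Vec.zipWith act as ts) t ts′ → Run M q ts (suc t) ts′

infix 4 _⊢_↝_within_
record _⊢_↝_within_ {m} (M : Machine m) (ts ts′ : Vec Tape m) (b : ℕ) : Set where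
  constructor within
  field
    {time} : ℕ
    bound  : time ≤ b
    run    : Run M (start M) ts time ts′

relax : ∀ {m} {M : Machine m} {ts ts′ b b′} → b ≤ b′ → M ⊢ ts ↝ ts′ within b → M ⊢ ts ↝ ts′ within b′
relax b≤b′ (within t≤b r) = within (ℕ.≤-trans t≤b b≤b′) r

idle : ∀ {m} → Vec Symbol m → Vec (Symbol × Move) m
idle = Vec.map (_, stay)

act-idle : ∀ {m} (ts : Vec Tape m) → Vec.zipWith act (idle (Vec.map head ts)) ts ≡ ts
act-idle []       = refl
act-idle (t ∷ ts) = cong (t ∷_) (act-idle ts)

module _ {m} {A B : Machine m} (ι : State A → State B) where

  embed : (∀ q v → δ B (ι q) v ≡ Maybe.map (Product.map₁ ι) (δ A q v)) →
          ∀ {q ts t ts′} → Run A q ts t ts′ → Run B (ι q) ts t ts′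
  embed h {q} (halt e)   = halt (trans (h q _) (cong (Maybe.map _) e))
  embed h {q} (step e r) = step (trans (h q _) (cong (Maybe.map _) e)) (embed h r)

  -- `κ` takes over where A would halt: it is the start of a second machine or the test of a loop.
  -- The handover is an idle step, whence the `suc` in the time.
  chain : ∀ {κ} →
          (∀ {q v q′ as} → δ A q v ≡ just (q′ , as) → δ B (ι q) v ≡ just (ι q′ , as)) →
          (∀ {q v} → δ A q v ≡ nothing → δ B (ι q) v ≡ just (κ , idle v)) →
          ∀ {q ts t us t′ vs} → Run A q ts t us → Run B κ us t′ vs → Run B (ι q) ts (t + suc t′) vs
  chain {κ} h₁ h₂ {us = us} (halt e) s =
    step (h₂ e) (subst (λ ts → Run B κ ts _ _) (sym (act-idle us)) s)
  chain h₁ h₂ (step e r) s = step (h₁ e) (chain h₁ h₂ r s)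

once : ∀ {m} → (Vec Symbol m → Vec (Symbol × Move) m) → Machine m
once f = record
  { State = Fin 2 ; size = 2 ; finite = ↔-id _ ; start = zero
  ; δ = λ { zero v → just (suc zero , f v) ; (suc _) v → nothing } }

once-run : ∀ {m} (f : Vec Symbol m → Vec (Symbol × Move) m) ts →
           once f ⊢ ts ↝ Vec.zipWith act (f (Vec.map head ts)) ts within 1
once-run f ts = within ℕ.≤-refl (step refl (halt refl))

thenGo : ∀ {m} {Q Q′ : Set} → (Q → Q′) → Q′ → Vec Symbol m →
         Maybe (Q × Vec (Symbol × Move) m) → Maybe (Q′ × Vec (Symbol × Move) m)
thenGo ι κ v (just (q , as)) = just (ι q , as)
thenGo ι κ v nothing         = just (κ , idle v)

infixr 5 _⟫_
_⟫_ : ∀ {m} → Machine m → Machine m → Machine m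
A ⟫ B = record
  { State  = State A ⊎ State B
  ; size   = size A + size B
  ; finite = ↔-sym Fin.+↔⊎ ↔-∘ (finite A ⊎-↔ finite B)
  ; start  = inj₁ (start A)
  ; δ      = λ { (inj₁ q) v → thenGo inj₁ (inj₂ (start B)) v (δ A q v)
               ; (inj₂ q) v → Maybe.map (Product.map₁ inj₂) (δ B q v) } }

⟫-run : ∀ {m} {A B : Machine m} {ts us vs a b} →
        A ⊢ ts ↝ us within a → B ⊢ us ↝ vs within b → A ⟫ B ⊢ ts ↝ vs within a + suc b
⟫-run {A = A} {B} (within t≤a r) (within u≤b s) =
  within (ℕ.+-mono-≤ t≤a (s≤s u≤b))
    (chain {A = A} {A ⟫ B} inj₁ (λ e → cong (thenGo _ _ _) e) (λ e → cong (thenGo _ _ _) e) r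
      (embed {A = B} {A ⟫ B} inj₂ (λ q v → refl) s))

branch-on : ∀ {m} → (Vec Symbol m → Bool) → Machine m → Machine m → Machine m
branch-on c A B = record
  { State  = Fin 1 ⊎ (State A ⊎ State B)
  ; size   = 1 + (size A + size B)
  ; finite = ↔-sym Fin.+↔⊎ ↔-∘ (↔-id _ ⊎-↔ (↔-sym Fin.+↔⊎ ↔-∘ (finite A ⊎-↔ finite B)))
  ; start  = inj₁ zero
  ; δ      = λ { (inj₁ _) v → just (inj₂ (if c v then inj₁ (start A) else inj₂ (start B)) , idle v)
               ; (inj₂ (inj₁ q)) v → Maybe.map (Product.map₁ (inj₂ ∘ inj₁)) (δ A q v)
               ; (inj₂ (inj₂ q)) v → Maybe.map (Product.map₁ (inj₂ ∘ inj₂)) (δ B q v) } }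

branch-run : ∀ {m} (c : Vec Symbol m → Bool) {A B : Machine m} {ts us a} →
             (if c (Vec.map head ts) then A else B) ⊢ ts ↝ us within a →
             branch-on c A B ⊢ ts ↝ us within suc a
branch-run c {A} {B} {ts} r with c (Vec.map head ts) in e | r
... | true  | within t≤a s = within (s≤s t≤a) (step
  (cong (λ b → just (inj₂ (if b then inj₁ (start A) else inj₂ (start B)) , _)) e)
  (subst (λ us → Run _ _ us _ _) (sym (act-idle ts))
    (embed {A = A} {branch-on c A B} (inj₂ ∘ inj₁) (λ q v → refl) s)))
... | false | within t≤a s = within (s≤s t≤a) (step
  (cong (λ b → just (inj₂ (if b then inj₁ (start A) else inj₂ (start B)) , _)) e)
  (subst (λ us → Run _ _ us _ _) (sym (act-idle ts))
    (embed {A = B} {branch-on c A B} (inj₂ ∘ inj₂) (λ q v → refl) s)))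

while : ∀ {m} → (Vec Symbol m → Bool) → Machine m → Machine m
while c A = record
  { State  = Fin 1 ⊎ State A
  ; size   = 1 + size A
  ; finite = ↔-sym Fin.+↔⊎ ↔-∘ (↔-id _ ⊎-↔ finite A)
  ; start  = inj₁ zero
  ; δ      = λ { (inj₁ _) v → if c v then just (inj₂ (start A) , idle v) else nothing
               ; (inj₂ q) v → thenGo inj₂ (inj₁ zero) v (δ A q v) } }

while-stop : ∀ {m} (c : Vec Symbol m → Bool) {A : Machine m} {ts} →
             c (Vec.map head ts) ≡ false → while c A ⊢ ts ↝ ts within 0
while-stop c e = within z≤n (halt (cong (if_then _ else nothing) e))

while-step : ∀ {m} (c : Vec Symbol m → Bool) {A : Machine m} {ts us vs a b} →
             c (Vec.map head ts) ≡ true → A ⊢ ts ↝ us within a → while c A ⊢ us ↝ vs within b →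
             while c A ⊢ ts ↝ vs within suc a + suc b
while-step c {A} {ts} e (within t≤a r) (within u≤b s) =
  within (s≤s (ℕ.+-mono-≤ t≤a (s≤s u≤b)))
    (step (cong (if_then _ else nothing) e)
      (subst (λ us → Run _ _ us _ _) (sym (act-idle ts))
        (chain {A = A} {while c A} inj₂ (λ e → cong (thenGo _ _ _) e) (λ e → cong (thenGo _ _ _) e) r s)))

-- The new tape is inserted behind the first one, which carries input and output.
insertTape : ∀ {m} → Machine (suc m) → Machine (suc (suc m))
insertTape M = record
  { State = State M ; size = size M ; finite = finite M ; start = start M
  ; δ = λ { q (s ∷ c ∷ v) → Maybe.map (λ { (q′ , a ∷ as) → q′ , a ∷ (c , stay) ∷ as }) (δ M q (s ∷ v)) } }

insertTape-run : ∀ {m} {M : Machine (suc m)} {q t ts n t′ ts′ c} →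
                 Run M q (t ∷ ts) n (t′ ∷ ts′) → Run (insertTape M) q (t ∷ c ∷ ts) n (t′ ∷ c ∷ ts′)
insertTape-run (halt e) = halt (cong (Maybe.map _) e)
insertTape-run {M = M} (step {as = a ∷ as} e r) = step (cong (Maybe.map _) e) (insertTape-run {M = M} r)

insertTapes : ∀ e {m} → Machine (suc m) → Machine (suc (e + m))
insertTapes zero    M = M
insertTapes (suc e) M = insertTape (insertTapes e M)

insertTapes-run : ∀ {e m} {M : Machine (suc m)} {t ts b t′ ts′} (us : Vec Tape e) →
                  M ⊢ t ∷ ts ↝ t′ ∷ ts′ within b →
                  insertTapes e M ⊢ t ∷ us Vec.++ ts ↝ t′ ∷ us Vec.++ ts′ within b
insertTapes-run []       r = r
insertTapes-run {suc e} {M = M} (u ∷ us) r with insertTapes-run us r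
... | within t≤b s = within t≤b (insertTape-run {M = insertTapes e M} s)

toTM : ∀ {w} → Machine (suc w) → TM
toTM {w} M = record
  { State = State M ; size = size M ; finite = finite M ; workTapes = w ; start = start M ; δ = δ M }

fromTM : (M : TM) → Machine (TM.tapes M)
fromTM M = record
  { State = TM.State M ; size = TM.size M ; finite = TM.finite M ; start = TM.start M ; δ = TM.δ M }

toTM-run : ∀ {w} (M : Machine (suc w)) {q ts t ts′} →
           Run M q ts t ts′ → TM._⇓[_]_ (toTM M) (q , ts) t ts′
toTM-run M (halt e)   = TM.halt e
toTM-run M (step e r) = TM.step e (toTM-run M r)

fromTM-run : ∀ (M : TM) {q ts t ts′} → TM._⇓[_]_ M (q , ts) t ts′ → Run (fromTM M) q ts t ts′
fromTM-run M (TM.halt e)   = halt e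
fromTM-run M (TM.step e r) = step e (fromTM-run M r)

-- Tapes as pairs of stacks

-- Only the cells up to the nearest blank on either side are specified, so remains of earlier
-- computations beyond these blanks do no harm.
data Zip (L R : List Bool) (t : Tape) : Set where
  zip : leadingBits (before t) ≡ L → outputTape t ≡ R → Zip L R t

-- One step to the left of `Zip L R`.
data Left : List Bool → List Bool → Tape → Set where
  off : ∀ {R t} → head t ≡ blank → leadingBits (after t) ≡ R → Left [] R t
  on  : ∀ {b L R t} → Zip L (b ∷ R) t → Left (b ∷ L) R t

goLeft goRight : Tape → Tape
goLeft  t = act (head t , left) t
goRight t = act (head t , right) t

nonblank : Symbol → Bool
nonblank (just _) = true
nonblank blank    = false

right-zip : ∀ {b L R t} → Zip L (b ∷ R) t → Zip (b ∷ L) R (goRight t)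
right-zip {t = tape B (just b) []}      (zip refl refl) = zip refl refl
right-zip {t = tape B (just b) (_ ∷ _)} (zip refl refl) = zip refl refl

right-off : ∀ {R t} → Left [] R t → Zip [] R (goRight t)
right-off {t = tape B blank []}      (off refl refl) = zip refl refl
right-off {t = tape B blank (_ ∷ _)} (off refl refl) = zip refl refl

left-zip : ∀ {L R t} → Zip L R t → Left L R (goLeft t)
left-zip {t = tape []           h a} (zip refl refl) = off refl refl
left-zip {t = tape (blank ∷ B)  h a} (zip refl refl) = off refl refl
left-zip {t = tape (just b ∷ B) h a} (zip refl refl) = on (zip refl refl)

zip-head : ∀ {L b R t} → Zip L (b ∷ R) t → nonblank (head t) ≡ true
zip-head {t = tape B (just b) _} (zip _ refl) = refl

zip-head-blank : ∀ {L t} → Zip L [] t → head t ≡ blank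
zip-head-blank {t = tape B blank _} (zip _ refl) = refl

module _ {m} (c : Vec Symbol m → Bool) (f : Vec Symbol m → Vec (Symbol × Move) m)
         (place : Tape → Vec Tape m)
         (c-place : ∀ t → c (Vec.map head (place t)) ≡ nonblank (head t))
         (f-place : ∀ t → Vec.zipWith act (f (Vec.map head (place t))) (place t) ≡ place (goLeft t)) where

  -- `place` says where the moving tape sits among the others. The same argument thus serves a loop
  -- counter, several copies moved in lockstep, and the output tape. Each cell costs three steps:
  -- test, move, handover.
  sweepLeft : ∀ L {R t} → Left L R t →
              ∃[ t′ ] Left [] (L ʳ++ R) t′ × while c (once f) ⊢ place t ↝ place t′ within length L * 3
  sweepLeft [] {t = t} l@(off e _) = t , l , while-stop c (trans (c-place t) (cong nonblank e))
  sweepLeft (b ∷ L) {t = t} (on z) with sweepLeft L (left-zip z)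
  ... | t′ , l , r = t′ , l , while-step c (trans (c-place t) (zip-head z))
    (subst (λ ts → once f ⊢ place t ↝ ts within 1) (f-place t) (once-run f (place t))) r

-- Stack programs

-- `loop` iterates its body N times, where N is the length of the input, so that every
-- program runs in polynomial time.  The index d bounds the nesting of loops: each level
-- has a tape of its own for counting.
infixr 5 _⨾_
data Prog (k : ℕ) : ℕ → Set where
  skip : ∀ {d} → Prog k d
  push : ∀ {d} → Fin k → Bool → Prog k d
  pop  : ∀ {d} → Fin k → Prog k d
  emit : ∀ {d} → Bool → Prog k d
  _⨾_  : ∀ {d} → Prog k d → Prog k d → Prog k d
  case : ∀ {d} → Fin k → Prog k d → (Bool → Prog k d) → Prog k d
  loop : ∀ {d} → Prog k d → Prog k (suc d)

-- The registers, and the output written so far.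
Store : ℕ → Set
Store k = Vec (List Bool) k × List Bool

peek : ∀ {A : Set} → List Bool → A → (Bool → A) → A
peek []      a f = a
peek (b ∷ _) a f = f b

iter : ∀ {A : Set} → ℕ → (A → A) → A → A
iter zero    f a = a
iter (suc n) f a = iter n f (f a)

exec : ∀ {k d} → ℕ → Prog k d → Store k → Store k
exec N skip         st = st
exec N (push i b)   (s , o) = s [ i ]%= (b ∷_) , o
exec N (pop i)      (s , o) = s [ i ]%= drop 1 , o
exec N (emit b)     (s , o) = s , o ++ [ b ]
exec N (p ⨾ q)      st = exec N q (exec N p st)
exec N (case i p q) st = peek (lookup (proj₁ st) i) (exec N p st) (λ b → exec N (q b) st)
exec N (loop p)     st = iter N (exec N p) st

infixl 6 _⊕_
_⊕_ : Polynomial → Polynomial → Polynomial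
[]      ⊕ q       = q
(a ∷ p) ⊕ []      = a ∷ p
(a ∷ p) ⊕ (b ∷ q) = (a + b) ∷ (p ⊕ q)

-- A round of a loop costs 4 besides its body (test, counter step, two handovers), and each of the N
-- counter cells costs 3 more on the way back; the remaining 5 are two single moves and three
-- handovers. For `case`, the sum over all branches bounds each of them.
cost : ∀ {k d} → Prog k d → Polynomial
cost skip         = [ 1 ]
cost (push i b)   = [ 3 ]
cost (pop i)      = [ 1 ]
cost (emit b)     = [ 1 ]
cost (p ⨾ q)      = cost p ⊕ [ 1 ] ⊕ cost q
cost (case i p q) = [ 2 ] ⊕ cost p ⊕ (cost (q true) ⊕ cost (q false))
cost (loop p)     = [ 5 ] ⊕ (0 ∷ ([ 7 ] ⊕ cost p))

eval-⊕ : ∀ p q n → eval (p ⊕ q) n ≡ eval p n + eval q n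
eval-⊕ []      q       n = refl
eval-⊕ (a ∷ p) []      n = sym (ℕ.+-identityʳ _)
eval-⊕ (a ∷ p) (b ∷ q) n rewrite eval-⊕ p q n =
  solve 5 (λ a b n x y → a :+ b :+ n :* (x :+ y) := a :+ n :* x :+ (b :+ n :* y)) refl a b n (eval p n)
    (eval q n)
  where open +-*-Solver

popAction : Symbol → Symbol × Move
popAction blank    = blank , stay
popAction (just _) = blank , right

push-tape : ∀ b t → outputTape (act (just b , stay) (goLeft t)) ≡ b ∷ outputTape t
push-tape b (tape []      h a) = refl
push-tape b (tape (_ ∷ _) h a) = refl

pop-tape : ∀ t → outputTape (act (popAction (head t)) t) ≡ drop 1 (outputTape t)
pop-tape (tape b blank    a)       = refl
pop-tape (tape b (just _) [])      = refl
pop-tape (tape b (just _) (_ ∷ _)) = refl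

emit-tape : ∀ b t → leadingBits (before (act (just b , right) t)) ≡ b ∷ leadingBits (before t)
emit-tape b (tape _ _ [])      = refl
emit-tape b (tape _ _ (_ ∷ _)) = refl

head-peek : ∀ t → head t ≡ peek (outputTape t) blank just
head-peek (tape _ blank    _) = refl
head-peek (tape _ (just _) _) = refl

onTape : ∀ {m} → Fin m → (Symbol → Symbol × Move) → Vec Symbol m → Vec (Symbol × Move) m
onTape i f v = idle v [ i ]%= (f ∘ proj₁)

act-onTape : ∀ {m} (i : Fin m) f ts →
             Vec.zipWith act (onTape i f (Vec.map head ts)) ts ≡ ts [ i ]%= (λ t → act (f (head t)) t)
act-onTape zero    f (t ∷ ts) = cong (_ ∷_) (act-idle ts)
act-onTape (suc i) f (t ∷ ts) = cong (t ∷_) (act-onTape i f ts)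

updateAt-++ˡ : ∀ {A : Set} {m n} (xs : Vec A m) (ys : Vec A n) i f →
               (xs Vec.++ ys) [ i ↑ˡ n ]%= f ≡ xs [ i ]%= f Vec.++ ys
updateAt-++ˡ (x ∷ xs) ys zero    f = refl
updateAt-++ˡ (x ∷ xs) ys (suc i) f = cong (x ∷_) (updateAt-++ˡ xs ys i f)

onWork : ∀ {m} → (Vec Symbol m → Vec (Symbol × Move) m) → Machine (suc m)
onWork f = once λ { (s ∷ v) → (s , stay) ∷ f v }

nonblankAt isTrueAt : ∀ {m} → Fin m → Vec Symbol m → Bool
nonblankAt i v = nonblank (lookup v i)
isTrueAt   i v = Maybe.maybe id false (lookup v i)

module _ {k : ℕ} (w : ℕ) where

  reg : ∀ d → Fin k → Fin (suc (d + (k + w)))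
  reg d i = suc (d ↑ʳ (i ↑ˡ w))

  -- The first tape receives the output; it is followed by `d` loop counters, `k` registers, and `w`
  -- tapes left over from the machine that produced the input, on which nothing is changed.
  compile : ∀ {d} → Prog k d → Machine (suc (d + (k + w)))
  compile     skip         = once idle
  compile {d} (push i b)   = insertTapes d (onWork (onTape (i ↑ˡ w) (_, left)) ⟫
                                            onWork (onTape (i ↑ˡ w) (λ _ → just b , stay)))
  compile {d} (pop i)      = insertTapes d (onWork (onTape (i ↑ˡ w) popAction))
  compile     (emit b)     = once (onTape zero (λ _ → just b , right))
  compile     (p ⨾ q)      = compile p ⟫ compile q
  compile {d} (case i p q) = branch-on (nonblankAt (reg d i))
                               (branch-on (isTrueAt (reg d i)) (compile (q true)) (compile (q false)))
                               (compile p)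
  -- One step to the right per round leads the counter through its N bits to the blank behind them.
  -- The rest brings its head back to the first bit, so that an enclosing loop can start this one
  -- again.
  compile     (loop p)     =
    while (nonblankAt counter) (once (onTape counter (_, right)) ⟫ insertTape (compile p)) ⟫
    once (onTape counter (_, left)) ⟫
    while (nonblankAt counter) (once (onTape counter (_, left))) ⟫
    once (onTape counter (_, right))
    where
    counter : ∀ {m} → Fin (suc (suc m))
    counter = suc zero

  module _ (N : ℕ) (junk : Vec (List Bool) w) where

    AtRest : Tape → Set
    AtRest t = ∃[ R ] Zip [] R t × length R ≡ N

    -- A register is what can be read from its head onwards, with the top of the stack under the
    -- head. The output stands to the left of the head of the first tape, hence in reverse.
    data Rep (d : ℕ) : Store k → Vec Tape (suc (d + (k + w))) → Set where
      rep : ∀ {s o t rs} (cs : Vec Tape d) → All AtRest cs →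
            Vec.map outputTape rs ≡ s Vec.++ junk → reverse (leadingBits (before t)) ≡ o →
            Rep d (s , o) (t ∷ cs Vec.++ rs)

    Computes : ∀ d → Machine (suc (d + (k + w))) → Store k → Store k → Vec Tape (suc (d + (k + w))) → ℕ → Set
    Computes d M st st′ ts b = ∃[ ts′ ] Rep d st′ ts′ × M ⊢ ts ↝ ts′ within b

    peek-reg : ∀ {d s o ts} (i : Fin k) → Rep d (s , o) ts →
               lookup (Vec.map head ts) (reg d i) ≡ peek (lookup s i) blank just
    peek-reg {d} {s} i (rep {t = t} {rs} cs _ e _) = begin
      lookup (Vec.map head (cs Vec.++ rs)) (d ↑ʳ (i ↑ˡ w))
        ≡⟨ Vec.lookup-map (d ↑ʳ (i ↑ˡ w)) head (cs Vec.++ rs) ⟩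
      head (lookup (cs Vec.++ rs) (d ↑ʳ (i ↑ˡ w)))
        ≡⟨ cong head (Vec.lookup-++ʳ cs rs (i ↑ˡ w)) ⟩
      head (lookup rs (i ↑ˡ w))
        ≡⟨ head-peek (lookup rs (i ↑ˡ w)) ⟩
      peek (outputTape (lookup rs (i ↑ˡ w))) blank just
        ≡⟨ cong (λ l → peek l blank just) (sym (Vec.lookup-map (i ↑ˡ w) outputTape rs)) ⟩
      peek (lookup (Vec.map outputTape rs) (i ↑ˡ w)) blank just
        ≡⟨ cong (λ v → peek (lookup v (i ↑ˡ w)) blank just) e ⟩
      peek (lookup (s Vec.++ junk) (i ↑ˡ w)) blank just
        ≡⟨ cong (λ l → peek l blank just) (Vec.lookup-++ˡ s junk i) ⟩
      peek (lookup s i) blank just ∎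
      where open ≡-Reasoning

    update-rep : ∀ {d s o t cs} {rs : Vec Tape (k + w)} (i : Fin k) {f : Tape → Tape} {g} →
                 (∀ t → outputTape (f t) ≡ g (outputTape t)) →
                 All AtRest cs → Vec.map outputTape rs ≡ s Vec.++ junk → reverse (leadingBits (before t)) ≡
                   o →
                 Rep d (s [ i ]%= g , o) (t ∷ cs Vec.++ rs [ i ↑ˡ w ]%= f)
    update-rep {s = s} {cs = cs} {rs} i {f} {g} h a e oe = rep cs a
      (trans (Vec.map-updateAt rs (i ↑ˡ w) (h _))
        (trans (cong (_[ i ↑ˡ w ]%= g) e) (updateAt-++ˡ s junk i g))) oe

    onWork-run : ∀ {m} f t (rs : Vec Tape m) →
                 onWork f ⊢ t ∷ rs ↝ t ∷ Vec.zipWith act (f (Vec.map head rs)) rs within 1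
    onWork-run f t rs = once-run _ (t ∷ rs)

    onReg-run : ∀ {m} i f t (rs : Vec Tape m) →
                onWork (onTape i f) ⊢ t ∷ rs ↝ t ∷ rs [ i ]%= (λ t → act (f (head t)) t) within 1
    onReg-run i f t rs = subst (λ us → _ ⊢ _ ↝ t ∷ us within 1) (act-onTape i f rs) (onWork-run _ t rs)

    onTape-run : ∀ {m} i f (ts : Vec Tape m) →
                 once (onTape i f) ⊢ ts ↝ ts [ i ]%= (λ t → act (f (head t)) t) within 1
    onTape-run i f ts = subst (λ us → _ ⊢ _ ↝ us within 1) (act-onTape i f ts) (once-run _ ts)

    module _ {d} {M : Machine (suc (d + (k + w)))} {f : Store k → Store k} {b}
             (M-run : ∀ {st ts} → Rep d st ts → Computes d M st (f st) ts b) where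

      counter : Fin (suc (suc (d + (k + w))))
      counter = suc zero

      -- Induction on the bits `R` that the counter has still to pass, one for each round to come.
      -- The tape of the counter is invisible to the body, which runs under `insertTape`.
      iterate-run : ∀ {L} R {st t c ts} → Zip L R c → Rep d st (t ∷ ts) →
        ∃[ c′ ] ∃[ t′ ] ∃[ ts′ ] Zip (R ʳ++ L) [] c′ × Rep d (iter (length R) f st) (t′ ∷ ts′) ×
          while (nonblankAt counter) (once (onTape counter (_, right)) ⟫ insertTape M)
            ⊢ t ∷ c ∷ ts ↝ t′ ∷ c′ ∷ ts′ within length R * (4 + b)
      iterate-run [] {t = t} {c} {ts} z r =
        c , t , ts , z , r , while-stop (nonblankAt counter) (cong nonblank (zip-head-blank z))
      iterate-run (x ∷ R) {t = t} {c} {ts} z r with M-run r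
      ... | t₁ ∷ ts₁ , r₁ , within t≤b s with iterate-run R (right-zip z) r₁
      ... | c′ , t′ , ts′ , z′ , r′ , s′ = c′ , t′ , ts′ , z′ , r′ ,
        relax (ℕ.≤-reflexive (solve 2 (λ b x → con 3 :+ b :+ (con 1 :+ x) := con 4 :+ b :+ x) refl b
          (length R * (4 + b))))
        (while-step (nonblankAt counter) (zip-head z)
          (⟫-run (onTape-run counter (_, right) (t ∷ c ∷ ts)) (within t≤b (insertTape-run {M = M} s))) s′)
        where open +-*-Solver

    -- The number of rounds is fixed by the counters and not by the registers, so the same N enters
    -- the bounds of all subprograms and no bound on the register contents is required.
    compile-run : ∀ {d} (p : Prog k d) {st ts} → Rep d st ts →
                  Computes d (compile p) st (exec N p st) ts (eval (cost p) N)
    compile-run skip {ts = ts} r = ts , r ,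
      subst (λ us → _ ⊢ ts ↝ us within _) (act-idle ts)
        (relax (s≤s z≤n) (once-run idle ts))
    compile-run (push i b) (rep {t = t} {rs} cs a e oe) = _ , 
      update-rep i (push-tape b) a e oe , 
      relax (ℕ.≤-reflexive (cong (3 +_) (sym (ℕ.*-zeroʳ N))))
      (insertTapes-run cs 
        (subst (λ us → _ ⊢ _ ↝ t ∷ us within 3) (Vec.updateAt-updateAt (i ↑ˡ w) rs)
        (⟫-run (onReg-run (i ↑ˡ w) (_, left) t rs) (onReg-run (i ↑ˡ w) (λ _ → just b , stay) t _))))
    compile-run (pop i) (rep {t = t} {rs} cs a e oe) = _ ,
      update-rep i pop-tape a e oe , relax (s≤s z≤n)
      (insertTapes-run cs (onReg-run (i ↑ˡ w) popAction t rs))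
    compile-run (emit b) (rep {t = t} {rs} cs a e refl) = _ ,
      rep cs a e (trans (cong reverse (emit-tape b t)) (List.unfold-reverse b (leadingBits (before t)))) ,
      relax (s≤s z≤n) (onTape-run zero (λ _ → just b , right) (t ∷ cs Vec.++ rs))
    compile-run (p ⨾ q) r with compile-run p r
    ... | us , r₁ , s₁ with compile-run q r₁
    ... | vs , r₂ , s₂ = vs , r₂ , relax (ℕ.≤-reflexive eq) (⟫-run s₁ s₂)
      where
      eq : eval (cost p) N + suc (eval (cost q) N) ≡ eval (cost p ⊕ [ 1 ] ⊕ cost q) N
      eq rewrite eval-⊕ (cost p ⊕ [ 1 ]) (cost q) N | eval-⊕ (cost p) [ 1 ] N | ℕ.*-zeroʳ N =
        solve 2 (λ a b → a :+ (con 1 :+ b) := a :+ con 1 :+ b) refl (eval (cost p) N) (eval (cost q) N)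
        where open +-*-Solver
    compile-run {d} (case i p q) {s , o} {ts} r = go (peek-reg i r)
      where
      eq : eval (cost (case i p q)) N ≡
        2 + eval (cost p) N + (eval (cost (q true)) N + eval (cost (q false)) N)
      eq rewrite eval-⊕ ([ 2 ] ⊕ cost p) (cost (q true) ⊕ cost (q false)) N | eval-⊕ [ 2 ] (cost p) N
               | eval-⊕ (cost (q true)) (cost (q false)) N | ℕ.*-zeroʳ N = refl

      c₁ c₂ : Vec Symbol (suc (d + (k + w))) → Bool
      c₁ = nonblankAt (reg d i)
      c₂ = isTrueAt (reg d i)

      p-bound : suc (eval (cost p) N) ≤ eval (cost (case i p q)) N
      p-bound = ℕ.≤-trans (ℕ.n≤1+n _) (ℕ.≤-trans (ℕ.m≤m+n _ _) (ℕ.≤-reflexive (sym eq)))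

      true-bound : 2 + eval (cost (q true)) N ≤ eval (cost (case i p q)) N
      true-bound = ℕ.≤-trans (ℕ.+-mono-≤ (ℕ.m≤m+n 2 (eval (cost p) N)) (ℕ.m≤m+n _ _)) (ℕ.≤-reflexive (sym eq))

      false-bound : 2 + eval (cost (q false)) N ≤ eval (cost (case i p q)) N
      false-bound = ℕ.≤-trans (ℕ.+-mono-≤ (ℕ.m≤m+n 2 (eval (cost p) N)) (ℕ.m≤n+m _ _))
        (ℕ.≤-reflexive (sym eq))

      if-true : ∀ {c} {A B : Machine (suc (d + (k + w)))} {us b} → c ≡ true → A ⊢ ts ↝ us within b →
        (if c then A else B) ⊢ ts ↝ us within b
      if-true refl x = x

      if-false : ∀ {c} {A B : Machine (suc (d + (k + w)))} {us b} → c ≡ false → B ⊢ ts ↝ us within b →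
        (if c then A else B) ⊢ ts ↝ us within b
      if-false refl x = x

      go : lookup (Vec.map head ts) (reg d i) ≡ peek (lookup s i) blank just →
           Computes d (compile (case i p q)) (s , o) (exec N (case i p q) (s , o)) ts
             (eval (cost (case i p q)) N)
      go e with lookup s i
      ... | [] with compile-run p r
      ... | us , r′ , x = us , r′ , relax p-bound (branch-run c₁ (if-false (cong nonblank e) x))
      go e | true ∷ _ with compile-run (q true) r
      ... | us , r′ , x = us , r′ , relax true-bound
        (branch-run c₁ (if-true (cong nonblank e)
          (branch-run c₂ (if-true (cong (Maybe.maybe id false) e) x))))
      go e | false ∷ _ with compile-run (q false) r
      ... | us , r′ , x = us , r′ , relax false-bound
        (branch-run c₁ (if-true (cong nonblank e)
          (branch-run c₂ (if-false (cong (Maybe.maybe id false) e) x))))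
    compile-run (loop p) {st} (rep {t = t} {rs} (c ∷ cs) ((R , z , refl) ∷ a) e oe) with
      iterate-run (compile-run p) R z (rep {t = t} {rs} cs a e oe)
    ... | c₁ , _ , _ , z₁ , rep {t = t′} {rs′} cs′ a′ e′ oe′ , r₁ with
      sweepLeft (nonblankAt (suc zero)) (onTape (suc zero) (_, left)) (λ c → t′ ∷ c ∷ cs′ Vec.++ rs′)
        (λ t → refl) (λ t → act-onTape (suc zero) (_, left) (t′ ∷ t ∷ cs′ Vec.++ rs′)) (R ʳ++ [])
          (left-zip z₁)
    ... | c₂ , l₂ , r₂ = _ ,
      rep (goRight c₂ ∷ cs′) ((_ , right-off l₂ , rest) ∷ a′) e′ oe′ ,
      relax (ℕ.≤-reflexive eq)
      (⟫-run r₁ (⟫-run (onTape-run (suc zero) (_, left) (t′ ∷ c₁ ∷ cs′ Vec.++ rs′))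
        (⟫-run r₂ (onTape-run (suc zero) (_, right) (t′ ∷ c₂ ∷ cs′ Vec.++ rs′)))))
      where
      rest : length (reverse R ʳ++ []) ≡ length R
      rest = trans (List.length-reverse (reverse R)) (List.length-reverse R)
      eq : length R * (4 + eval (cost p) N) + suc (1 + suc (length (R ʳ++ []) * 3 + 2)) ≡
        eval (cost (loop p)) N
      eq rewrite eval-⊕ [ 7 ] (cost p) N | ℕ.*-zeroʳ N | List.length-reverse R =
        solve 2 (λ n c → n :* (con 4 :+ c) :+ (con 1 :+ (con 1 :+ (con 1 :+ (n :* con 3 :+ con 2))))
                   := con 5 :+ n :* (con 7 :+ c)) refl (length R) (eval (cost p) N)
        where open +-*-Solver

-- Products and composition of polynomials

infixl 7 _⊗_
_⊗_ : Polynomial → Polynomial → Polynomial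
[]      ⊗ q = []
(a ∷ p) ⊗ q = List.map (a *_) q ⊕ (0 ∷ p ⊗ q)

_⟨_⟩ : Polynomial → Polynomial → Polynomial
[]      ⟨ q ⟩ = []
(a ∷ p) ⟨ q ⟩ = [ a ] ⊕ q ⊗ p ⟨ q ⟩

eval-scale : ∀ a p n → eval (List.map (a *_) p) n ≡ a * eval p n
eval-scale a []      n = sym (ℕ.*-zeroʳ a)
eval-scale a (b ∷ p) n rewrite eval-scale a p n =
  solve 4 (λ a b n x → a :* b :+ n :* (a :* x) := a :* (b :+ n :* x)) refl a b n (eval p n)
  where open +-*-Solver

eval-⊗ : ∀ p q n → eval (p ⊗ q) n ≡ eval p n * eval q n
eval-⊗ []      q n = refl
eval-⊗ (a ∷ p) q n rewrite eval-⊕ (List.map (a *_) q) (0 ∷ p ⊗ q) n | eval-scale a q n | eval-⊗ p q n =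
  solve 4 (λ a n x y → a :* y :+ n :* (x :* y) := (a :+ n :* x) :* y) refl a n (eval p n) (eval q n)
  where open +-*-Solver

eval-⟨⟩ : ∀ p q n → eval (p ⟨ q ⟩) n ≡ eval p (eval q n)
eval-⟨⟩ []      q n = refl
eval-⟨⟩ (a ∷ p) q n rewrite eval-⊕ [ a ] (q ⊗ p ⟨ q ⟩) n | eval-⊗ q (p ⟨ q ⟩) n | eval-⟨⟩ p q n | ℕ.*-zeroʳ n =
  cong (_+ eval q n * eval p (eval q n)) (ℕ.+-identityʳ a)

eval-mono : ∀ p {m n} → m ≤ n → eval p m ≤ eval p n
eval-mono []      m≤n = z≤n
eval-mono (a ∷ p) m≤n = ℕ.+-monoʳ-≤ a (ℕ.*-mono-≤ m≤n (eval-mono p m≤n))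

-- Space used by a run

usedCells : Tape → ℕ
usedCells t = length (before t) + length (after t)

act-usedCells : ∀ a t → usedCells (act a t) ≤ suc (usedCells t)
act-usedCells (s , left)  (tape []      h a)       = ℕ.≤-refl
act-usedCells (s , left)  (tape (_ ∷ b) h a)       =
  ℕ.≤-trans (ℕ.≤-reflexive (ℕ.+-suc (length b) _)) (ℕ.n≤1+n _)
act-usedCells (s , stay)  t                        = ℕ.n≤1+n _
act-usedCells (s , right) (tape b       h [])      = ℕ.≤-refl
act-usedCells (s , right) (tape b       h (_ ∷ a)) = s≤s (ℕ.+-monoʳ-≤ (length b) (ℕ.n≤1+n _))

-- A step uses at most one new cell. This bounds the output of a machine by its running time, and so
-- the input of a program that is run on this output.
run-usedCells : ∀ {m} {M : Machine (suc m)} {q ts n ts′} → Run M q ts n ts′ →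
                usedCells (Vec.head ts′) ≤ n + usedCells (Vec.head ts)
run-usedCells (halt e) = ℕ.≤-refl
run-usedCells {M = M} {ts = t ∷ ts} (step {as = a ∷ as} {t = n} e r) =
  ℕ.≤-trans (run-usedCells {M = M} r)
    (ℕ.≤-trans (ℕ.+-monoʳ-≤ n (act-usedCells a t)) (ℕ.≤-reflexive (ℕ.+-suc n _)))

length-leadingBits : ∀ ss → length (leadingBits ss) ≤ length ss
length-leadingBits []            = z≤n
length-leadingBits (blank ∷ _)   = z≤n
length-leadingBits (just _ ∷ ss) = s≤s (length-leadingBits ss)

length-outputTape : ∀ t → length (outputTape t) ≤ suc (usedCells t)
length-outputTape t = ℕ.≤-trans (length-leadingBits (head t ∷ after t)) (s≤s (ℕ.m≤n+m _ _))

usedCells-inputTape : ∀ x → usedCells (inputTape x) ≤ length x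
usedCells-inputTape []      = z≤n
usedCells-inputTape (b ∷ x) = ℕ.≤-trans (ℕ.≤-reflexive (List.length-map just x)) (ℕ.n≤1+n _)

leadingBits-just : ∀ x → leadingBits (List.map just x) ≡ x
leadingBits-just []      = refl
leadingBits-just (b ∷ x) = cong (b ∷_) (leadingBits-just x)

-- Loading the input and rewinding the output

copies : ∀ d {m} → Tape → Vec Tape m → Vec Tape (d + suc m)
copies d t ts = Vec.replicate d t Vec.++ t ∷ ts

onCopies : ∀ d {m} → (Symbol → Symbol × Move) → Vec Symbol (d + suc m) → Vec (Symbol × Move) (d + suc m)
onCopies zero    f (s ∷ v) = f s ∷ idle v
onCopies (suc d) f (s ∷ v) = f s ∷ onCopies d f v

act-onCopies : ∀ d {m} f t (ts : Vec Tape m) →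
               Vec.zipWith act (onCopies d f (Vec.map head (copies d t ts))) (copies d t ts) ≡
                 copies d (act (f (head t)) t) ts
act-onCopies zero    f t ts = cong (_ ∷_) (act-idle ts)
act-onCopies (suc d) f t ts = cong (_ ∷_) (act-onCopies d f t ts)

lookup-copies : ∀ d {m} t (ts : Vec Tape m) → lookup (Vec.map head (copies d t ts)) (d ↑ʳ zero) ≡ head t
lookup-copies zero    t ts = refl
lookup-copies (suc d) t ts = lookup-copies d t ts

module _ (d : ℕ) {m : ℕ} where

  copyStep : Vec Symbol (suc (d + suc m)) → Vec (Symbol × Move) (suc (d + suc m))
  copyStep (s ∷ v) = (s , right) ∷ onCopies d (λ _ → s , right) v

  stepsWith : (Symbol → Symbol × Move) → (Symbol → Symbol × Move) →
              Vec Symbol (suc (d + suc m)) → Vec (Symbol × Move) (suc (d + suc m))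
  stepsWith f g (s ∷ v) = f s ∷ onCopies d g v

  -- Copies the input from the first tape to the counters and the first register.  The
  -- blank left behind on the first tape will delimit the output on its left.
  load : Machine (suc (d + suc m))
  load = while (nonblankAt zero) (once copyStep) ⟫
         once (stepsWith (λ _ → blank , right) (_, left)) ⟫
         while (nonblankAt (suc (d ↑ʳ zero))) (once (stepsWith (_, stay) (_, left))) ⟫
         once (stepsWith (_, stay) (_, right))

  stepsWith-run : ∀ f g t c (rs : Vec Tape m) →
                  once (stepsWith f g) ⊢ t ∷ copies d c rs ↝ act (f (head t)) t ∷ copies d
                    (act (g (head c)) c) rs within 1
  stepsWith-run f g t c rs = subst (λ us → _ ⊢ t ∷ copies d c rs ↝ _ ∷ us within 1) (act-onCopies d g c rs)
    (once-run _ _)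

  copy-run : ∀ x {L t} (rs : Vec Tape m) → outputTape t ≡ x →
    ∃[ t′ ] head t′ ≡ blank ×
      while (nonblankAt zero) (once copyStep) ⊢ t ∷ copies d (tape (List.map just L) blank []) rs
        ↝ t′ ∷ copies d (tape (List.map just (x ʳ++ L)) blank []) rs within length x * 3
  copy-run [] {t = t} rs e = t , h e , while-stop (nonblankAt zero) (cong nonblank (h e))
    where
    h : outputTape t ≡ [] → head t ≡ blank
    h e = trans (head-peek t) (cong (λ l → peek l blank just) e)
  copy-run (b ∷ x) {L} {t} rs e with copy-run x {b ∷ L} {goRight t} rs (tail t e)
    where
    tail : ∀ t → outputTape t ≡ b ∷ x → outputTape (goRight t) ≡ x
    tail (tape _ (just _) [])      refl = refl
    tail (tape _ (just _) (_ ∷ _)) refl = refl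
  ... | t′ , e′ , r = t′ , e′ , while-step (nonblankAt zero) (cong nonblank he)
      (subst (λ us → once copyStep ⊢ t ∷ copies d c rs ↝ goRight t ∷ us within 1)
        (trans (act-onCopies d _ c rs) (cong (λ s → copies d (act (s , right) c) rs) he))
        (once-run copyStep (t ∷ copies d c rs))) r
    where
    c = tape (List.map just L) blank []
    he : head t ≡ just b
    he = trans (head-peek t) (cong (λ l → peek l blank just) e)

  load-run : ∀ {t} (rs : Vec Tape m) →
    ∃[ t′ ] ∃[ c ] leadingBits (before t′) ≡ [] × Zip [] (outputTape t) c ×
      load ⊢ t ∷ copies d blankTape rs ↝ t′ ∷ copies d c rs within 5 + length (outputTape t) * 6
  load-run {t} rs with copy-run (outputTape t) {[]} {t} rs refl
  -- All copies move in lockstep, so one of them can steer the sweep. The first register is chosen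
  -- because it exists even without any counters.
  ... | t₁ , e , r with sweepLeft (nonblankAt (suc (d ↑ʳ zero))) (stepsWith (_, stay) (_, left))
          (λ c → act (blank , right) t₁ ∷ copies d c rs) (λ c → cong nonblank (lookup-copies d c rs))
          (λ c → cong (_ ∷_) (act-onCopies d (_, left) c rs)) (outputTape t ʳ++ [])
          (left-zip {R = []} {t = tape (List.map just (outputTape t ʳ++ [])) blank []}
            (zip (leadingBits-just _) refl))
  ... | c , l , r₂ = act (blank , right) t₁ , goRight c , before-right t₁ ,
    subst (λ R → Zip [] R (goRight c)) (List.reverse-involutive (outputTape t)) (right-off l) ,
    relax (ℕ.≤-reflexive eq) (⟫-run r (⟫-run (stepsWith-run _ (_, left) t₁ _ rs)
      (⟫-run r₂ (stepsWith-run (_, stay) (_, right) (act (blank , right) t₁) c rs))))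
    where
    before-right : ∀ t → leadingBits (before (act (blank , right) t)) ≡ []
    before-right (tape _ _ [])      = refl
    before-right (tape _ _ (_ ∷ _)) = refl
    eq : length (outputTape t) * 3 + suc (1 + suc (length (outputTape t ʳ++ []) * 3 + 2)) ≡
      5 + length (outputTape t) * 6
    eq rewrite List.length-reverse (outputTape t) =
      solve 1 (λ n → n :* con 3 :+ (con 1 :+ (con 1 :+ (con 1 :+ (n :* con 3 :+ con 2)))) := con 5 :+ n :* con
        6)
        refl (length (outputTape t))
      where open +-*-Solver

-- The blank written at the head cuts off whatever stands to the right of the output; the sweep
-- stops at the blank that `load` has left on the other side.
rewind : ∀ {m} → Machine (suc m)
rewind = once (onTape zero (λ _ → blank , left)) ⟫
         while (nonblankAt zero) (once (onTape zero (_, left))) ⟫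
         once (onTape zero (_, right))

rewind-run : ∀ {m} t (ts : Vec Tape m) →
  ∃[ t′ ] outputTape t′ ≡ reverse (leadingBits (before t)) ×
    rewind ⊢ t ∷ ts ↝ t′ ∷ ts within 4 + usedCells t * 3
rewind-run t ts with sweepLeft (nonblankAt zero) (onTape zero (_, left)) (_∷ ts) (λ _ → refl)
    (λ c → act-onTape zero (_, left) (c ∷ ts)) (leadingBits (before t))
    (left-zip {t = write blank t} (zip refl refl))
... | c , l , r with right-off l
... | zip _ e = goRight c , e ,
  relax (ℕ.≤-trans (ℕ.≤-reflexive eq)
    (ℕ.+-monoʳ-≤ 4 (ℕ.*-monoˡ-≤ 3 (ℕ.≤-trans (length-leadingBits (before t)) (ℕ.m≤m+n _ _)))))
  (⟫-run (onTape-run₀ (λ _ → blank , left) t) (⟫-run r (onTape-run₀ (_, right) c)))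
  where
  onTape-run₀ : ∀ f t → once (onTape zero f) ⊢ t ∷ ts ↝ act (f (head t)) t ∷ ts within 1
  onTape-run₀ f t = subst (λ us → once (onTape zero f) ⊢ t ∷ ts ↝ us within 1) (act-onTape zero f (t ∷ ts))
    (once-run (onTape zero f) (t ∷ ts))
  eq : 1 + suc (length (leadingBits (before t)) * 3 + 2) ≡ 4 + length (leadingBits (before t)) * 3
  eq = cong (2 +_) (ℕ.+-comm _ 2)

then-rewind : ∀ {m} (A : Machine (suc m)) {x ws t ts T} → A ⊢ inputTape x ∷ ws ↝ t ∷ ts within T →
  ∃[ t′ ] outputTape t′ ≡ reverse (leadingBits (before t)) ×
    A ⟫ rewind ⊢ inputTape x ∷ ws ↝ t′ ∷ ts within 5 + length x * 3 + (T + T + T + T)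
then-rewind A {x} {t = t} {ts} {T} r@(within n≤ s) =
  let t′ , e , r′ = rewind-run t ts in t′ , e , relax bound (⟫-run r r′)
  where
  bound : T + suc (4 + usedCells t * 3) ≤ 5 + length x * 3 + (T + T + T + T)
  bound = begin
    T + suc (4 + usedCells t * 3)
      ≤⟨ ℕ.+-monoʳ-≤ T (ℕ.+-monoʳ-≤ 5 (ℕ.*-monoˡ-≤ 3 (ℕ.≤-trans (run-usedCells {M = A} s)
           (ℕ.+-mono-≤ n≤ (usedCells-inputTape x))))) ⟩
    T + (5 + (T + length x) * 3)
      ≡⟨ solve 2 (λ T n → T :+ (con 5 :+ (T :+ n) :* con 3) := con 5 :+ n :* con 3 :+ (T :+ T :+ T :+ T)) refl
        T (length x) ⟩
    5 + length x * 3 + (T + T + T + T) ∎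
    where
    open ℕ.≤-Reasoning
    open +-*-Solver

-- Programs as polynomial-time functions

abstract
  run : ∀ {k d} → Prog (suc k) d → List Bool → List Bool
  run {k} p x = proj₂ (exec (length x) p (x ∷ Vec.replicate k [] , []))

  run-unfold : ∀ {k d} (p : Prog (suc k) d) x → run p x ≡
    proj₂ (exec (length x) p (x ∷ Vec.replicate k [] , []))
  run-unfold p x = refl

All-replicate : ∀ {A : Set} {P : A → Set} n {a} → P a → All P (Vec.replicate n a)
All-replicate zero    p = []
All-replicate (suc n) p = p ∷ All-replicate n p

replicate-++ : ∀ {A : Set} m n {a : A} → Vec.replicate (m + n) a ≡ Vec.replicate m a Vec.++ Vec.replicate n a
replicate-++ zero    n = refl
replicate-++ (suc m) n = cong (_ ∷_) (replicate-++ m n)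

module _ {k d : ℕ} (p : Prog (suc k) d) {w : ℕ} (A : Machine (suc w)) (P : Polynomial) where

  -- A works on the first tape and the last `w` tapes, while those of the program are still blank.
  -- Its output is then the input that `load` distributes.
  evaluate : Machine (suc (d + (suc k + w)))
  evaluate = insertTapes d (insertTapes (suc k) A) ⟫ load d ⟫ compile w p

  abstract
    lengthBound evaluateTime time : Polynomial
    -- The output of A consists of the cell under the head and used cells, of which there are at
    -- most n + P(n).
    lengthBound  = [ 1 ] ⊕ (0 ∷ [ 1 ]) ⊕ P
    evaluateTime = P ⊕ ([ 7 ] ⊕ (0 ∷ [ 6 ]) ⊕ cost p) ⟨ lengthBound ⟩
    time         = ([ 5 ] ⊕ (0 ∷ [ 3 ])) ⊕ (evaluateTime ⊕ evaluateTime ⊕ evaluateTime ⊕ evaluateTime)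

    eval-lengthBound : ∀ n → eval lengthBound n ≡ 1 + n + eval P n
    eval-lengthBound n rewrite eval-⊕ ([ 1 ] ⊕ (0 ∷ [ 1 ])) P n =
      solve 2 (λ n q → con 1 :+ n :* (con 1 :+ n :* con 0) :+ q := con 1 :+ n :+ q) refl n (eval P n)
      where open +-*-Solver

    eval-evaluateTime : ∀ n → let N = 1 + n + eval P n in
                        eval evaluateTime n ≡ eval P n + (7 + N * 6 + eval (cost p) N)
    eval-evaluateTime n rewrite eval-⊕ P (([ 7 ] ⊕ (0 ∷ [ 6 ]) ⊕ cost p) ⟨ lengthBound ⟩) n
                              | eval-⟨⟩ ([ 7 ] ⊕ (0 ∷ [ 6 ]) ⊕ cost p) lengthBound n | eval-lengthBound n
                              | eval-⊕ ([ 7 ] ⊕ (0 ∷ [ 6 ])) (cost p) (1 + n + eval P n)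
                              | ℕ.*-zeroʳ (n + eval P n) = refl

    eval-time : ∀ n → let T = eval evaluateTime n in eval time n ≡ 5 + n * 3 + (T + T + T + T)
    eval-time n rewrite eval-⊕ ([ 5 ] ⊕ (0 ∷ [ 3 ])) (evaluateTime ⊕ evaluateTime ⊕ evaluateTime ⊕ evaluateTime) n
                      | eval-⊕ (evaluateTime ⊕ evaluateTime ⊕ evaluateTime) evaluateTime n
                      | eval-⊕ (evaluateTime ⊕ evaluateTime) evaluateTime n
                      | eval-⊕ evaluateTime evaluateTime n | ℕ.*-zeroʳ n = refl

  evaluate-run : ∀ {y x t us} → Run A (Machine.start A) (inputTape x ∷ Vec.replicate w blankTape) t us →
    t ≤ eval P (length x) → outputTape (Vec.head us) ≡ y →
    ∃[ t′ ] ∃[ ts′ ] reverse (leadingBits (before t′)) ≡ run p y ×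
      evaluate ⊢ inputTape x ∷ Vec.replicate (d + (suc k + w)) blankTape ↝ t′ ∷ ts′ within eval evaluateTime
        (length x)
  evaluate-run {x = x} {t} {u ∷ us} r t≤P refl with load-run d {t = u} (Vec.replicate k blankTape Vec.++ us)
  ... | t₂ , c , e₂ , z@(zip _ e) , r₂ with compile-run w (length (outputTape u)) (Vec.map outputTape us) p
          (rep (Vec.replicate d c) (All-replicate d (_ , z , refl)) regs (cong reverse e₂))
    where
    regs : Vec.map outputTape (c ∷ Vec.replicate k blankTape Vec.++ us) ≡
      (outputTape u ∷ Vec.replicate k []) Vec.++ Vec.map outputTape us
    regs = cong₂ _∷_ e (trans (Vec.map-++ outputTape (Vec.replicate k blankTape) us)
             (cong (Vec._++ Vec.map outputTape us) (Vec.map-replicate outputTape blankTape k)))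
  ... | _ , rep {t = t₃} {rs} cs _ _ e₃ , r₃ = t₃ , cs Vec.++ rs , trans e₃ (sym (run-unfold p (outputTape u))) ,
    subst (λ ts → evaluate ⊢ inputTape x ∷ ts ↝ t₃ ∷ cs Vec.++ rs within eval evaluateTime (length x))
      (sym (trans (replicate-++ d (suc k + w))
        (cong (Vec.replicate d blankTape Vec.++_) (replicate-++ (suc k) w))))
      (relax bound (⟫-run
        (insertTapes-run (Vec.replicate d blankTape)
          (insertTapes-run (Vec.replicate (suc k) blankTape) (within {M = A} ℕ.≤-refl r)))
        (⟫-run r₂ r₃)))
    where
    N = 1 + length x + eval P (length x)
    y≤N : length (outputTape u) ≤ N
    y≤N = ℕ.≤-trans (length-outputTape u) (s≤s (ℕ.≤-trans (run-usedCells {M = A} r)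
            (ℕ.≤-trans (ℕ.+-mono-≤ t≤P (usedCells-inputTape x)) (ℕ.≤-reflexive (ℕ.+-comm _ (length x))))))
    bound : t + suc (5 + length (outputTape u) * 6 + suc (eval (cost p) (length (outputTape u)))) ≤ eval
      evaluateTime (length x)
    bound = begin
      t + suc (5 + length (outputTape u) * 6 + suc (eval (cost p) (length (outputTape u))))
        ≤⟨ ℕ.+-mono-≤ t≤P (s≤s (ℕ.+-mono-≤ (ℕ.+-monoʳ-≤ 5 (ℕ.*-monoˡ-≤ 6 y≤N))
          (s≤s (eval-mono (cost p) y≤N)))) ⟩
      eval P (length x) + suc (5 + N * 6 + suc (eval (cost p) N))
        ≡⟨ cong (λ m → eval P (length x) + suc m) (ℕ.+-suc (5 + N * 6) _) ⟩
      eval P (length x) + (7 + N * 6 + eval (cost p) N)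
        ≡⟨ sym (eval-evaluateTime (length x)) ⟩
      eval evaluateTime (length x) ∎
      where open ℕ.≤-Reasoning

module _ {k d : ℕ} (p : Prog (suc k) d) {w : ℕ} (A : Machine (suc w)) (P : Polynomial) where

  machine : Machine (suc (d + (suc k + w)))
  machine = evaluate p A P ⟫ rewind

  blanks : Vec Tape (d + (suc k + w))
  blanks = Vec.replicate _ blankTape

  machine-run : ∀ {x y t ts} → reverse (leadingBits (before t)) ≡ y →
    evaluate p A P ⊢ inputTape x ∷ blanks ↝ t ∷ ts within eval (evaluateTime p A P) (length x) →
    ∃[ t′ ] outputTape t′ ≡ y × machine ⊢ inputTape x ∷ blanks ↝ t′ ∷ ts within eval (time p A P) (length x)
  machine-run {x} e r =
    let t′ , e′ , r′ = then-rewind (evaluate p A P) r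
    in  t′ , trans e′ e , relax (ℕ.≤-reflexive (sym (eval-time p A P (length x)))) r′

-- The one form of composition in the proof: a program after an arbitrary machine. It lets a
-- reduction given by a program extend any given reduction.
PolyTime-run : ∀ {k d g} (p : Prog (suc k) d) → PolyTime g → PolyTime (run p ∘ g)
PolyTime-run {g = g} p (M , P , M-computes) = toTM (machine p A P) , time p A P , computes
  where
  A = fromTM M
  computes : ComputesInTime (toTM (machine p A P)) (time p A P) (run p ∘ g)
  computes x =
    let t , us , r , t≤P , e   = M-computes x
        t₁ , ts₁ , e₁ , r₁     = evaluate-run p A P (fromTM-run M r) t≤P e
        t₂ , e₂ , within n≤ s  = machine-run p A P e₁ r₁
    in  _ , _ , toTM-run (machine p A P) s , n≤ , e₂

outputTape-inputTape : ∀ x → outputTape (inputTape x) ≡ x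
outputTape-inputTape []      = refl
outputTape-inputTape (b ∷ x) = cong (b ∷_) (leadingBits-just x)

PolyTime-id : PolyTime id
PolyTime-id = record { State = Fin 1 ; size = 1 ; finite = ↔-id _ ; workTapes = 0 ; start = zero ; δ = λ _ _ →
  nothing } ,
  [] , λ x → 0 , _ , TM.halt refl , z≤n , outputTape-inputTape x

-- Loops of stack programs

-- A loop makes N rounds whatever the data. A body that idles on an empty stack therefore amounts to
-- a fold over any stack of at most N items.
drain : ∀ {S D Y : Set} (f : S → S) (st : List D → Y → S) (g : Y → D → Y) →
        (∀ y → f (st [] y) ≡ st [] y) → (∀ d ds y → f (st (d ∷ ds) y) ≡ st ds (g y d)) →
        ∀ N ds y → length ds ≤ N → iter N f (st ds y) ≡ st [] (List.foldl g y ds)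
drain f st g stop next zero    []       y l       = refl
drain f st g stop next (suc N) []       y l       =
  trans (cong (iter N f) (stop y)) (drain f st g stop next N [] y z≤n)
drain f st g stop next (suc N) (d ∷ ds) y (s≤s l) =
  trans (cong (iter N f) (next d ds y)) (drain f st g stop next N ds (g y d) l)

foldl-const : ∀ {A B : Set} (g : A → A) (l : List B) a → List.foldl (λ a _ → g a) a l ≡ iter (length l) g a
foldl-const g []      a = refl
foldl-const g (_ ∷ l) a = foldl-const g l (g a)

iter-fix : ∀ {A : Set} (f : A → A) a → f a ≡ a → ∀ n → iter n f a ≡ a
iter-fix f a e zero    = refl
iter-fix f a e (suc n) = trans (cong (iter n f) e) (iter-fix f a e n)

iter-cong : ∀ {A : Set} {f g : A → A} → (∀ a → f a ≡ g a) → ∀ n a → iter n f a ≡ iter n g a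
iter-cong h zero    a = refl
iter-cong {f = f} h (suc n) a = trans (cong (iter n f) (h a)) (iter-cong h n _)

move∗ : ∀ {k d} → Fin k → Fin k → Prog k (suc d)
move∗ i j = loop (case i skip λ b → pop i ⨾ push j b)

-- Runs the body once for each bit of register `i` without losing the register: the bits are parked
-- on `i′` and poured back, and the two reversals cancel.
each : ∀ {k d} → Fin k → Fin k → Prog k (suc d) → Prog k (suc (suc d))
each i i′ body = loop (case i skip λ b → pop i ⨾ push i′ b ⨾ body) ⨾ move∗ i′ i

flag : Bool → List Bool
flag false = []
flag true  = [ true ]

set : ∀ {k d} → Fin k → Prog k d
set i = case i (push i true) (λ _ → skip)

setIf : ∀ {k d} → Bool → Fin k → Prog k d
setIf b i = if b then set i else skip

exec-move : ∀ {k d N} (i j : Fin k) → i ≢ j → ∀ s o → length (lookup s i) ≤ N →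
            exec N (move∗ {d = d} i j) (s , o) ≡ (s [ i ]%= (λ _ → []) [ j ]%= (lookup s i ʳ++_) , o)
exec-move {d = d} {N} i j i≢j s o l = begin
  exec N (move∗ {d = d} i j) (s , o)
    ≡⟨ cong (λ s → exec N (move∗ {d = d} i j) (s , o))
      (sym (trans (cong (_[ j ]%= _) (Vec.updateAt-id-local i s refl)) (Vec.updateAt-id-local j s refl))) ⟩
  exec N (move∗ {d = d} i j) (st (lookup s i) (lookup s j))
    ≡⟨ drain (exec N (case {d = d} i skip λ b → pop i ⨾ push j b)) st (λ y d → d ∷ y) stop next N (lookup s i)
      (lookup s j) l ⟩
  st [] (lookup s i ʳ++ lookup s j)
    ≡⟨ cong (_, o) (Vec.updateAt-cong-local j (s [ i ]%= (λ _ → []))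
         (cong (lookup s i ʳ++_) (sym (Vec.lookup∘updateAt′ j i (i≢j ∘ sym) s)))) ⟩
  (s [ i ]%= (λ _ → []) [ j ]%= (lookup s i ʳ++_) , o) ∎
  where
  open ≡-Reasoning
  st : List Bool → List Bool → Store _
  st ds y = s [ i ]%= (λ _ → ds) [ j ]%= (λ _ → y) , o
  top : ∀ ds y → lookup (proj₁ (st ds y)) i ≡ ds
  top ds y = trans (Vec.lookup∘updateAt′ i j i≢j (s [ i ]%= (λ _ → ds))) (Vec.lookup∘updateAt i s)
  stop : ∀ y → exec N (case {d = d} i skip λ b → pop i ⨾ push j b) (st [] y) ≡ st [] y
  stop y rewrite top [] y = refl
  next : ∀ b ds y → exec N (case {d = d} i skip λ b → pop i ⨾ push j b) (st (b ∷ ds) y) ≡ st ds (b ∷ y)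
  next b ds y rewrite top (b ∷ ds) y = cong (_, o) (begin
    s [ i ]%= (λ _ → b ∷ ds) [ j ]%= (λ _ → y) [ i ]%= drop 1 [ j ]%= (b ∷_)
      ≡⟨ cong (_[ j ]%= (b ∷_)) (Vec.updateAt-commutes i j i≢j (s [ i ]%= (λ _ → b ∷ ds))) ⟩
    s [ i ]%= (λ _ → b ∷ ds) [ i ]%= drop 1 [ j ]%= (λ _ → y) [ j ]%= (b ∷_)
      ≡⟨ Vec.updateAt-updateAt j (s [ i ]%= (λ _ → b ∷ ds) [ i ]%= drop 1) ⟩
    s [ i ]%= (λ _ → b ∷ ds) [ i ]%= drop 1 [ j ]%= (λ _ → b ∷ y)
      ≡⟨ cong (_[ j ]%= (λ _ → b ∷ y)) (Vec.updateAt-updateAt i s) ⟩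
    s [ i ]%= (λ _ → ds) [ j ]%= (λ _ → b ∷ y) ∎)

module _ {k d N : ℕ} (i i′ : Fin k) (body : Prog k (suc d)) {Y : Set}
  (st : List Bool → List Bool → Y → Store k) (g : Y → Y)
         (top : ∀ a a′ y → lookup (proj₁ (st a a′ y)) i ≡ a)
         (restore : ∀ a y → length a ≤ N → exec N (move∗ {d = suc d} i′ i) (st [] a y) ≡ st (reverse a) [] y) where

  -- `P` relates the data to the number of rounds still to come. The greedy pass depends on it: a
  -- step is correct only while a row is left and the list of decisions is no longer than a row.
  exec-each-invariant : (P : ℕ → Y → Set) →
    (∀ b a a′ y → P (suc (length a)) y → exec N (pop i ⨾ push i′ b ⨾ body) (st (b ∷ a) a′ y) ≡
      st a (b ∷ a′) (g y) × P (length a) (g y)) →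
    ∀ a y → length a ≤ N → P (length a) y → exec N (each i i′ body) (st a [] y) ≡
      st a [] (iter (length a) g y)
  exec-each-invariant P next a y l p = begin
    exec N (each i i′ body) (st a [] y)
      ≡⟨ cong (exec N (move∗ {d = suc d} i′ i)) (go N a [] y l p) ⟩
    exec N (move∗ {d = suc d} i′ i) (st [] (reverse a) (iter (length a) g y))
      ≡⟨ restore (reverse a) _ (ℕ.≤-trans (ℕ.≤-reflexive (List.length-reverse a)) l) ⟩
    st (reverse (reverse a)) [] (iter (length a) g y)
      ≡⟨ cong (λ a′ → st a′ [] (iter (length a) g y)) (List.reverse-involutive a) ⟩
    st a [] (iter (length a) g y) ∎
    where
    open ≡-Reasoning
    once-through : Prog k (suc d)
    once-through = case i skip λ b → pop i ⨾ push i′ b ⨾ body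
    stop : ∀ a′ y → exec N once-through (st [] a′ y) ≡ st [] a′ y
    stop a′ y rewrite top [] a′ y = refl
    unfold : ∀ b a a′ y → exec N once-through (st (b ∷ a) a′ y) ≡
      exec N (pop i ⨾ push i′ b ⨾ body) (st (b ∷ a) a′ y)
    unfold b a a′ y rewrite top (b ∷ a) a′ y = refl
    go : ∀ M a a′ y → length a ≤ M → P (length a) y → iter M (exec N once-through) (st a a′ y) ≡
      st [] (a ʳ++ a′) (iter (length a) g y)
    go M       []      a′ y l       p = iter-fix _ _ (stop a′ y) M
    go (suc M) (b ∷ a) a′ y (s≤s l) p =
      let e , p′ = next b a a′ y p in
      trans (cong (iter M (exec N once-through)) (trans (unfold b a a′ y) e)) (go M a (b ∷ a′) (g y) l p′)

  exec-each : (∀ b a a′ y → exec N (pop i ⨾ push i′ b ⨾ body) (st (b ∷ a) a′ y) ≡ st a (b ∷ a′) (g y)) →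
    ∀ a y → length a ≤ N → exec N (each i i′ body) (st a [] y) ≡ st a [] (iter (length a) g y)
  exec-each next a y l = exec-each-invariant (λ _ _ → ⊤) (λ b a a′ y _ → next b a a′ y , tt) a y l tt

-- Unlike the equation, this type determines the program for unification.
data Exec {k d} (N : ℕ) (p : Prog k d) (s t : Store k) : Set where
  exec≡ : exec N p s ≡ t → Exec N p s t

infixr 5 _▷_
_▷_ : ∀ {k d N} {p q : Prog k d} {s t u} → Exec N p s t → Exec N q t u → Exec N (p ⨾ q) s u
_▷_ {N = N} {q = q} (exec≡ e) (exec≡ e′) = exec≡ (trans (cong (exec N q) e) e′)

run-exec : ∀ {k d} (p : Prog (suc k) d) x {s o} → Exec (length x) p (x ∷ Vec.replicate k [] , []) (s , o) →
  run p x ≡ o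
run-exec p x (exec≡ e) = trans (run-unfold p x) (cong proj₂ e)

-- Registers: X is the unread input, Y a copy of it; A, A′ and B, B′ hold the order of the
-- graph in unary, split at the current position of a loop; F is a flag and E reports errors.
pattern X  = zero
pattern Y  = suc zero
pattern Z  = suc (suc zero)
pattern A  = suc (suc (suc zero))
pattern A′ = suc (suc (suc (suc zero)))
pattern B  = suc (suc (suc (suc (suc zero))))
pattern B′ = suc (suc (suc (suc (suc (suc zero)))))
pattern F  = suc (suc (suc (suc (suc (suc (suc zero))))))
pattern E  = suc (suc (suc (suc (suc (suc (suc (suc zero)))))))

regs : ∀ {m} (x y z a a′ b b′ f e : List Bool) → Vec (List Bool) m → Vec (List Bool) (9 + m)
regs x y z a a′ b b′ f e ρ = x ∷ y ∷ z ∷ a ∷ a′ ∷ b ∷ b′ ∷ f ∷ e ∷ ρ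

ones : ℕ → List Bool
ones n = replicate n true

length-ones : ∀ {n N} → n ≤ N → length (ones n) ≤ N
length-ones {n} l = ℕ.≤-trans (ℕ.≤-reflexive (List.length-replicate n)) l

-- The length of the unary header, whether its terminator is missing, and the remaining input.
header : List Bool → ℕ × Bool × List Bool
header []          = 0 , true , []
header (false ∷ x) = 0 , false , x
header (true ∷ x)  = Product.map₁ suc (header x)

headerStep : ∀ {m d} → Prog (9 + m) d
headerStep = case F (case X skip λ { true  → pop X ⨾ push A true ⨾ push B true
                                   ; false → pop X ⨾ set F }) λ _ → skip

readHeader : ∀ {m d} → Prog (9 + m) (suc d)
readHeader = loop headerStep ⨾ case F (set E) λ _ → pop F

spread : ∀ {m d} → Prog (9 + m) (suc d)
spread = loop (case Z skip λ b → pop Z ⨾ push X b ⨾ push Y b)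

copyX copyY : ∀ {m d} → Prog (9 + m) (suc d)
copyX = move∗ X Z ⨾ spread
copyY = move∗ Y Z ⨾ spread

-- The Boolean reports an error.
Input : Set
Input = List Bool × Bool

tick : Input → Input
tick ([]    , e) = [] , true
tick (_ ∷ x , e) = x , e

readBit : ∀ {m d} → Prog (9 + m) d
readBit = case X (set E) λ _ → pop X

readMatrix : ∀ {m d} → Prog (9 + m) (suc (suc (suc d)))
readMatrix = each A A′ (each B B′ readBit)

-- Each `true` uses up one unit of the budget, which runs out exactly on the numbers that are too
-- large. Parts out of range are thus detected during reading.
index : ℕ → Input → Input
index zero    (x         , e) = x , true
index (suc n) ([]        , e) = [] , true
index (suc n) (false ∷ x , e) = x , e
index (suc n) (true ∷ x  , e) = index n (x , e)

partCode : ℕ → ℕ → Input → Input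
partCode r ℓ ([]        , e) = [] , true
partCode r ℓ (false ∷ x , e) = index r (x , e)
partCode r ℓ (true ∷ x  , e) = index ℓ (x , e)

readIndex : ∀ {m d} → ℕ → Prog (9 + m) d
readIndex zero    = set E
readIndex (suc n) = case X (set E) λ { false → pop X ; true → pop X ⨾ readIndex n }

readPart : ∀ {m d} → ℕ → ℕ → Prog (9 + m) d
readPart r ℓ = case X (set E) λ { false → pop X ⨾ readIndex r ; true → pop X ⨾ readIndex ℓ }

nonempty : List Bool → Bool
nonempty []      = false
nonempty (_ ∷ _) = true

readEnd : ∀ {m d} → Prog (9 + m) d
readEnd = case X skip λ _ → set E

-- Parsers for the encodings

-- The error flag is never reset: by `sound`, a clean flag at the end was clean at the start. This
-- is what makes parsers composable without testing the flag in between.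
record Parses {C : Set} (f : Input → Input) (encode : C → List Bool) : Set where
  field
    sound    : ∀ x {e y} → f (x , e) ≡ (y , false) → e ≡ false × ∃[ c ] x ≡ encode c ++ y
    complete : ∀ c {y e} → f (encode c ++ y , e) ≡ (y , e)

open Parses

encodeAll : ∀ {C : Set} {n} → (C → List Bool) → Vec C n → List Bool
encodeAll encode []       = []
encodeAll encode (c ∷ cs) = encode c ++ encodeAll encode cs

iter-parses : ∀ {C : Set} {f} {encode : C → List Bool} n → Parses f encode →
  Parses {Vec C n} (iter n f) (encodeAll encode)
iter-parses zero p .sound x refl = refl , [] , refl
iter-parses {f = f} {encode} (suc n) p .sound x {e} h with iter-parses n p .sound (proj₁ (f (x , e))) h
... | e₁ , cs , h₁ with p .sound x (cong₂ _,_ h₁ e₁)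
... | e₂ , c , h₂ = e₂ , c ∷ cs , trans h₂ (sym (List.++-assoc (encode c) (encodeAll encode cs) _))
iter-parses zero p .complete [] = refl
iter-parses {f = f} {encode} (suc n) p .complete (c ∷ cs) {y} {e} =
  trans (cong (λ x → iter n f (f (x , e))) (List.++-assoc (encode c) _ y))
    (trans (cong (iter n f) (p .complete c)) (iter-parses n p .complete cs))

tick-parses : Parses tick [_]
tick-parses .sound (b ∷ x) refl = refl , b , refl
tick-parses .complete b = refl

index-parses : ∀ r → Parses {Fin r} (index r) (unary ∘ toℕ)
index-parses zero    .sound x ()
index-parses (suc r) .sound (false ∷ x) refl = refl , zero , refl
index-parses (suc r) .sound (true ∷ x) h with index-parses r .sound x h
... | e , i , h′ = e , suc i , cong (true ∷_) h′
index-parses (suc r) .complete zero    = refl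
index-parses (suc r) .complete (suc i) = index-parses r .complete i

partCode-parses : ∀ r ℓ → Parses {Fin r ⊎ Fin ℓ} (partCode r ℓ) encodePart
partCode-parses r ℓ .sound (false ∷ x) h with index-parses r .sound x h
... | e , i , h′ = e , inj₁ i , cong (false ∷_) h′
partCode-parses r ℓ .sound (true ∷ x) h with index-parses ℓ .sound x h
... | e , j , h′ = e , inj₂ j , cong (true ∷_) h′
partCode-parses r ℓ .complete (inj₁ i) = index-parses r .complete i
partCode-parses r ℓ .complete (inj₂ j) = index-parses ℓ .complete j

Matrix : ℕ → Set
Matrix n = Vec (Vec Bool n) n

encodeRows : ∀ {m n} → Vec (Vec Bool n) m → List Bool
encodeRows = encodeAll (encodeAll [_])

matrix-parses : ∀ n → Parses {Matrix n} (iter n (iter n tick)) encodeRows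
matrix-parses n = iter-parses n (iter-parses n tick-parses)

header-sound : ∀ x → let n , e , m = header x in e ≡ false → x ≡ unary n ++ m
header-sound (false ∷ x) e = refl
header-sound (true ∷ x)  e = cong (true ∷_) (header-sound x e)

header-complete : ∀ n {m} → header (unary n ++ m) ≡ (n , false , m)
header-complete zero    = refl
header-complete (suc n) = cong (Product.map₁ suc) (header-complete n)

header-length : ∀ x → proj₁ (header x) + length (proj₂ (proj₂ (header x))) ≤ length x
header-length []          = z≤n
header-length (false ∷ x) = ℕ.n≤1+n _
header-length (true ∷ x)  = s≤s (header-length x)

-- Execution of the reading programs

module _ {N : ℕ} {m : ℕ} {o : List Bool} {ρ : Vec (List Bool) m} where

  exec-readHeader : ∀ {d} x {y z a′ b′} → length x ≤ N → let n , e , x′ = header x in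
    exec N (readHeader {d = d}) (regs x y z [] a′ [] b′ [] [] ρ , o) ≡
      (regs x′ y z (ones n) a′ (ones n) b′ [] (flag e) ρ , o)
  exec-readHeader {d} x {y} {z} {a′} {b′} l =
    trans (cong (exec {d = d} N (case F (set E) λ _ → pop F)) (loop-header N x 0 l)) (end x)
    where
    st : List Bool → ℕ → Bool → Store (9 + m)
    st x j f = regs x y z (ones j) a′ (ones j) b′ (flag f) [] ρ , o
    body : Prog (9 + m) d
    body = headerStep
    loop-header : ∀ M x j → length x ≤ M → let n , e , x′ = header x in
                  iter M (exec N body) (st x j false) ≡ st x′ (n + j) (not e)
    loop-header M       []          j l = iter-fix (exec N body) _ refl M
    loop-header (suc M) (false ∷ x) j l = iter-fix (exec N body) (st x j true) refl M
    loop-header (suc M) (true ∷ x)  j (s≤s l) =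
      trans (loop-header M x (suc j) l)
      (cong (λ n → st (proj₂ (proj₂ (header x))) n (not (proj₁ (proj₂ (header x)))))
      (ℕ.+-suc (proj₁ (header x)) j))
    end : ∀ x → let n , e , x′ = header x in
          exec N (case {d = d} F (set E) λ _ → pop F) (st x′ (n + 0) (not e)) ≡
            (regs x′ y z (ones n) a′ (ones n) b′ [] (flag e) ρ , o)
    end x rewrite ℕ.+-identityʳ (proj₁ (header x)) with proj₁ (proj₂ (header x))
    ... | true  = refl
    ... | false = refl

  exec-spread : ∀ {d} x {y a a′ b b′ f e} → length x ≤ N →
    exec N (spread {d = d}) (regs [] y (reverse x) a a′ b b′ f e ρ , o) ≡
      (regs x (x ++ y) [] a a′ b b′ f e ρ , o)
  exec-spread {d} x {y} {a} {a′} {b} {b′} {f} {e} l = begin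
    iter N (exec N body) (regs [] y (reverse x) a a′ b b′ f e ρ , o)
      ≡⟨ drain (exec N body) st push₂ (λ _ → refl) (λ _ _ _ → refl) N (reverse x) ([] , y)
           (ℕ.≤-trans (ℕ.≤-reflexive (List.length-reverse x)) l) ⟩
    st [] (List.foldl push₂ ([] , y) (reverse x))
      ≡⟨ cong (st []) (trans (fold (reverse x) [] y) (cong₂ _,_ (List.reverse-involutive x)
           (trans (List.ʳ++-defn (reverse x)) (cong (_++ y) (List.reverse-involutive x))))) ⟩
    (regs x (x ++ y) [] a a′ b b′ f e ρ , o) ∎
    where
    open ≡-Reasoning
    body : Prog (9 + m) d
    body = case Z skip λ b → pop Z ⨾ push X b ⨾ push Y b
    st : List Bool → List Bool × List Bool → Store (9 + m)
    st z (x , y) = regs x y z a a′ b b′ f e ρ , o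
    push₂ : List Bool × List Bool → Bool → List Bool × List Bool
    push₂ (x , y) b = b ∷ x , b ∷ y
    fold : ∀ z x y → List.foldl push₂ (x , y) z ≡ (z ʳ++ x , z ʳ++ y)
    fold []      x y = refl
    fold (b ∷ z) x y = fold z (b ∷ x) (b ∷ y)

  exec-copyX : ∀ {d} x {y a a′ b b′ f e} → length x ≤ N →
    exec N (copyX {d = d}) (regs x y [] a a′ b b′ f e ρ , o) ≡ (regs x (x ++ y) [] a a′ b b′ f e ρ , o)
  exec-copyX {d} x l = trans (cong (exec N (spread {d = d})) (exec-move {d = d} X Z (λ ()) _ o l))
    (exec-spread {d} x l)

  exec-copyY : ∀ {d} y {a a′ b b′ f e} → length y ≤ N →
    exec N (copyY {d = d}) (regs [] y [] a a′ b b′ f e ρ , o) ≡ (regs y y [] a a′ b b′ f e ρ , o)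
  exec-copyY {d} y {a} {a′} {b} {b′} {f} {e} l =
    trans (cong (exec N (spread {d = d})) (exec-move {d = d} Y Z (λ ()) _ o l))
    (trans (exec-spread {d} y l) (cong (λ y′ → regs y y′ [] a a′ b b′ f e ρ , o) (List.++-identityʳ y)))

  module _ {y z : List Bool} where

    private
      st : List Bool → List Bool → List Bool → List Bool → Input → Store (9 + m)
      st a a′ b b′ (x , e) = regs x y z a a′ b b′ [] (flag e) ρ , o

    exec-readBit : ∀ {d a a′ b b′} i → exec N (readBit {d = d}) (st a a′ b b′ i) ≡ st a a′ b b′ (tick i)
    exec-readBit ([]    , false) = refl
    exec-readBit ([]    , true)  = refl
    exec-readBit (_ ∷ x , e)     = refl

    exec-readIndex : ∀ {d a a′ b b′} n i → exec N (readIndex {d = d} n) (st a a′ b b′ i) ≡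
      st a a′ b b′ (index n i)
    exec-readIndex zero    (x         , false) = refl
    exec-readIndex zero    (x         , true)  = refl
    exec-readIndex (suc n) ([]        , false) = refl
    exec-readIndex (suc n) ([]        , true)  = refl
    exec-readIndex (suc n) (false ∷ x , e)     = refl
    exec-readIndex (suc n) (true ∷ x  , e)     = exec-readIndex n (x , e)

    exec-readPart : ∀ {d a a′ b b′} r ℓ i → exec N (readPart {d = d} r ℓ) (st a a′ b b′ i) ≡
      st a a′ b b′ (partCode r ℓ i)
    exec-readPart r ℓ ([]        , false) = refl
    exec-readPart r ℓ ([]        , true)  = refl
    exec-readPart r ℓ (false ∷ x , e)     = exec-readIndex r (x , e)
    exec-readPart r ℓ (true ∷ x  , e)     = exec-readIndex ℓ (x , e)

    exec-eachA : ∀ {d b} (body : Prog (9 + m) (suc d)) g →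
      (∀ a a′ i → exec N body (st a a′ b [] i) ≡ st a a′ b [] (g i)) →
      ∀ a i → length a ≤ N → exec N (each A A′ body) (st a [] b [] i) ≡ st a [] b [] (iter (length a) g i)
    exec-eachA {d} {b} body g h = exec-each A A′ body (λ a a′ → st a a′ b []) g (λ _ _ _ → refl)
      (λ a (x , e) → exec-move {d = suc d} A′ A (λ ()) _ o) (λ _ a a′ i → h a _ i)

    exec-eachB : ∀ {d a a′} (body : Prog (9 + m) (suc d)) g →
      (∀ b b′ i → exec N body (st a a′ b b′ i) ≡ st a a′ b b′ (g i)) →
      ∀ b i → length b ≤ N → exec N (each B B′ body) (st a a′ b [] i) ≡ st a a′ b [] (iter (length b) g i)
    exec-eachB {d} {a} {a′} body g h = exec-each B B′ body (λ b b′ → st a a′ b b′) g (λ _ _ _ → refl)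
      (λ b (x , e) → exec-move {d = suc d} B′ B (λ ()) _ o) (λ _ b b′ i → h b _ i)

    exec-readMatrix : ∀ {d b} a i → length a ≤ N → length b ≤ N →
      exec N (readMatrix {d = d}) (st a [] b [] i) ≡ st a [] b [] (iter (length a) (iter (length b) tick) i)
    exec-readMatrix {d} {b} a i la lb = exec-eachA {suc d} (each B B′ readBit) (iter (length b) tick)
      (λ a a′ i → exec-eachB {d = d} readBit tick (λ b b′ i → exec-readBit {suc d} i) b i lb) a i la

    exec-readEnd : ∀ {d a a′ b b′} i → exec N (readEnd {d = d}) (st a a′ b b′ i) ≡
      st a a′ b b′ (proj₁ i , proj₂ i ∨ nonempty (proj₁ i))
    exec-readEnd ([]    , false) = refl
    exec-readEnd ([]    , true)  = refl
    exec-readEnd (_ ∷ x , false) = refl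
    exec-readEnd (_ ∷ x , true)  = refl

-- Recognition of well-formed strings

-- What follows the adjacency matrix: nothing in an instance of `rℓwc-g`, the part codes in an
-- instance of `wc-rℓg`. One checker serves both.
record Tail : Set₁ where
  field
    Code      : ℕ → Set
    encode    : ∀ {n} → Code n → List Bool
    read      : ℕ → Input → Input
    parses    : ∀ n → Parses (read n) (encode {n})
    program   : ∀ {m} → Prog (9 + m) 3
    exec-tail : ∀ {N m o y n} {ρ : Vec (List Bool) m} i → n ≤ N →
                exec N program (regs (proj₁ i) y [] (ones n) [] (ones n) [] [] (flag (proj₂ i)) ρ , o)
                ≡ (regs (proj₁ (read n i)) y [] (ones n) [] (ones n) [] [] (flag (proj₂ (read n i))) ρ , o)

noTail : Tail
noTail = record
  { Code = λ _ → ⊤ ; encode = λ _ → [] ; read = λ _ i → i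
  ; parses = λ _ → record { sound = λ x e → cong proj₂ e , tt , cong proj₁ e ; complete = λ _ → refl }
  ; program = skip ; exec-tail = λ _ _ → refl }

partition : ℕ → ℕ → Tail
partition r ℓ = record
  { Code = Vec (Fin r ⊎ Fin ℓ) ; encode = encodeAll encodePart ; read = λ n → iter n (partCode r ℓ)
  ; parses = λ n → iter-parses n (partCode-parses r ℓ)
  ; program = each A A′ (readPart r ℓ)
  ; exec-tail = λ {N} {m} {o} {y} {n} {ρ} i n≤N →
      trans (exec-eachA {d = 1} (readPart r ℓ) (partCode r ℓ) (λ a a′ i → exec-readPart {d = 2} r ℓ i)
        (ones n) i
              (length-ones n≤N))
            (cong (λ k → let i′ = iter k (partCode r ℓ) i in
                regs (proj₁ i′) y [] (ones n) [] (ones n) [] [] (flag (proj₂ i′)) ρ , o)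
                  (List.length-replicate n)) }

module _ (T : Tail) where

  open Tail T

  -- Purely syntactic: the matrix may be asymmetric or have loops, and the parts need not be
  -- independent sets or cliques.
  Shape : List Bool → Set
  Shape x = ∃[ n ] Σ (Matrix n) λ M → Σ (Code n) λ c → x ≡ unary n ++ encodeRows M ++ encode c

  readAll : List Bool → Input
  readAll x = let n , e , y = header x in read n (iter n (iter n tick) (y , e))

  malformed : List Bool → Bool
  malformed x = proj₂ (readAll x) ∨ nonempty (proj₁ (readAll x))

  malformed-sound : ∀ x → malformed x ≡ false → Shape x
  malformed-sound x h with ends (readAll x) refl h
    where
    ends : ∀ i → readAll x ≡ i → proj₂ i ∨ nonempty (proj₁ i) ≡ false → readAll x ≡ ([] , false)
    ends ([] , false) e h = e
  ... | h₁ with parses _ .sound _ h₁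
  ... | e₁ , c , h₂ with matrix-parses _ .sound _ (cong₂ _,_ h₂ e₁)
  ... | e₂ , M , h₃ = _ , M , c , trans (header-sound x e₂)
    (cong (unary (proj₁ (header x)) ++_) (trans h₃ (cong (encodeRows M ++_) (List.++-identityʳ _))))

  readAll-complete : ∀ n (M : Matrix n) (c : Code n) → readAll (unary n ++ encodeRows M ++ encode c) ≡
    ([] , false)
  readAll-complete n M c = begin
    readAll (unary n ++ encodeRows M ++ encode c)
      ≡⟨ cong (λ (n , e , y) → read n (iter n (iter n tick) (y , e))) (header-complete n) ⟩
    read n (iter n (iter n tick) (encodeRows M ++ encode c , false))
      ≡⟨ cong (read n) (matrix-parses n .complete M) ⟩
    read n (encode c , false)
      ≡⟨ cong (λ y → read n (y , false)) (sym (List.++-identityʳ (encode c))) ⟩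
    read n (encode c ++ [] , false)
      ≡⟨ parses n .complete c ⟩
    ([] , false) ∎
    where open ≡-Reasoning

  -- Reading consumes `X`. The copy on `Y`, made before, is what the programs after the check work
  -- on.
  check : ∀ {m} → Prog (9 + m) 3
  check = readHeader ⨾ copyX ⨾ readMatrix ⨾ program ⨾ readEnd

  exec-check : ∀ {N m o} {ρ : Vec (List Bool) m} x → length x ≤ N → let n , _ , y = header x in
    exec N check (regs x [] [] [] [] [] [] [] [] ρ , o)
    ≡ (regs (proj₁ (readAll x)) y [] (ones n) [] (ones n) [] [] (flag (malformed x)) ρ , o)
  exec-check {N} {m} {o} {ρ} x l = begin
    exec N check (regs x [] [] [] [] [] [] [] [] ρ , o)
      ≡⟨ cong (exec N (copyX {d = 2} ⨾ readMatrix ⨾ program ⨾ readEnd)) (exec-readHeader {d = 2} x l) ⟩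
    exec N (copyX {d = 2} ⨾ readMatrix ⨾ program ⨾ readEnd)
      (regs y [] [] (ones n) [] (ones n) [] [] (flag e) ρ , o)
      ≡⟨ cong (exec N (readMatrix ⨾ program ⨾ readEnd)) (exec-copyX {d = 2} y y≤N) ⟩
    exec N (readMatrix ⨾ program ⨾ readEnd) (st (y ++ []) (y , e))
      ≡⟨ cong (exec N (program ⨾ readEnd)) (exec-readMatrix {d = 0} (ones n) (y , e) ones≤N ones≤N) ⟩
    exec N (program ⨾ readEnd) (st (y ++ []) (iter (length (ones n)) (iter (length (ones n)) tick) (y , e)))
      ≡⟨ cong₂ (λ y′ k → exec N (program ⨾ readEnd) (st y′ (iter k (iter k tick) (y , e))))
           (List.++-identityʳ y) (List.length-replicate n) ⟩
    exec N (program ⨾ readEnd) (st y (iter n (iter n tick) (y , e)))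
      ≡⟨ cong (exec {d = 3} N readEnd) (exec-tail (iter n (iter n tick) (y , e)) n≤N) ⟩
    exec {d = 3} N readEnd (st y (readAll x))
      ≡⟨ exec-readEnd {N} {d = 3} (readAll x) ⟩
    (regs (proj₁ (readAll x)) y [] (ones n) [] (ones n) [] [] (flag (malformed x)) ρ , o) ∎
    where
    open ≡-Reasoning
    n = proj₁ (header x)
    e = proj₁ (proj₂ (header x))
    y = proj₂ (proj₂ (header x))
    n≤N : n ≤ N
    n≤N = ℕ.≤-trans (ℕ.m≤m+n n (length y)) (ℕ.≤-trans (header-length x) l)
    y≤N : length y ≤ N
    y≤N = ℕ.≤-trans (ℕ.m≤n+m (length y) n) (ℕ.≤-trans (header-length x) l)
    ones≤N : length (ones n) ≤ N
    ones≤N = length-ones n≤N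
    st : List Bool → Input → Store (9 + m)
    st y′ (x′ , e′) = regs x′ y′ [] (ones n) [] (ones n) [] [] (flag e′) ρ , o

  checked : ∀ {m} → Vec (List Bool) m → (x y : List Bool) → ℕ → Bool → Vec (List Bool) (9 + m)
  checked ρ x y n e = regs x y [] (ones n) [] (ones n) [] [] (flag e) ρ

  exec-check-good : ∀ {N m o} {ρ : Vec (List Bool) m} n (M : Matrix n) (c : Code n) →
    length (unary n ++ encodeRows M ++ encode c) ≤ N →
    exec N check (regs (unary n ++ encodeRows M ++ encode c) [] [] [] [] [] [] [] [] ρ , o)
    ≡ (checked ρ [] (encodeRows M ++ encode c) n false , o)
  exec-check-good {o = o} {ρ} n M c l = trans (exec-check (unary n ++ encodeRows M ++ encode c) l)
    (cong₂ (λ (n , _ , y) (x , e) → checked ρ x y n (e ∨ nonempty x) , o) (header-complete n)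
      (readAll-complete n M c))

  exec-check-bad : ∀ {N m o} {ρ : Vec (List Bool) m} x → length x ≤ N → ¬ Shape x →
    ∃[ x′ ] ∃[ y ] ∃[ n ] exec N check (regs x [] [] [] [] [] [] [] [] ρ , o) ≡ (checked ρ x′ y n true , o)
  exec-check-bad {o = o} {ρ} x l ¬s with malformed x in e
  ... | false = ⊥-elim (¬s (malformed-sound x e))
  ... | true  = x′ , y , n , trans (exec-check x l) (cong (λ e → checked ρ x′ y n e , o) e)
    where
    x′ = proj₁ (readAll x)
    y = proj₂ (proj₂ (header x))
    n = proj₁ (header x)

  shape? : ∀ x → Dec (Shape x)
  shape? x with malformed x in e
  ... | false = yes (malformed-sound x e)
  ... | true  = no λ { (n , M , c , refl) → contradiction (trans (sym (cong (λ i → proj₂ i ∨ nonempty (proj₁ i)) (readAll-complete n M c))) e) λ () }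

-- Writing output, and the reduction between problems with a given partition

emits : ∀ {k d} → List Bool → Prog k d
emits []       = skip
emits (b ∷ bs) = emit b ⨾ emits bs

exec-emits : ∀ {k N d} bs {s : Vec (List Bool) k} {o} → exec N (emits {d = d} bs) (s , o) ≡ (s , o ++ bs)
exec-emits []       {s} {o} = cong (s ,_) (sym (List.++-identityʳ o))
exec-emits {d = d} (b ∷ bs) {s} {o} = trans (exec-emits {d = d} bs) (cong (s ,_) (List.++-assoc o [ b ] bs))

iter-snoc : ∀ n (c : Bool) o → iter n (_++ [ c ]) o ≡ o ++ replicate n c
iter-snoc zero    c o = sym (List.++-identityʳ o)
iter-snoc (suc n) c o = trans (iter-snoc n c (o ++ [ c ])) (List.++-assoc o [ c ] (replicate n c))

emitB : ∀ {m d} → Bool → Prog (9 + m) (suc (suc d))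
emitB c = each B B′ (emit c)

exec-emitB : ∀ {N m d} c {x y z a a′ n f e o} {ρ : Vec (List Bool) m} → n ≤ N →
  exec N (emitB {d = d} c) (regs x y z a a′ (ones n) [] f e ρ , o) ≡
    (regs x y z a a′ (ones n) [] f e ρ , o ++ replicate n c)
exec-emitB {N} {d = d} c {x} {y} {z} {a} {a′} {n} {f} {e} {o} {ρ} n≤N = trans
  (exec-each {d = d} B B′ (emit c) (λ b b′ o → regs x y z a a′ b b′ f e ρ , o) (_++ [ c ]) (λ _ _ _ → refl)
    (λ b o → exec-move {d = suc d} B′ B (λ ()) _ o) (λ _ _ _ _ → refl) (ones n) o
    (length-ones n≤N))
  (cong (regs x y z a a′ (ones n) [] f e ρ ,_)
    (trans (iter-snoc (length (ones n)) c o) (cong (λ k → o ++ replicate k c) (List.length-replicate n))))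

emitY : ∀ {m d} → Prog (9 + m) (suc d)
emitY = loop (case Y skip λ b → pop Y ⨾ emit b)

exec-emitY : ∀ {N m d x} y {z a a′ b b′ f e o} {ρ : Vec (List Bool) m} → length y ≤ N →
  exec N (emitY {d = d}) (regs x y z a a′ b b′ f e ρ , o) ≡ (regs x [] z a a′ b b′ f e ρ , o ++ y)
exec-emitY {N} {d = d} {x} y {z} {a} {a′} {b} {b′} {f} {e} {o} {ρ} l = trans
  (drain (exec N (case {d = d} Y skip λ b → pop Y ⨾ emit b)) (λ y o → regs x y z a a′ b b′ f e ρ , o)
    (λ o b → o ++ [ b ])
    (λ _ → refl) (λ _ _ _ → refl) N y o l)
  (cong (regs x [] z a a′ b b′ f e ρ ,_) (snocs y o))
  where
  snocs : ∀ y o → List.foldl (λ o b → o ++ [ b ]) o y ≡ o ++ y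
  snocs []      o = sym (List.++-identityʳ o)
  snocs (b ∷ y) o = trans (snocs y (o ++ [ b ])) (List.++-assoc o [ b ] y)

reduce : ∀ {k d C L L′} (p : Prog (suc k) d) → (∀ x → L x ⇔ L′ (run p x)) → C ≤ₚ L → C ≤ₚ L′
reduce p h (f , f-poly , e) = run p ∘ f , PolyTime-run p f-poly , λ x → h (f x) ⇔-∘ e x

order≤length : ∀ n y → n ≤ length (unary n ++ y)
order≤length zero    y = z≤n
order≤length (suc n) y = s≤s (order≤length n y)

-- Here `r` and `ℓ` belong to the problem that is reduced, so a string using a part that is only
-- available in the target is discarded. The empty string encodes no graph, as every encoding begins
-- with a unary number.
gate : ℕ → ℕ → Prog 9 3
gate r ℓ = check (partition r ℓ) ⨾ case E (emitB true ⨾ emit false ⨾ emitY) λ _ → skip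

run-gate-good : ∀ r ℓ x → Shape (partition r ℓ) x → run (gate r ℓ) x ≡ x
run-gate-good r ℓ x (n , M , c , refl) =
  run-exec (gate r ℓ) x (exec≡ h ▷
  accept (exec≡ (exec-emitB {d = 1} true {x = []} n≤N) ▷ exec≡ {p = emit {d = 3} false} refl ▷
  exec≡ (exec-emitY {d = 2} m m≤N)))
  where
  N = length x
  m = encodeRows M ++ encodeAll encodePart c
  n≤N = order≤length n m
  m≤N = List.length-++-≤ʳ m {unary n}
  h = exec-check-good (partition r ℓ) {N} {o = []} {[]} n M c ℕ.≤-refl
  accept : ∀ {p : Prog 9 3} {q t} → Exec N p (checked (partition r ℓ) [] [] m n false , []) t →
           Exec N (case E p q) (checked (partition r ℓ) [] [] m n false , []) t
  accept (exec≡ e) = exec≡ e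

run-gate-bad : ∀ r ℓ x → ¬ Shape (partition r ℓ) x → run (gate r ℓ) x ≡ []
run-gate-bad r ℓ x ¬s =
  let x′ , y , n , h = exec-check-bad (partition r ℓ) {length x} {o = []} {[]} x ℕ.≤-refl ¬s in
  run-exec (gate r ℓ) x (exec≡ h ▷ exec≡ {p = case E (emitB true ⨾ emit false ⨾ emitY) λ _ → skip} refl)

-- Encodings

unary-injective : ∀ m n {x y} → unary m ++ x ≡ unary n ++ y → m ≡ n × x ≡ y
unary-injective zero    zero    e = refl , List.∷-injectiveʳ e
unary-injective (suc m) (suc n) e = Product.map₁ (cong suc) (unary-injective m n (List.∷-injectiveʳ e))

-- Two encoders and a relation instead of equality: rows are to be compared entry by entry, and
-- parts with parts from a larger range.
encodeAll-injective : ∀ {C D : Set} {enc : C → List Bool} {enc′ : D → List Bool} {R : C → D → Set} →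
  (∀ a b {x y} → enc a ++ x ≡ enc′ b ++ y → R a b × x ≡ y) →
  ∀ {n} (as : Vec C n) (bs : Vec D n) {x y} → encodeAll enc as ++ x ≡ encodeAll enc′ bs ++ y →
  (∀ i → R (lookup as i) (lookup bs i)) × x ≡ y
encodeAll-injective inj [] [] e = (λ ()) , e
encodeAll-injective {enc = enc} {enc′} inj (a ∷ as) (b ∷ bs) e
  with inj a b (trans (sym (List.++-assoc (enc a) _ _)) (trans e (List.++-assoc (enc′ b) _ _)))
... | r , e₁ with encodeAll-injective inj as bs e₁
... | rs , e₂ = (λ { zero → r ; (suc i) → rs i }) , e₂

entry : ∀ {m n} → Vec (Vec Bool n) m → Fin m → Fin n → Bool
entry M u v = lookup (lookup M u) v

encodeRows-injective : ∀ {m n} (M M′ : Vec (Vec Bool n) m) {x y} → encodeRows M ++ x ≡ encodeRows M′ ++ y →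
                       (∀ u v → entry M u v ≡ entry M′ u v) × x ≡ y
encodeRows-injective = encodeAll-injective
  (λ s t → encodeAll-injective (λ { a b e → List.∷-injective e }) s t)

encodePart-injective : ∀ {r ℓ} (a b : Fin r ⊎ Fin ℓ) {x y} → encodePart a ++ x ≡ encodePart b ++ y → a ≡ b ×
  x ≡ y
encodePart-injective (inj₁ i) (inj₁ j) e =
  Product.map₁ (cong inj₁ ∘ Fin.toℕ-injective) (unary-injective (toℕ i) (toℕ j) (List.∷-injectiveʳ e))
encodePart-injective (inj₁ i) (inj₂ j) ()
encodePart-injective (inj₂ i) (inj₁ j) ()
encodePart-injective (inj₂ i) (inj₂ j) e =
  Product.map₁ (cong inj₂ ∘ Fin.toℕ-injective) (unary-injective (toℕ i) (toℕ j) (List.∷-injectiveʳ e))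

encodeAll-tabulate : ∀ {C : Set} {n} (enc : C → List Bool) (f : Fin n → C) →
                     encodeAll enc (Vec.tabulate f) ≡ concat (List.tabulate (enc ∘ f))
encodeAll-tabulate {n = zero}  enc f = refl
encodeAll-tabulate {n = suc n} enc f = cong (enc (f zero) ++_) (encodeAll-tabulate enc (f ∘ suc))

encodeAll-bits : ∀ {n} (f : Fin n → Bool) → encodeAll [_] (Vec.tabulate f) ≡ List.tabulate f
encodeAll-bits {zero}  f = refl
encodeAll-bits {suc n} f = cong (f zero ∷_) (encodeAll-bits (f ∘ suc))

adjacencyMatrix : (G : Graph) → Matrix (Graph.order G)
adjacencyMatrix G = Vec.tabulate λ u → Vec.tabulate (Graph.adj G u)

entry-adjacencyMatrix : ∀ G u v → entry (adjacencyMatrix G) u v ≡ Graph.adj G u v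
entry-adjacencyMatrix G u v =
  trans (cong (λ s → lookup s v) (Vec.lookup∘tabulate (λ u → Vec.tabulate (Graph.adj G u)) u))
    (Vec.lookup∘tabulate (Graph.adj G u) v)

encodeGraph-matrix : ∀ G → encodeGraph G ≡ unary (Graph.order G) ++ encodeRows (adjacencyMatrix G)
encodeGraph-matrix G = cong (unary (Graph.order G) ++_) (sym (trans
  (encodeAll-tabulate (encodeAll [_]) (λ u → Vec.tabulate (Graph.adj G u)))
  (cong concat (List.tabulate-cong (λ u → encodeAll-bits (Graph.adj G u))))))

encodePartitioned-shape : ∀ {r ℓ} G (π : Partition G r ℓ) → encodePartitioned G π ≡
  unary (Graph.order G) ++ encodeRows (adjacencyMatrix G) ++ encodeAll encodePart
    (Vec.tabulate (Partition.part π))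
encodePartitioned-shape G π = trans
  (cong₂ _++_ (encodeGraph-matrix G) (sym (encodeAll-tabulate encodePart (Partition.part π))))
  (List.++-assoc (unary (Graph.order G)) (encodeRows (adjacencyMatrix G)) _)

-- Enlarging the number of parts leaves the encoding of a partition unchanged.
module _ {r r′ ℓ ℓ′} (f : Fin r → Fin r′) (g : Fin ℓ → Fin ℓ′)
         (f-toℕ : ∀ i → toℕ (f i) ≡ toℕ i) (g-toℕ : ∀ j → toℕ (g j) ≡ toℕ j)
         (h : List Bool → List Bool)
         (h-good : ∀ x → Shape (partition r ℓ) x → h x ≡ x) (h-bad : ∀ x → ¬ Shape (partition r ℓ) x → h x ≡ []) where

  widen : Fin r ⊎ Fin ℓ → Fin r′ ⊎ Fin ℓ′
  widen = Sum.map f g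

  encodePart-widen : ∀ p → encodePart (widen p) ≡ encodePart p
  encodePart-widen (inj₁ i) = cong (λ k → false ∷ unary k) (f-toℕ i)
  encodePart-widen (inj₂ j) = cong (λ k → true ∷ unary k) (g-toℕ j)

  widen-inj₁ : ∀ {p i} → widen p ≡ inj₁ (f i) → p ≡ inj₁ i
  widen-inj₁ {inj₁ i′} {i} e = cong inj₁
    (Fin.toℕ-injective (trans (sym (f-toℕ i′)) (trans (cong toℕ (inj₁-injective e)) (f-toℕ i))))

  widen-inj₂ : ∀ {p j} → widen p ≡ inj₂ (g j) → p ≡ inj₂ j
  widen-inj₂ {inj₂ j′} {j} e = cong inj₂
    (Fin.toℕ-injective (trans (sym (g-toℕ j′)) (trans (cong toℕ (inj₂-injective e)) (g-toℕ j))))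

  widen-wc : ∀ x → wc-rℓg r ℓ x ⇔ wc-rℓg r′ ℓ′ (h x)
  widen-wc x = mk⇔ to from
    where
    to : wc-rℓg r ℓ x → wc-rℓg r′ ℓ′ (h x)
    to (G , π , refl , wc) = G , π′ ,
      trans e′ (sym (h-good x (Graph.order G , adjacencyMatrix G , Vec.tabulate (Partition.part π) ,
      encodePartitioned-shape G π))) , wc
      where
      open Partition π
      π′ : Partition G r′ ℓ′
      π′ = record
        { part        = widen ∘ part
        ; independent = λ i {u} {v} pu pv → case₁ i (part u) pu (part v) pv refl refl
        ; clique      = λ j {u} {v} pu pv → case₂ j (part u) pu (part v) pv refl refl }
        where
        case₁ : ∀ i {u v} p → widen p ≡ inj₁ i → ∀ q → widen q ≡ inj₁ i → part u ≡ p → part v ≡ q →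
          ¬ Graph.Adjacent G u v
        case₁ i (inj₁ k) refl q hq hu hv = independent k hu (trans hv (widen-inj₁ {q} hq))
        case₂ : ∀ j {u v} p → widen p ≡ inj₂ j → ∀ q → widen q ≡ inj₂ j → part u ≡ p → part v ≡ q → u ≢ v →
          Graph.Adjacent G u v
        case₂ j (inj₂ k) refl q hq hu hv = clique k hu (trans hv (widen-inj₂ {q} hq))
      e′ : encodePartitioned G π′ ≡ encodePartitioned G π
      e′ = cong (encodeGraph G ++_) (cong concat (List.tabulate-cong (encodePart-widen ∘ part)))

    from : wc-rℓg r′ ℓ′ (h x) → wc-rℓg r ℓ x
    from (G , π′ , e , wc) with shape? (partition r ℓ) x
    ... | no ¬s = ⊥-elim (no-nil (Graph.order G) (trans (sym (encodePartitioned-shape G π′)) (trans e (h-bad x ¬s))))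
      where
      no-nil : ∀ n {y} → unary n ++ y ≢ []
      no-nil zero    ()
      no-nil (suc n) ()
    ... | yes s@(n , M , c , refl) with trans (sym (encodePartitioned-shape G π′)) (trans e (h-good x s))
    ... | h₀ with unary-injective (Graph.order G) n h₀
    ... | refl , h₁ with encodeRows-injective (adjacencyMatrix G) M h₁
    ... | _ , h₂ = G , π , trans (cong (encodeGraph G ++_) (cong concat (List.tabulate-cong encodePart-part)))
                           (trans e (h-good x s)) , wc
      where
      open Partition π′ renaming (part to part′)
      -- The string passed the check for `r` and `ℓ`, and its codes can be read in only one way. So
      -- the partition with more parts uses none of the additional ones and can be narrowed.
      parts : ∀ v → part′ v ≡ widen (lookup c v)
      parts v = trans (sym (Vec.lookup∘tabulate part′ v))
        (proj₁ (encodeAll-injective {R = λ a b → a ≡ widen b}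
          (λ a b e → encodePart-injective a (widen b) (trans e (cong (_++ _) (sym (encodePart-widen b)))))
          (Vec.tabulate part′) c (cong (_++ []) h₂)) v)
      encodePart-part : ∀ v → encodePart (lookup c v) ≡ encodePart (part′ v)
      encodePart-part v = trans (sym (encodePart-widen (lookup c v))) (cong encodePart (sym (parts v)))
      π : Partition G r ℓ
      π = record
        { part        = lookup c
        ; independent = λ i pu pv → independent (f i) (trans (parts _) (cong widen pu))
          (trans (parts _) (cong widen pv))
        ; clique      = λ j pu pv → clique (g j) (trans (parts _) (cong widen pu))
          (trans (parts _) (cong widen pv)) }

widen-hard : ∀ {r r′ ℓ ℓ′} (f : Fin r → Fin r′) (g : Fin ℓ → Fin ℓ′) →
             (∀ i → toℕ (f i) ≡ toℕ i) → (∀ j → toℕ (g j) ≡ toℕ j) → CoNPHard (wc-rℓg r ℓ) →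
               CoNPHard (wc-rℓg r′ ℓ′)
widen-hard {r} {ℓ = ℓ} f g f-toℕ g-toℕ hard C C∈ =
  reduce {L = wc-rℓg r ℓ} {wc-rℓg _ _} (gate r ℓ)
  (widen-wc f g f-toℕ g-toℕ (run (gate r ℓ)) (run-gate-good r ℓ) (run-gate-bad r ℓ)) (hard C C∈)

-- Maximal independent sets as kernels

search : ∀ {n} (p : Fin n → Bool) → (∃[ i ] p i ≡ true) ⊎ (∀ i → p i ≡ false)
search {zero}  p = inj₂ λ ()
search {suc n} p with p zero in e
... | true  = inj₁ (zero , e)
... | false = Sum.map (Product.map suc id) (λ h → λ { zero → e ; (suc i) → h i }) (search (p ∘ suc))

∈⇒lookup : ∀ {n} {S : Subset n} {v} → v ∈ S → lookup S v ≡ true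
∈⇒lookup = Vec.[]=⇒lookup

lookup⇒∈ : ∀ {n} {S : Subset n} {v} → lookup S v ≡ true → v ∈ S
lookup⇒∈ {S = S} {v} = Vec.lookup⇒[]= v S

-- An independent dominating set. The notion makes sense for any Boolean matrix, even before it is
-- known to be the adjacency matrix of a graph.
record Kernel {n} (a : Fin n → Fin n → Bool) (S : Subset n) : Set where
  field
    independent : ∀ u v → lookup S u ≡ true → lookup S v ≡ true → a u v ≡ false
    dominating  : ∀ v → lookup S v ≡ false → ∃[ u ] lookup S u ≡ true × a u v ≡ true

module _ (G : Graph) where
  open Graph G

  -- A vertex outside S without a neighbour in S could be added to S, against maximality.
  maximal⇒kernel : ∀ {S} → IsMaximalIndependent G S → Kernel adj S
  maximal⇒kernel {S} (ind , max) = record { independent = ind′ ; dominating = dom }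
    where
    ind′ : ∀ u v → lookup S u ≡ true → lookup S v ≡ true → adj u v ≡ false
    ind′ u v hu hv = Bool.¬-not (ind (lookup⇒∈ hu) (lookup⇒∈ hv))
    dom : ∀ v → lookup S v ≡ false → ∃[ u ] lookup S u ≡ true × adj u v ≡ true
    dom v hv with search (λ u → lookup S u ∧ adj u v)
    ... | inj₁ (u , h) = u , Bool.∧-conicalˡ _ _ h , Bool.∧-conicalʳ _ _ h
    ... | inj₂ h = contradiction (trans (sym hv) (∈⇒lookup (max T T-ind S⊆T (lookup⇒∈ (Vec.lookup∘updateAt v S))))) λ ()
      where
      T = S Vec.[ v ]≔ true
      T-cases : ∀ {w} → w ∈ T → w ≡ v ⊎ lookup S w ≡ true
      T-cases {w} h with w Fin.≟ v
      ... | yes e = inj₁ e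
      ... | no ¬e = inj₂ (trans (sym (Vec.lookup∘updateAt′ w v ¬e S)) (∈⇒lookup h))
      isolated : ∀ {w} → lookup S w ≡ true → adj w v ≢ true
      isolated {w} hw a = contradiction (trans (sym (h w)) (cong₂ _∧_ hw a)) λ ()
      T-ind : IsIndependent G (_∈ T)
      T-ind hu hw a with T-cases hu | T-cases hw
      ... | inj₁ refl | inj₁ refl = contradiction (trans (sym (adj-irrefl v)) a) λ ()
      ... | inj₁ refl | inj₂ h₂   = isolated h₂ (trans (adj-sym _ v) a)
      ... | inj₂ h₁   | inj₁ refl = isolated h₁ a
      ... | inj₂ h₁   | inj₂ h₂   = ind (lookup⇒∈ h₁) (lookup⇒∈ h₂) a
      S⊆T : ∀ {w} → w ∈ S → w ∈ T
      S⊆T {w} hw with w Fin.≟ v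
      ... | yes refl = lookup⇒∈ (Vec.lookup∘updateAt v S)
      ... | no ¬e    = lookup⇒∈ (trans (Vec.lookup∘updateAt′ w v ¬e S) (∈⇒lookup hw))

  kernel⇒maximal : ∀ {S} → Kernel adj S → IsMaximalIndependent G S
  kernel⇒maximal {S} k = (λ hu hv a →
    contradiction (trans (sym (independent _ _ (∈⇒lookup hu) (∈⇒lookup hv))) a) λ ()) , max
    where
    open Kernel k
    max : ∀ T → IsIndependent G (_∈ T) → (∀ {v} → v ∈ S → v ∈ T) → ∀ {v} → v ∈ T → v ∈ S
    max T T-ind S⊆T {v} hv with lookup S v in e
    ... | true  = lookup⇒∈ e
    ... | false with dominating v e
    ... | u , hu , a = ⊥-elim (T-ind (S⊆T (lookup⇒∈ hu)) hv a)

EqualKernels : Graph → Set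
EqualKernels G = ∀ S T → Kernel (Graph.adj G) S → Kernel (Graph.adj G) T → ∣ S ∣ ≡ ∣ T ∣

wellCovered⇔ : ∀ G → WellCovered G ⇔ EqualKernels G
wellCovered⇔ G = mk⇔ (λ wc S T hS hT → wc S T (kernel⇒maximal G hS) (kernel⇒maximal G hT))
                     (λ ek S T hS hT → ek S T (maximal⇒kernel G hS) (maximal⇒kernel G hT))

module _ {n} {a a′ : Fin n → Fin n → Bool} (eq : ∀ u v → a u v ≡ a′ u v) where

  -- An encoding determines an adjacency function only pointwise. Without function extensionality,
  -- kernels, partitions and well-coveredness have to be transported one by one.
  kernel-cong : ∀ {S} → Kernel a S → Kernel a′ S
  kernel-cong k = record
    { independent = λ u v hu hv → trans (sym (eq u v)) (independent u v hu hv)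
    ; dominating  = λ v hv → let u , hu , e = dominating v hv in u , hu , trans (sym (eq u v)) e }
    where open Kernel k

  partition-cong : ∀ {s i s′ i′ r ℓ} →
    Partition (record { order = n ; adj = a ; adj-sym = s ; adj-irrefl = i }) r ℓ →
    Partition (record { order = n ; adj = a′ ; adj-sym = s′ ; adj-irrefl = i′ }) r ℓ
  partition-cong π = record
    { part        = part
    ; independent = λ i pu pv e → independent i pu pv (trans (eq _ _) e)
    ; clique      = λ j pu pv u≢v → trans (sym (eq _ _)) (clique j pu pv u≢v) }
    where open Partition π

wellCovered-cong : ∀ {n} {a a′ : Fin n → Fin n → Bool} → (∀ u v → a u v ≡ a′ u v) → ∀ {s i s′ i′} →
  WellCovered (record { order = n ; adj = a ; adj-sym = s ; adj-irrefl = i }) →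
  WellCovered (record { order = n ; adj = a′ ; adj-sym = s′ ; adj-irrefl = i′ })
wellCovered-cong eq {s} {i} {s′} {i′} wc =
  Equivalence.from (wellCovered⇔ (record { adj = _ ; adj-sym = s′ ; adj-irrefl = i′ })) λ S T hS hT →
  Equivalence.to (wellCovered⇔ (record { adj = _ ; adj-sym = s ; adj-irrefl = i })) wc S T
    (kernel-cong (λ u v → sym (eq u v)) hS) (kernel-cong (λ u v → sym (eq u v)) hT)

-- Disjoint unions and joins

-- `c` is the entry between the two sides: `false` gives the disjoint union and `true` the join.
glueRows : ∀ {n h} → Bool → Matrix n → Matrix h → Matrix (n + h)
glueRows {n} {h} c M H = Vec.map (Vec._++ Vec.replicate h c) M Vec.++ Vec.map (Vec.replicate n c Vec.++_) H

module _ {n h} (c : Bool) (M : Matrix n) (H : Matrix h) where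

  private
    row-ˡ : ∀ u → lookup (glueRows c M H) (u ↑ˡ h) ≡ lookup M u Vec.++ Vec.replicate h c
    row-ˡ u = trans (Vec.lookup-++ˡ (Vec.map (Vec._++ Vec.replicate h c) M)
      (Vec.map (Vec.replicate n c Vec.++_) H) u) (Vec.lookup-map u (Vec._++ Vec.replicate h c) M)
    row-ʳ : ∀ u → lookup (glueRows c M H) (n ↑ʳ u) ≡ Vec.replicate n c Vec.++ lookup H u
    row-ʳ u = trans (Vec.lookup-++ʳ (Vec.map (Vec._++ Vec.replicate h c) M)
      (Vec.map (Vec.replicate n c Vec.++_) H) u) (Vec.lookup-map u (Vec.replicate n c Vec.++_) H)

  entry-ˡˡ : ∀ u v → entry (glueRows c M H) (u ↑ˡ h) (v ↑ˡ h) ≡ entry M u v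
  entry-ˡˡ u v rewrite row-ˡ u = Vec.lookup-++ˡ (lookup M u) _ v

  entry-ˡʳ : ∀ u v → entry (glueRows c M H) (u ↑ˡ h) (n ↑ʳ v) ≡ c
  entry-ˡʳ u v rewrite row-ˡ u = trans (Vec.lookup-++ʳ (lookup M u) _ v) (Vec.lookup-replicate v c)

  entry-ʳˡ : ∀ u v → entry (glueRows c M H) (n ↑ʳ u) (v ↑ˡ h) ≡ c
  entry-ʳˡ u v rewrite row-ʳ u = trans (Vec.lookup-++ˡ (Vec.replicate n c) _ v) (Vec.lookup-replicate v c)

  entry-ʳʳ : ∀ u v → entry (glueRows c M H) (n ↑ʳ u) (n ↑ʳ v) ≡ entry H u v
  entry-ʳʳ u v rewrite row-ʳ u = Vec.lookup-++ʳ (Vec.replicate n c) _ v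

data Sides {n h} : Fin (n + h) → Set where
  inˡ : ∀ u → Sides (u ↑ˡ h)
  inʳ : ∀ u → Sides (n ↑ʳ u)

sides : ∀ {n h} (u : Fin (n + h)) → Sides {n} {h} u
sides {zero}  u       = inʳ u
sides {suc n} zero    = inˡ zero
sides {suc n} (suc u) with sides {n} u
... | inˡ v = inˡ (suc v)
... | inʳ v = inʳ v

IsAdjacency : ∀ {n} → Matrix n → Set
IsAdjacency M = (∀ u v → entry M u v ≡ entry M v u) × (∀ v → entry M v v ≡ false)

graph : ∀ {n} (M : Matrix n) → IsAdjacency M → Graph
graph {n} M (s , i) = record { order = n ; adj = entry M ; adj-sym = s ; adj-irrefl = i }

encodeGraph-graph : ∀ {n} (M : Matrix n) i → encodeGraph (graph M i) ≡ unary n ++ encodeRows M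
encodeGraph-graph {n} M i = trans (encodeGraph-matrix (graph M i))
  (cong (λ M → unary n ++ encodeRows M)
    (trans (Vec.tabulate-cong (λ u → Vec.tabulate∘lookup (lookup M u))) (Vec.tabulate∘lookup M)))

isAdjacency-adjacencyMatrix : ∀ G → IsAdjacency (adjacencyMatrix G)
isAdjacency-adjacencyMatrix G =
  (λ u v → trans (entry-adjacencyMatrix G u v)
    (trans (Graph.adj-sym G u v) (sym (entry-adjacencyMatrix G v u)))) ,
  (λ v → trans (entry-adjacencyMatrix G v v) (Graph.adj-irrefl G v))

module _ {n h} (c : Bool) (M : Matrix n) (H : Matrix h) where

  isAdjacency-glue : IsAdjacency M → IsAdjacency H → IsAdjacency (glueRows c M H)
  isAdjacency-glue (sM , iM) (sH , iH) = s , i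
    where
    s : ∀ u v → entry (glueRows c M H) u v ≡ entry (glueRows c M H) v u
    s u v with sides {n} u | sides {n} v
    ... | inˡ u | inˡ v = trans (entry-ˡˡ c M H u v) (trans (sM u v) (sym (entry-ˡˡ c M H v u)))
    ... | inˡ u | inʳ v = trans (entry-ˡʳ c M H u v) (sym (entry-ʳˡ c M H v u))
    ... | inʳ u | inˡ v = trans (entry-ʳˡ c M H u v) (sym (entry-ˡʳ c M H v u))
    ... | inʳ u | inʳ v = trans (entry-ʳʳ c M H u v) (trans (sH u v) (sym (entry-ʳʳ c M H v u)))
    i : ∀ v → entry (glueRows c M H) v v ≡ false
    i v with sides {n} v
    ... | inˡ v = trans (entry-ˡˡ c M H v v) (iM v)
    ... | inʳ v = trans (entry-ʳʳ c M H v v) (iH v)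

  isAdjacency-left : IsAdjacency (glueRows c M H) → IsAdjacency M
  isAdjacency-left (s , i) =
    (λ u v → trans (sym (entry-ˡˡ c M H u v)) (trans (s _ _) (entry-ˡˡ c M H v u))) ,
    (λ v → trans (sym (entry-ˡˡ c M H v v)) (i _))

edgeless completeGraph : ∀ m → Matrix m
edgeless m = Vec.replicate m (Vec.replicate m false)
completeGraph m = Vec.tabulate λ u → Vec.tabulate λ v → not (does (u Fin.≟ v))

entry-edgeless : ∀ {m} u v → entry (edgeless m) u v ≡ false
entry-edgeless {m} u v = trans (cong (λ s → lookup s v) (Vec.lookup-replicate u (Vec.replicate m false)))
  (Vec.lookup-replicate v false)

isAdjacency-edgeless : ∀ m → IsAdjacency (edgeless m)
isAdjacency-edgeless m = (λ u v → trans (entry-edgeless u v) (sym (entry-edgeless v u))) , λ v →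
  entry-edgeless v v

entry-complete : ∀ {m} (u v : Fin m) → entry (completeGraph m) u v ≡ not (does (u Fin.≟ v))
entry-complete {m} u v = trans
  (cong (λ s → lookup s v) (Vec.lookup∘tabulate (λ u → Vec.tabulate λ v → not (does (u Fin.≟ v))) u))
  (Vec.lookup∘tabulate (λ v → not (does (u Fin.≟ v))) v)

complete-adjacent : ∀ {m} {u v : Fin m} → u ≢ v → entry (completeGraph m) u v ≡ true
complete-adjacent {u = u} {v} ne = trans (entry-complete u v) (cong not (dec-false (u Fin.≟ v) ne))

complete-irrefl : ∀ {m} (u : Fin m) → entry (completeGraph m) u u ≡ false
complete-irrefl u = trans (entry-complete u u) (cong not (dec-true (u Fin.≟ u) refl))

isAdjacency-complete : ∀ m → IsAdjacency (completeGraph m)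
isAdjacency-complete m = s , complete-irrefl
  where
  s : ∀ u v → entry (completeGraph m) u v ≡ entry (completeGraph m) v u
  s u v with u Fin.≟ v
  ... | yes refl = refl
  ... | no ne    = trans (complete-adjacent ne) (sym (complete-adjacent (ne ∘ sym)))

-- Kernels of unions and joins

∣++∣ : ∀ {n h} (S : Subset n) (T : Subset h) → ∣ S Vec.++ T ∣ ≡ ∣ S ∣ + ∣ T ∣
∣++∣ []          T = refl
∣++∣ (true ∷ S)  T = cong suc (∣++∣ S T)
∣++∣ (false ∷ S) T = ∣++∣ S T

∣empty∣ : ∀ {n} (S : Subset n) → (∀ v → lookup S v ≡ false) → ∣ S ∣ ≡ 0
∣empty∣ []          h = refl
∣empty∣ (true ∷ S)  h = contradiction (h zero) λ ()
∣empty∣ (false ∷ S) h = ∣empty∣ S (h ∘ suc)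

∣full∣ : ∀ {n} (S : Subset n) → (∀ v → lookup S v ≡ true) → ∣ S ∣ ≡ n
∣full∣ []          h = refl
∣full∣ (true ∷ S)  h = cong suc (∣full∣ S (h ∘ suc))
∣full∣ (false ∷ S) h = contradiction (h zero) λ ()

∣single∣ : ∀ {n} (S : Subset n) u → lookup S u ≡ true → (∀ v → v ≢ u → lookup S v ≡ false) → ∣ S ∣ ≡ 1
∣single∣ (true ∷ S)  zero    h h′ = cong suc (∣empty∣ S (λ v → h′ (suc v) λ ()))
∣single∣ (true ∷ S)  (suc u) h h′ = contradiction (h′ zero λ ()) λ ()
∣single∣ (false ∷ S) (suc u) h h′ = ∣single∣ S u h (λ v ne → h′ (suc v) (ne ∘ Fin.suc-injective))

module _ {n h} {M : Matrix n} {H : Matrix h} {S : Subset n} {T : Subset h} where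

  private
    ˡ : ∀ u → lookup (S Vec.++ T) (u ↑ˡ h) ≡ lookup S u
    ˡ = Vec.lookup-++ˡ S T
    ʳ : ∀ u → lookup (S Vec.++ T) (n ↑ʳ u) ≡ lookup T u
    ʳ = Vec.lookup-++ʳ S T

  kernel-union : Kernel (entry M) S → Kernel (entry H) T → Kernel (entry (glueRows false M H)) (S Vec.++ T)
  kernel-union kS kT = record { independent = ind ; dominating = dom }
    where
    module S = Kernel kS
    module T = Kernel kT
    ind : ∀ u v → lookup (S Vec.++ T) u ≡ true → lookup (S Vec.++ T) v ≡ true →
      entry (glueRows false M H) u v ≡ false
    ind u v hu hv with sides {n} u | sides {n} v
    ... | inˡ u | inˡ v = trans (entry-ˡˡ false M H u v) (S.independent u v (trans (sym (ˡ u)) hu) (trans (sym (ˡ v)) hv))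
    ... | inˡ u | inʳ v = entry-ˡʳ false M H u v
    ... | inʳ u | inˡ v = entry-ʳˡ false M H u v
    ... | inʳ u | inʳ v = trans (entry-ʳʳ false M H u v) (T.independent u v (trans (sym (ʳ u)) hu) (trans (sym (ʳ v)) hv))
    dom : ∀ v → lookup (S Vec.++ T) v ≡ false → ∃[ u ] lookup (S Vec.++ T) u ≡ true ×
      entry (glueRows false M H) u v ≡ true
    dom v hv with sides {n} v
    ... | inˡ v = let u , hu , e = S.dominating v (trans (sym (ˡ v)) hv) in _ , trans (ˡ u) hu , trans (entry-ˡˡ false M H u v) e
    ... | inʳ v = let u , hu , e = T.dominating v (trans (sym (ʳ v)) hv) in _ , trans (ʳ u) hu , trans (entry-ʳʳ false M H u v) e

  kernel-unionˡ : Kernel (entry (glueRows false M H)) (S Vec.++ T) → Kernel (entry M) S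
  kernel-unionˡ k = record
    { independent = λ u v hu hv → trans (sym (entry-ˡˡ false M H u v))
      (independent _ _ (trans (ˡ u) hu) (trans (ˡ v) hv))
    ; dominating  = λ v hv → dom v (dominating _ (trans (ˡ v) hv)) }
    where
    open Kernel k
    dom : ∀ v → ∃[ u ] lookup (S Vec.++ T) u ≡ true × entry (glueRows false M H) u (v ↑ˡ h) ≡ true →
          ∃[ u ] lookup S u ≡ true × entry M u v ≡ true
    dom v (u , hu , e) with sides {n} u
    ... | inˡ u = u , trans (sym (ˡ u)) hu , trans (sym (entry-ˡˡ false M H u v)) e
    ... | inʳ u = contradiction (trans (sym e) (entry-ʳˡ false M H u v)) λ ()

  kernel-unionʳ : Kernel (entry (glueRows false M H)) (S Vec.++ T) → Kernel (entry H) T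
  kernel-unionʳ k = record
    { independent = λ u v hu hv → trans (sym (entry-ʳʳ false M H u v))
      (independent _ _ (trans (ʳ u) hu) (trans (ʳ v) hv))
    ; dominating  = λ v hv → dom v (dominating _ (trans (ʳ v) hv)) }
    where
    open Kernel k
    dom : ∀ v → ∃[ u ] lookup (S Vec.++ T) u ≡ true × entry (glueRows false M H) u (n ↑ʳ v) ≡ true →
          ∃[ u ] lookup T u ≡ true × entry H u v ≡ true
    dom v (u , hu , e) with sides {n} u
    ... | inˡ u = contradiction (trans (sym e) (entry-ˡʳ false M H u v)) λ ()
    ... | inʳ u = u , trans (sym (ʳ u)) hu , trans (sym (entry-ʳʳ false M H u v)) e

  -- A single member of S dominates all of H through the added edges. Nonemptiness matters: the
  -- empty kernel of a graph without vertices would leave H undominated.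
  kernel-join : Kernel (entry M) S → ∃[ u ] lookup S u ≡ true → (∀ v → lookup T v ≡ false) →
                Kernel (entry (glueRows true M H)) (S Vec.++ T)
  kernel-join k (u₀ , h₀) empty = record { independent = ind ; dominating = dom }
    where
    open Kernel k
    ind : ∀ u v → lookup (S Vec.++ T) u ≡ true → lookup (S Vec.++ T) v ≡ true →
      entry (glueRows true M H) u v ≡ false
    ind u v hu hv with sides {n} u | sides {n} v
    ... | inˡ u | inˡ v = trans (entry-ˡˡ true M H u v) (independent u v (trans (sym (ˡ u)) hu) (trans (sym (ˡ v)) hv))
    ... | inʳ u | _     = contradiction (trans (sym hu) (trans (ʳ u) (empty u))) λ ()
    ... | inˡ u | inʳ v = contradiction (trans (sym hv) (trans (ʳ v) (empty v))) λ ()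
    dom : ∀ v → lookup (S Vec.++ T) v ≡ false → ∃[ u ] lookup (S Vec.++ T) u ≡ true ×
      entry (glueRows true M H) u v ≡ true
    dom v hv with sides {n} v
    ... | inˡ v = let u , hu , e = dominating v (trans (sym (ˡ v)) hv) in _ , trans (ˡ u) hu , trans (entry-ˡˡ true M H u v) e
    ... | inʳ v = u₀ ↑ˡ h , trans (ˡ u₀) h₀ , entry-ˡʳ true M H u₀ v

  -- All edges between the two sides are present, so an independent set that meets one side avoids
  -- the other.
  kernel-joinˡ : Kernel (entry (glueRows true M H)) (S Vec.++ T) → ∃[ u ] lookup S u ≡ true →
                 Kernel (entry M) S × (∀ v → lookup T v ≡ false)
  kernel-joinˡ k (u₀ , h₀) = record
    { independent = λ u v hu hv → trans (sym (entry-ˡˡ true M H u v))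
      (independent _ _ (trans (ˡ u) hu) (trans (ˡ v) hv))
    ; dominating  = λ v hv → dom v (dominating _ (trans (ˡ v) hv)) } , empty
    where
    open Kernel k
    empty : ∀ v → lookup T v ≡ false
    empty v = Bool.¬-not λ hv → contradiction
      (trans (sym (entry-ˡʳ true M H u₀ v)) (independent _ _ (trans (ˡ u₀) h₀) (trans (ʳ v) hv))) λ ()
    dom : ∀ v → ∃[ u ] lookup (S Vec.++ T) u ≡ true × entry (glueRows true M H) u (v ↑ˡ h) ≡ true →
          ∃[ u ] lookup S u ≡ true × entry M u v ≡ true
    dom v (u , hu , e) with sides {n} u
    ... | inˡ u = u , trans (sym (ˡ u)) hu , trans (sym (entry-ˡˡ true M H u v)) e
    ... | inʳ u = contradiction (trans (sym hu) (trans (ʳ u) (empty u))) λ ()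

  -- The set avoids M as before; nothing in an edgeless H can dominate a vertex of H, so all of H
  -- must belong to the set.
  kernel-joinʳ : Kernel (entry (glueRows true M H)) (S Vec.++ T) → (∀ u v → entry H u v ≡ false) →
    ∃[ u ] lookup T u ≡ true →
                 (∀ v → lookup S v ≡ false) × (∀ v → lookup T v ≡ true)
  kernel-joinʳ k edgeless (u₀ , h₀) = empty , full
    where
    open Kernel k
    empty : ∀ v → lookup S v ≡ false
    empty v = Bool.¬-not λ hv → contradiction
      (trans (sym (entry-ʳˡ true M H u₀ v)) (independent _ _ (trans (ʳ u₀) h₀) (trans (ˡ v) hv))) λ ()
    full : ∀ v → lookup T v ≡ true
    full v with lookup T v in hv
    ... | true  = refl
    ... | false with dominating (n ↑ʳ v) (trans (ʳ v) hv)
    ... | u , hu , e with sides {n} u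
    ... | inˡ u = contradiction (trans (sym hu) (trans (ˡ u) (empty u))) λ ()
    ... | inʳ u = contradiction (trans (sym e) (trans (entry-ʳʳ true M H u v) (edgeless u v))) λ ()

EqualKernelsOf : ∀ {n} → Matrix n → Set
EqualKernelsOf M = ∀ S T → Kernel (entry M) S → Kernel (entry M) T → ∣ S ∣ ≡ ∣ T ∣

module _ {n h} (M : Matrix n) (H : Matrix h) where

  union-equalKernels : EqualKernelsOf M → EqualKernelsOf H → EqualKernelsOf (glueRows false M H)
  union-equalKernels eM eH S T kS kT with Vec.splitAt n S | Vec.splitAt n T
  ... | S₁ , S₂ , refl | T₁ , T₂ , refl = trans (∣++∣ S₁ S₂) (trans
    (cong₂ _+_ (eM S₁ T₁ (kernel-unionˡ {M = M} {H} {S₁} {S₂} kS) (kernel-unionˡ {M = M} {H} {T₁} {T₂} kT))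
               (eH S₂ T₂ (kernel-unionʳ {M = M} {H} {S₁} {S₂} kS) (kernel-unionʳ {M = M} {H} {T₁} {T₂} kT)))
                 (sym (∣++∣ T₁ T₂)))

  -- Two kernels of M are extended by the same kernel `U` of H, whose size cancels.
  union-equalKernelsˡ : ∀ {U} → Kernel (entry H) U → EqualKernelsOf (glueRows false M H) → EqualKernelsOf M
  union-equalKernelsˡ {U} kU e S T kS kT = ℕ.+-cancelʳ-≡ (∣ U ∣) (∣ S ∣) (∣ T ∣)
    (trans (sym (∣++∣ S U)) (trans (e (S Vec.++ U) (T Vec.++ U) (kernel-union {M = M} {H} kS kU)
      (kernel-union {M = M} {H} kT kU)) (∣++∣ T U)))

edgeless-full : ∀ {m S} → Kernel (entry (edgeless m)) S → ∀ v → lookup S v ≡ true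
edgeless-full {S = S} k v with lookup S v in e
... | true  = refl
... | false = let u , _ , a = Kernel.dominating k v e in contradiction (trans (sym a) (entry-edgeless u v)) λ ()

edgeless-kernel : ∀ m → Kernel (entry (edgeless m)) (Vec.replicate m true)
edgeless-kernel m = record
  { independent = λ u v _ _ → entry-edgeless u v
  ; dominating  = λ v e → contradiction (trans (sym (Vec.lookup-replicate v true)) e) λ () }

edgeless-equalKernels : ∀ m → EqualKernelsOf (edgeless m)
edgeless-equalKernels m S T kS kT = trans (∣full∣ S (edgeless-full kS)) (sym (∣full∣ T (edgeless-full kT)))

complete-kernel : ∀ m → Kernel (entry (completeGraph (suc m))) (true ∷ Vec.replicate m false)
complete-kernel m = record { independent = ind ; dominating = λ v e → zero , refl ,
  complete-adjacent (ne v e) }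
  where
  S = true ∷ Vec.replicate m false
  ind : ∀ u v → lookup S u ≡ true → lookup S v ≡ true → entry (completeGraph (suc m)) u v ≡ false
  ind zero    zero    _ _ = complete-irrefl {suc m} zero
  ind (suc u) _       h _ = contradiction (trans (sym (Vec.lookup-replicate u false)) h) λ ()
  ind zero    (suc v) _ h = contradiction (trans (sym (Vec.lookup-replicate v false)) h) λ ()
  ne : ∀ v → lookup S v ≡ false → zero ≢ v
  ne (suc v) e ()

complete-single : ∀ {m S} → Kernel (entry (completeGraph (suc m))) S → ∣ S ∣ ≡ 1
complete-single {m} {S} k with search (lookup S)
... | inj₂ none = let u , hu , _ = dominating zero (none zero) in contradiction (trans (sym hu) (none u)) λ ()
  where open Kernel k
... | inj₁ (u , hu) = ∣single∣ S u hu λ v ne → Bool.¬-not λ hv →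
  contradiction (trans (sym (complete-adjacent ne)) (Kernel.independent k v u hv hu)) λ ()

complete-equalKernels : ∀ m → EqualKernelsOf (completeGraph (suc m))
complete-equalKernels m S T kS kT = trans (complete-single kS) (sym (complete-single kT))

module _ {n} (M : Matrix n) (k : ℕ) where

  join-equalKernels : ∀ S₀ → Kernel (entry M) S₀ → ∣ S₀ ∣ ≡ k → EqualKernelsOf M →
    EqualKernelsOf (glueRows true M (edgeless k))
  join-equalKernels S₀ k₀ e₀ e S T kS kT = trans (size-k S kS) (sym (size-k T kT))
    where
    size-k : ∀ S → Kernel (entry (glueRows true M (edgeless k))) S → ∣ S ∣ ≡ k
    size-k S kS with Vec.splitAt n S
    ... | S₁ , S₂ , refl with search (lookup S₁)
    ... | inj₁ w = let k₁ , empty = kernel-joinˡ {M = M} {edgeless k} {S₁} {S₂} kS w in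
      trans (∣++∣ S₁ S₂) (trans (cong₂ _+_ (trans (e S₁ S₀ k₁ k₀) e₀) (∣empty∣ S₂ empty)) (ℕ.+-identityʳ k))
    ... | inj₂ empty₁ with search (lookup S₂)
    ... | inj₁ w = let _ , full = kernel-joinʳ {M = M} {edgeless k} {S₁} {S₂} kS entry-edgeless w in
      trans (∣++∣ S₁ S₂) (cong₂ _+_ (∣empty∣ S₁ empty₁) (∣full∣ S₂ full))
    -- The empty set dominates no vertex, so being a kernel it leaves no vertex on the right either,
    -- and k is zero.
    ... | inj₂ empty₂ = trans (∣empty∣ (S₁ Vec.++ S₂) empty) (sym (no-vertices k refl))
      where
      empty : ∀ v → lookup (S₁ Vec.++ S₂) v ≡ false
      empty v with sides {n} v
      ... | inˡ v = trans (Vec.lookup-++ˡ S₁ S₂ v) (empty₁ v)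
      ... | inʳ v = trans (Vec.lookup-++ʳ S₁ S₂ v) (empty₂ v)
      no-vertices : ∀ k′ → k′ ≡ k → k′ ≡ 0
      no-vertices zero     _    = refl
      no-vertices (suc k′) refl = let u , hu , _ = Kernel.dominating kS (n ↑ʳ zero) (empty _) in
        contradiction (trans (sym hu) (empty u)) λ ()

  -- Nonempty kernels of M are kernels of the join. If one kernel is empty, M has no vertices and
  -- the other is empty too. Nothing is assumed about k.
  join-equalKernelsˡ : EqualKernelsOf (glueRows true M (edgeless k)) → EqualKernelsOf M
  join-equalKernelsˡ e S T kS kT with search (lookup S) | search (lookup T)
  ... | inj₁ wS | inj₁ wT = ℕ.+-cancelʳ-≡ (∣ ∅ ∣) (∣ S ∣) (∣ T ∣) (trans (sym (∣++∣ S ∅)) (trans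
    (e (S Vec.++ ∅) (T Vec.++ ∅) (kernel-join {M = M} {edgeless k} kS wS ∅-empty)
      (kernel-join {M = M} {edgeless k} kT wT ∅-empty)) (∣++∣ T ∅)))
    where
    ∅ : Subset k
    ∅ = Vec.replicate k false
    ∅-empty : ∀ v → lookup ∅ v ≡ false
    ∅-empty v = Vec.lookup-replicate v false
  ... | inj₂ none | inj₂ none′ = trans (∣empty∣ S none) (sym (∣empty∣ T none′))
  ... | inj₂ none | inj₁ (t , _) = let u , hu , _ = Kernel.dominating kS t (none t) in contradiction (trans (sym hu) (none u)) λ ()
  ... | inj₁ (s , _) | inj₂ none = let u , hu , _ = Kernel.dominating kT s (none s) in contradiction (trans (sym hu) (none u)) λ ()

-- Partitions of unions and joins

-- The dichotomy behind both pigeonhole arguments: either all new vertices lie in parts of the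
-- scarce kind, or one of them occupies a part of the other kind.
allOrSome : ∀ {m} {C D : Set} (p : Fin m → C ⊎ D) →
  (Σ (Fin m → C) λ f → ∀ i → p i ≡ inj₁ (f i)) ⊎ (∃[ i ] ∃[ d ] p i ≡ inj₂ d)
allOrSome {zero}  p = inj₁ ((λ ()) , λ ())
allOrSome {suc m} p with p zero in e
... | inj₂ d = inj₂ (zero , d , e)
... | inj₁ c with allOrSome (p ∘ suc)
... | inj₁ (f , h)     = inj₁ ((λ { zero → c ; (suc i) → f i }) , λ { zero → e ; (suc i) → h i })
... | inj₂ (i , d , h) = inj₂ (suc i , d , h)

module _ {n h} (c : Bool) (M : Matrix n) (H : Matrix h) (aM : IsAdjacency M) (aG : IsAdjacency (glueRows c M H)) where

  restrict : ∀ {r ℓ r′ ℓ′} (π : Partition (graph (glueRows c M H) aG) r′ ℓ′)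
             (f : Fin r → Fin r′) (g : Fin ℓ → Fin ℓ′) (q : Fin n → Fin r ⊎ Fin ℓ) →
             (∀ u → Sum.map f g (q u) ≡ Partition.part π (u ↑ˡ h)) → Partition (graph M aM) r ℓ
  restrict π f g q e = record
    { part        = q
    ; independent = λ i {u} {v} hu hv a →
      independent (f i) {u ↑ˡ h} {v ↑ˡ h} (trans (sym (e u)) (cong (Sum.map f g) hu))
                      (trans (sym (e v)) (cong (Sum.map f g) hv)) (trans (entry-ˡˡ c M H u v) a)
    ; clique      = λ j {u} {v} hu hv u≢v → trans (sym (entry-ˡˡ c M H u v))
                      (clique (g j) {u ↑ˡ h} {v ↑ˡ h} (trans (sym (e u)) (cong (Sum.map f g) hu))
                        (trans (sym (e v)) (cong (Sum.map f g) hv))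
                        (u≢v ∘ Fin.↑ˡ-injective h u v)) }
    where open Partition π

  removeIndependent : ∀ {r ℓ} (π : Partition (graph (glueRows c M H) aG) (suc r) ℓ) i →
                      (∀ u → Partition.part π (u ↑ˡ h) ≢ inj₁ i) → Partition (graph M aM) r ℓ
  removeIndependent {r} {ℓ} π i avoid =
    restrict π (punchIn i) id (λ u → drop-part (part (u ↑ˡ h)) (avoid u))
    (λ u → drop-eq (part (u ↑ˡ h)) (avoid u))
    where
    open Partition π
    drop-part : (p : Fin (suc r) ⊎ Fin ℓ) → p ≢ inj₁ i → Fin r ⊎ Fin ℓ
    drop-part (inj₁ k) ne = inj₁ (punchOut {i = i} {k} (ne ∘ cong inj₁ ∘ sym))
    drop-part (inj₂ k) ne = inj₂ k
    drop-eq : ∀ p ne → Sum.map (punchIn i) id (drop-part p ne) ≡ p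
    drop-eq (inj₁ k) ne = cong inj₁ (Fin.punchIn-punchOut _)
    drop-eq (inj₂ k) ne = refl

  removeClique : ∀ {r ℓ} (π : Partition (graph (glueRows c M H) aG) r (suc ℓ)) j →
                 (∀ u → Partition.part π (u ↑ˡ h) ≢ inj₂ j) → Partition (graph M aM) r ℓ
  removeClique {r} {ℓ} π j avoid =
    restrict π id (punchIn j) (λ u → drop-part (part (u ↑ˡ h)) (avoid u))
    (λ u → drop-eq (part (u ↑ˡ h)) (avoid u))
    where
    open Partition π
    drop-part : (p : Fin r ⊎ Fin (suc ℓ)) → p ≢ inj₂ j → Fin r ⊎ Fin ℓ
    drop-part (inj₁ k) ne = inj₁ k
    drop-part (inj₂ k) ne = inj₂ (punchOut {i = j} {k} (ne ∘ cong inj₂ ∘ sym))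
    drop-eq : ∀ p ne → Sum.map id (punchIn j) (drop-part p ne) ≡ p
    drop-eq (inj₁ k) ne = refl
    drop-eq (inj₂ k) ne = cong inj₂ (Fin.punchIn-punchOut _)

  -- All vertices of H go into the part `p₀`. It may coincide with an independent part already in
  -- use only if there are no edges across, and never with a clique in use.
  extend : ∀ {r ℓ r′ ℓ′} (π : Partition (graph M aM) r ℓ) (f : Fin r → Fin r′) (g : Fin ℓ → Fin ℓ′)
    (p₀ : Fin r′ ⊎ Fin ℓ′) →
    (∀ {i k} → f i ≡ f k → i ≡ k) → (∀ {i k} → g i ≡ g k → i ≡ k) →
    (∀ {i} → p₀ ≡ inj₁ i → ∀ u v → entry H u v ≡ false) →
      (∀ {j} → p₀ ≡ inj₂ j → ∀ u v → u ≢ v → entry H u v ≡ true) →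
    (∀ i → p₀ ≡ inj₁ (f i) → c ≡ false) → (∀ j → p₀ ≢ inj₂ (g j)) →
      Partition (graph (glueRows c M H) aG) r′ ℓ′
  extend {r} {ℓ} {r′} {ℓ′} π f g p₀ f-inj g-inj H-ind H-cl cross-ind cross-cl = record
    { part        = λ w → side (sides w)
    ; independent = λ i {u} {v} → ind i {u} {v} (sides u) (sides v)
    ; clique      = λ j {u} {v} → cl j {u} {v} (sides u) (sides v) }
    where
    open Partition π
    side : ∀ {w} → Sides {n} {h} w → Fin r′ ⊎ Fin ℓ′
    side (inˡ u) = Sum.map f g (part u)
    side (inʳ u) = p₀
    from₁ : ∀ {p i} → Sum.map f g p ≡ inj₁ i → ∃[ k ] p ≡ inj₁ k × f k ≡ i
    from₁ {inj₁ k} refl = k , refl , refl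
    from₂ : ∀ {p j} → Sum.map f g p ≡ inj₂ j → ∃[ k ] p ≡ inj₂ k × g k ≡ j
    from₂ {inj₂ k} refl = k , refl , refl
    ind : ∀ i {u v} (s : Sides {n} {h} u) (t : Sides {n} {h} v) → side s ≡ inj₁ i → side t ≡ inj₁ i →
      entry (glueRows c M H) u v ≢ true
    ind i (inˡ u) (inˡ v) hu hv a with from₁ {part u} hu | from₁ {part v} hv
    ... | k , e , refl | k′ , e′ , fk with f-inj fk
    ... | refl = independent k {u} {v} e e′ (trans (sym (entry-ˡˡ c M H u v)) a)
    ind i (inˡ u) (inʳ v) hu hv a with from₁ {part u} hu
    ... | k , _ , refl = contradiction (trans (sym (cross-ind k hv)) (trans (sym (entry-ˡʳ c M H u v)) a)) λ ()
    ind i (inʳ u) (inˡ v) hu hv a with from₁ {part v} hv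
    ... | k , _ , refl = contradiction (trans (sym (cross-ind k hu)) (trans (sym (entry-ʳˡ c M H u v)) a)) λ ()
    ind i (inʳ u) (inʳ v) hu hv a =
      contradiction (trans (sym (H-ind hu u v)) (trans (sym (entry-ʳʳ c M H u v)) a)) λ ()
    cl : ∀ j {u v} (s : Sides {n} {h} u) (t : Sides {n} {h} v) → side s ≡ inj₂ j → side t ≡ inj₂ j → u ≢ v →
      entry (glueRows c M H) u v ≡ true
    cl j (inˡ u) (inˡ v) hu hv u≢v with from₂ {part u} hu | from₂ {part v} hv
    ... | k , e , refl | k′ , e′ , gk with g-inj gk
    ... | refl = trans (entry-ˡˡ c M H u v) (clique k {u} {v} e e′ (u≢v ∘ cong (_↑ˡ h)))
    cl j (inˡ u) (inʳ v) hu hv u≢v with from₂ {part u} hu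
    ... | k , _ , refl = ⊥-elim (cross-cl k hv)
    cl j (inʳ u) (inˡ v) hu hv u≢v with from₂ {part v} hv
    ... | k , _ , refl = ⊥-elim (cross-cl k hu)
    cl j (inʳ u) (inʳ v) hu hv u≢v = trans (entry-ʳʳ c M H u v) (H-cl hu u v (u≢v ∘ cong (n ↑ʳ_)))

module _ {n} (M : Matrix n) (a : IsAdjacency M) where

  partition-union-complete : ∀ {r ℓ} (a′ : IsAdjacency (glueRows false M (completeGraph (suc r)))) →
    Partition (graph M a) r ℓ ⇔ Partition (graph (glueRows false M (completeGraph (suc r))) a′) r (suc ℓ)
  partition-union-complete {r} {ℓ} a′ = mk⇔
    (λ π → extend false M (completeGraph (suc r)) a a′ π id suc (inj₂ zero) (λ e → e) Fin.suc-injective (λ ())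
      (λ _ u v → complete-adjacent) (λ _ ()) (λ _ ()))
    from
    where
    K = completeGraph (suc r)
    from : Partition (graph (glueRows false M K) a′) r (suc ℓ) → Partition (graph M a) r ℓ
    from π with allOrSome (part ∘ (n ↑ʳ_))
      where open Partition π
    -- With all r + 1 vertices in r independent parts, two of them would share a part although they
    -- are adjacent.
    ... | inj₁ (f , e) = let i , k , i<k , fi≡fk = Fin.pigeonhole (ℕ.n<1+n r) f in
      ⊥-elim (Partition.independent π (f i) {n ↑ʳ i} {n ↑ʳ k} (e i) (trans (e k) (cong inj₁ (sym fi≡fk)))
        (trans (entry-ʳʳ false M K i k) (complete-adjacent (Fin.<⇒≢ i<k))))
    ... | inj₂ (i , j , e) = removeClique false M K a a′ π j λ u h → contradiction
      (trans (sym (entry-ˡʳ false M K u i)) (Partition.clique π j {u ↑ˡ suc r} {n ↑ʳ i} h e (↑ˡ≢↑ʳ u i))) λ ()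
      where
      ↑ˡ≢↑ʳ : ∀ {m n} (u : Fin m) (v : Fin n) → u ↑ˡ n ≢ m ↑ʳ v
      ↑ˡ≢↑ʳ (suc u) v e = ↑ˡ≢↑ʳ u v (Fin.suc-injective e)

  -- The isolated vertices are put into the independent part `zero`, which exists because the number
  -- of such parts is a successor.
  partition-union-edgeless : ∀ {r ℓ q} (a′ : IsAdjacency (glueRows false M (edgeless q))) →
    Partition (graph M a) (suc r) ℓ ⇔ Partition (graph (glueRows false M (edgeless q)) a′) (suc r) ℓ
  partition-union-edgeless {q = q} a′ = mk⇔
    (λ π → extend false M (edgeless q) a a′ π id id (inj₁ zero) (λ e → e) (λ e → e) (λ _ → entry-edgeless)
      (λ ()) (λ _ _ → refl) (λ _ ()))
    (λ π → restrict false M (edgeless q) a a′ π id id (λ u → Partition.part π (u ↑ˡ q))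
      (λ u → id-map (Partition.part π (u ↑ˡ q))))
    where
    id-map : ∀ {C D : Set} (p : C ⊎ D) → Sum.map id id p ≡ p
    id-map (inj₁ _) = refl
    id-map (inj₂ _) = refl

  partition-join-edgeless : ∀ {r ℓ k} (a′ : IsAdjacency (glueRows true M (edgeless k))) → ℓ < k →
    Partition (graph M a) r ℓ ⇔ Partition (graph (glueRows true M (edgeless k)) a′) (suc r) ℓ
  partition-join-edgeless {r} {ℓ} {k} a′ ℓ<k = mk⇔
    (λ π → extend true M (edgeless k) a a′ π suc id (inj₁ zero) Fin.suc-injective (λ e → e)
      (λ _ → entry-edgeless) (λ ()) (λ _ ()) (λ _ ()))
    from
    where
    E′ = edgeless k
    from : Partition (graph (glueRows true M E′) a′) (suc r) ℓ → Partition (graph M a) r ℓ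
    from π with allOrSome (Sum.swap ∘ part ∘ (n ↑ʳ_))
      where open Partition π
    -- With all k new vertices in ℓ < k cliques, two of them would share a clique although they are
    -- not adjacent.
    ... | inj₁ (f , e) = let i , j , i<j , fi≡fj = Fin.pigeonhole ℓ<k f in contradiction
      (trans (sym (entry-edgeless i j)) (trans (sym (entry-ʳʳ true M E′ i j))
        (Partition.clique π (f i) {n ↑ʳ i} {n ↑ʳ j} (unswap (e i))
          (trans (unswap (e j)) (cong inj₂ (sym fi≡fj)))
          (Fin.<⇒≢ i<j ∘ Fin.↑ʳ-injective n i j)))) λ ()
      where
      unswap : ∀ {C D : Set} {p : C ⊎ D} {d} → Sum.swap p ≡ inj₁ d → p ≡ inj₂ d
      unswap {p = inj₂ _} refl = refl
    ... | inj₂ (v , i , e) = removeIndependent true M E′ a a′ π i λ u h →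
      Partition.independent π i {u ↑ˡ k} {n ↑ʳ v} h (unswap e) (entry-ˡʳ true M E′ u v)
      where
      unswap : ∀ {C D : Set} {p : C ⊎ D} {d} → Sum.swap p ≡ inj₂ d → p ≡ inj₁ d
      unswap {p = inj₁ _} refl = refl

-- Transformations of matrices as reductions

encodeMatrix : ∀ {n} → Matrix n → List Bool
encodeMatrix {n} M = unary n ++ encodeRows M

MatrixWC : ℕ → ℕ → List Bool → Set
MatrixWC r ℓ x = ∃[ n ] Σ (Matrix n) λ M → Σ (IsAdjacency M) λ a →
                 encodeMatrix M ≡ x × Partition (graph M a) r ℓ × EqualKernelsOf M

matrixWC⇔ : ∀ r ℓ x → rℓwc-g r ℓ x ⇔ MatrixWC r ℓ x
matrixWC⇔ r ℓ x = mk⇔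
  (λ (G , e , π , wc) → Graph.order G , adjacencyMatrix G , isAdjacency-adjacencyMatrix G ,
    trans (sym (encodeGraph-matrix G)) e ,
    partition-cong (λ u v → sym (entry-adjacencyMatrix G u v)) π ,
    Equivalence.to (wellCovered⇔ (graph (adjacencyMatrix G) (isAdjacency-adjacencyMatrix G)))
      (wellCovered-cong {a = Graph.adj G} (λ u v → sym (entry-adjacencyMatrix G u v)) {Graph.adj-sym G}
      {Graph.adj-irrefl G} {proj₁ (isAdjacency-adjacencyMatrix G)} {proj₂ (isAdjacency-adjacencyMatrix G)}
      wc))
  (λ (n , M , a , e , π , ek) → graph M a , trans (encodeGraph-graph M a) e , π ,
    Equivalence.from (wellCovered⇔ (graph M a)) ek)

encodeMatrix-injective : ∀ {m n} (M : Matrix m) (M′ : Matrix n) → encodeMatrix M ≡ encodeMatrix M′ →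
                         Σ (m ≡ n) λ e → ∀ u v → entry (subst Matrix e M) u v ≡ entry M′ u v
encodeMatrix-injective {m} {n} M M′ e with unary-injective m n e
... | refl , e₁ = refl , proj₁ (encodeRows-injective M M′ (cong (_++ []) e₁))

module _ {r ℓ r′ ℓ′ : ℕ} (order′ : ∀ {n} → Matrix n → ℕ) (Φ : ∀ {n} (M : Matrix n) → Matrix (order′ M))
         (Φ-adjacency : ∀ {n} (M : Matrix n) → IsAdjacency M ⇔ IsAdjacency (Φ M))
         (Φ-partition : ∀ {n} (M : Matrix n) a a′ →
           Partition (graph M a) r ℓ ⇔ Partition (graph (Φ M) a′) r′ ℓ′)
         (Φ-kernels : ∀ {n} (M : Matrix n) → IsAdjacency M → EqualKernelsOf M ⇔ EqualKernelsOf (Φ M))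
         (f : List Bool → List Bool)
         (f-good : ∀ {n} (M : Matrix n) → f (encodeMatrix M) ≡ encodeMatrix (Φ M))
         (f-bad : ∀ x → ¬ Shape noTail x → f x ≡ []) where

  -- In the backward direction `x` is only known to encode some matrix M. That M is an adjacency
  -- matrix has to be recovered from its image; only then do the equivalences for partitions and
  -- kernels apply.
  transform-wc : ∀ x → rℓwc-g r ℓ x ⇔ rℓwc-g r′ ℓ′ (f x)
  transform-wc x = ⇔-sym (matrixWC⇔ r′ ℓ′ (f x)) ⇔-∘ (mk⇔ to from ⇔-∘ matrixWC⇔ r ℓ x)
    where
    to : MatrixWC r ℓ x → MatrixWC r′ ℓ′ (f x)
    to (n , M , a , refl , π , ek) = let a′ = Equivalence.to (Φ-adjacency M) a in
      order′ M , Φ M , a′ , sym (f-good M) , Equivalence.to (Φ-partition M a a′) π ,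
        Equivalence.to (Φ-kernels M a) ek

    transport : ∀ {n} (M M′ : Matrix n) → (∀ u v → entry M′ u v ≡ entry M u v) → ∀ a′ →
      Partition (graph M′ a′) r′ ℓ′ →
                EqualKernelsOf M′ → Σ (IsAdjacency M) λ a → Partition (graph M a) r′ ℓ′ × EqualKernelsOf M
    transport M M′ e (s , i) π ek =
      ((λ u v → trans (sym (e u v)) (trans (s u v) (e v u))) , (λ v → trans (sym (e v v)) (i v))) ,
      partition-cong e π , λ S T kS kT →
        ek S T (kernel-cong (λ u v → sym (e u v)) kS) (kernel-cong (λ u v → sym (e u v)) kT)

    from : MatrixWC r′ ℓ′ (f x) → MatrixWC r ℓ x
    from (n′ , M′ , a′ , e , π , ek) with shape? noTail x
    ... | no ¬s = ⊥-elim (no-nil n′ (trans e (f-bad x ¬s)))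
      where
      no-nil : ∀ n {y} → unary n ++ y ≢ []
      no-nil zero    ()
      no-nil (suc n) ()
    ... | yes (n , M , _ , e₁) with encodeMatrix-injective M′ (Φ M) (trans e (trans (cong f (trans e₁ (cong (unary n ++_) (List.++-identityʳ _)))) (f-good M)))
    ... | refl , e₂ = let a″ , π″ , ek″ = transport (Φ M) M′ e₂ a′ π ek
                          a = Equivalence.from (Φ-adjacency M) a″ in
      n , M , a , sym (trans e₁ (cong (unary n ++_) (List.++-identityʳ _))) ,
      Equivalence.from (Φ-partition M a a″) π″ , Equivalence.from (Φ-kernels M a) ek″

-- A program for the union with a fixed graph

encodeAll-++ : ∀ {C : Set} {enc : C → List Bool} {m n} (cs : Vec C m) (ds : Vec C n) →
               encodeAll enc (cs Vec.++ ds) ≡ encodeAll enc cs ++ encodeAll enc ds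
encodeAll-++ []                   ds = refl
encodeAll-++ {enc = enc} (c ∷ cs) ds =
  trans (cong (enc c ++_) (encodeAll-++ cs ds)) (sym (List.++-assoc (enc c) _ _))

encodeAll-map : ∀ {C D : Set} {enc : D → List Bool} {f : C → D} {enc′} → (∀ c → enc (f c) ≡ enc′ c) →
                ∀ {n} (cs : Vec C n) → encodeAll enc (Vec.map f cs) ≡ encodeAll enc′ cs
encodeAll-map h []       = refl
encodeAll-map h (c ∷ cs) = cong₂ _++_ (h c) (encodeAll-map h cs)

encodeAll-replicate : ∀ n (b : Bool) → encodeAll [_] (Vec.replicate n b) ≡ replicate n b
encodeAll-replicate zero    b = refl
encodeAll-replicate (suc n) b = cong (b ∷_) (encodeAll-replicate n b)

unary-+ : ∀ n h → unary (n + h) ≡ ones n ++ unary h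
unary-+ zero    h = refl
unary-+ (suc n) h = cong (true ∷_) (unary-+ n h)

-- Cuts the encoding into the blocks that the programs write one after the other: the order in two
-- portions, the prolonged rows of M, and the rows of H behind their padding.
encodeMatrix-glue : ∀ {n h} c (M : Matrix n) (H : Matrix h) → encodeMatrix (glueRows c M H) ≡
  ones n ++ unary h ++ encodeAll (λ row → encodeAll [_] row ++ replicate h c) M
                    ++ encodeAll (λ row → replicate n c ++ encodeAll [_] row) H
encodeMatrix-glue {n} {h} c M H = trans
  (cong₂ _++_ (unary-+ n h) (trans (encodeAll-++ (Vec.map (Vec._++ Vec.replicate h c) M) _) (cong₂ _++_
    (encodeAll-map (λ row → trans (encodeAll-++ row _)
      (cong (encodeAll [_] row ++_) (encodeAll-replicate h c))) M)
    (encodeAll-map (λ row → trans (encodeAll-++ (Vec.replicate n c) row)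
      (cong (_++ encodeAll [_] row) (encodeAll-replicate n c))) H))))
  (List.++-assoc (ones n) (unary h) _)

copyBit : ∀ {m d} → Prog (9 + m) d
copyBit = case Y skip λ b → pop Y ⨾ emit b

copyRows : ∀ {m d} → Prog (9 + m) (suc (suc d)) → Prog (9 + m) (suc (suc (suc d)))
copyRows tail = each A A′ (each B B′ copyBit ⨾ tail)

transfer : List Bool × List Bool → List Bool × List Bool
transfer ([]    , o) = [] , o
transfer (b ∷ y , o) = y , o ++ [ b ]

transfer-row : ∀ {n} (row : Vec Bool n) y o → iter n transfer (encodeAll [_] row ++ y , o) ≡
  (y , o ++ encodeAll [_] row)
transfer-row []        y o = cong (y ,_) (sym (List.++-identityʳ o))
transfer-row (b ∷ row) y o = trans (transfer-row row y (o ++ [ b ])) (cong (y ,_) (List.++-assoc o [ b ] _))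

transferRow : ℕ → List Bool → List Bool × List Bool → List Bool × List Bool
transferRow n t = Product.map₂ (_++ t) ∘ iter n transfer

transfer-rows : ∀ {m n} t (M : Vec (Vec Bool n) m) y o →
  iter m (transferRow n t) (encodeRows M ++ y , o) ≡ (y , o ++ encodeAll (λ row → encodeAll [_] row ++ t) M)
transfer-rows t [] y o = cong (y ,_) (sym (List.++-identityʳ o))
transfer-rows {suc m} {n} t (row ∷ M) y o = begin
  iter m (transferRow n t) (transferRow n t ((encodeAll [_] row ++ encodeRows M) ++ y , o))
    ≡⟨ cong (λ z → iter m (transferRow n t) (transferRow n t (z , o)))
      (List.++-assoc (encodeAll [_] row) (encodeRows M) y) ⟩
  iter m (transferRow n t) (transferRow n t (encodeAll [_] row ++ encodeRows M ++ y , o))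
    ≡⟨ cong (iter m (transferRow n t) ∘ Product.map₂ (_++ t)) (transfer-row row (encodeRows M ++ y) o) ⟩
  iter m (transferRow n t) (encodeRows M ++ y , (o ++ encodeAll [_] row) ++ t)
    ≡⟨ transfer-rows t M y _ ⟩
  (y , ((o ++ encodeAll [_] row) ++ t) ++ rest)
    ≡⟨ cong (y ,_) (trans (cong (_++ rest) (List.++-assoc o (encodeAll [_] row) t))
      (List.++-assoc o (encodeAll [_] row ++ t) rest)) ⟩
  (y , o ++ (encodeAll [_] row ++ t) ++ rest) ∎
  where
  open ≡-Reasoning
  rest = encodeAll (λ row → encodeAll [_] row ++ t) M

module _ {N m n : ℕ} {x z f e : List Bool} {ρ : Vec (List Bool) m} (n≤N : n ≤ N) where

  private
    st : List Bool → List Bool → List Bool → List Bool → List Bool × List Bool → Store (9 + m)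
    st a a′ b b′ (y , o) = regs x y z a a′ b b′ f e ρ , o

    ones≤N : length (ones n) ≤ N
    ones≤N = length-ones n≤N

  exec-copyRows : ∀ {d} tail t (M : Matrix n) {o} →
    (∀ a a′ y o → exec N tail (st a a′ (ones n) [] (y , o)) ≡ st a a′ (ones n) [] (y , o ++ t)) →
    exec N (copyRows {d = d} tail) (st (ones n) [] (ones n) [] (encodeRows M , o))
    ≡ st (ones n) [] (ones n) [] ([] , o ++ encodeAll (λ row → encodeAll [_] row ++ t) M)
  exec-copyRows {d} tail t M {o} h = begin
    exec N (copyRows {d = d} tail) (st (ones n) [] (ones n) [] (encodeRows M , o))
      ≡⟨ exec-each A A′ (each B B′ copyBit ⨾ tail) (λ a a′ → st a a′ (ones n) []) (transferRow n t)
        (λ _ _ _ → refl)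
           (λ a (y , o) → exec-move {d = suc (suc d)} A′ A (λ ()) _ o) row (ones n) (encodeRows M , o)
             ones≤N ⟩
    st (ones n) [] (ones n) [] (iter (length (ones n)) (transferRow n t) (encodeRows M , o))
      ≡⟨ cong₂ (λ k y → st (ones n) [] (ones n) [] (iter k (transferRow n t) (y , o)))
        (List.length-replicate n) (sym (List.++-identityʳ (encodeRows M))) ⟩
    st (ones n) [] (ones n) [] (iter n (transferRow n t) (encodeRows M ++ [] , o))
      ≡⟨ cong (st (ones n) [] (ones n) []) (transfer-rows t M [] o) ⟩
    st (ones n) [] (ones n) [] ([] , o ++ encodeAll (λ row → encodeAll [_] row ++ t) M) ∎
    where
    open ≡-Reasoning
    bit : ∀ {a a′} b b′ i → exec N (copyBit {d = suc d}) (st a a′ b b′ i) ≡ st a a′ b b′ (transfer i)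
    bit b b′ ([]    , o) = refl
    bit b b′ (_ ∷ y , o) = refl
    row : ∀ c a a′ i → exec N (pop A ⨾ push A′ c ⨾ each B B′ copyBit ⨾ tail) (st (c ∷ a) a′ (ones n) [] i)
                       ≡ st a (c ∷ a′) (ones n) [] (transferRow n t i)
    row c a a′ i = trans
      (cong (exec N tail) (trans
        (exec-each B B′ (copyBit {d = suc d}) (λ b b′ → st a (c ∷ a′) b b′) transfer (λ _ _ _ → refl)
          (λ b (y , o) → exec-move {d = suc d} B′ B (λ ()) _ o) (λ c b b′ i → bit b (c ∷ b′) i) (ones n) i
            ones≤N)
        (cong (λ k → st a (c ∷ a′) (ones n) [] (iter k transfer i)) (List.length-replicate n))))
      (h a (c ∷ a′) _ _)

-- The rows of the fixed graph are constants of the program; only the padding in front of them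
-- depends on the input.
bottomRows : ∀ {m d h k} → Vec (Vec Bool h) k → Prog (9 + m) (suc (suc d))
bottomRows []         = skip
bottomRows (row ∷ H) = emitB false ⨾ emits (encodeAll [_] row) ⨾ bottomRows H

exec-bottomRows : ∀ {N m n h k x y z a a′ f e o} {ρ : Vec (List Bool) m} (H : Vec (Vec Bool h) k) → n ≤ N →
  Exec N (bottomRows {d = 1} H) (regs x y z a a′ (ones n) [] f e ρ , o)
    (regs x y z a a′ (ones n) [] f e ρ , o ++ encodeAll (λ row → replicate n false ++ encodeAll [_] row) H)
exec-bottomRows {o = o} [] n≤N = exec≡ (cong (_ ,_) (sym (List.++-identityʳ o)))
exec-bottomRows {N} {n = n} {x = x} {o = o} (row ∷ H) n≤N =
  subst (λ o′ → Exec N _ _ (_ , o′))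
    (trans (List.++-assoc (o ++ replicate n false) _ _) (trans (List.++-assoc o _ _)
      (cong (o ++_) (sym (List.++-assoc (replicate n false) (encodeAll [_] row) _)))))
    (exec≡ (exec-emitB {d = 1} false {x = x} n≤N) ▷ exec≡ (exec-emits {d = 3} (encodeAll [_] row)) ▷
      exec-bottomRows H n≤N)

addDisjoint : ∀ {h} → Matrix h → Prog 9 3
addDisjoint {h} H = check noTail ⨾ case E
  (emitB true ⨾ emits (unary h) ⨾ copyRows (emits (replicate h false)) ⨾ bottomRows H) λ _ → skip

run-addDisjoint-good : ∀ {n h} (H : Matrix h) (M : Matrix n) → run (addDisjoint H) (encodeMatrix M) ≡
  encodeMatrix (glueRows false M H)
run-addDisjoint-good {n} {h} H M = trans
  (cong (run (addDisjoint H)) (cong (unary n ++_) (sym (List.++-identityʳ (encodeRows M)))))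
  (trans (run-exec (addDisjoint H) x (exec≡ checks ▷ accept
    (exec≡ (exec-emitB {d = 1} true {x = []} n≤N) ▷ exec≡ (exec-emits {d = 3} (unary h)) ▷ rows-exec ▷
      exec-bottomRows {x = []} H n≤N)))
    (trans (List.++-assoc (ones n ++ unary h) rows bottom)
      (trans (List.++-assoc (ones n) (unary h) (rows ++ bottom)) (sym (encodeMatrix-glue false M H)))))
  where
  x = unary n ++ encodeRows M ++ []
  N = length x
  n≤N = order≤length n (encodeRows M ++ [])
  checks = exec-check-good noTail {N} {o = []} {[]} n M tt ℕ.≤-refl
  rows   = encodeAll (λ row → encodeAll [_] row ++ replicate h false) M
  bottom = encodeAll (λ row → replicate n false ++ encodeAll [_] row) H
  rows-exec : Exec N (copyRows (emits (replicate h false)))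
    (checked noTail [] [] (encodeRows M ++ []) n false , ones n ++ unary h)
                (checked noTail [] [] [] n false , (ones n ++ unary h) ++ rows)
  rows-exec = subst (λ y → Exec N _ (checked noTail [] [] y n false , _)
    (checked noTail [] [] [] n false , (ones n ++ unary h) ++ rows)) (sym (List.++-identityʳ (encodeRows M)))
    (exec≡ (exec-copyRows n≤N {d = 0} (emits (replicate h false)) (replicate h false) M
      (λ _ _ _ _ → exec-emits {d = 2} (replicate h false))))
  accept : ∀ {p : Prog 9 3} {q t} → Exec N p (checked noTail [] [] (encodeRows M ++ []) n false , []) t →
           Exec N (case E p q) (checked noTail [] [] (encodeRows M ++ []) n false , []) t
  accept (exec≡ e) = exec≡ e

run-addDisjoint-bad : ∀ {h} (H : Matrix h) x → ¬ Shape noTail x → run (addDisjoint H) x ≡ []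
run-addDisjoint-bad {h} H x ¬s =
  let x′ , y , n , e = exec-check-bad noTail {length x} {o = []} {[]} x ℕ.≤-refl ¬s in
  run-exec (addDisjoint H) x (exec≡ e ▷
    exec≡ {p = case E (emitB true ⨾ emits (unary h) ⨾ copyRows (emits (replicate h false)) ⨾ bottomRows H)
    λ _ → skip} refl)

-- Greedy independent sets

hit : ∀ {n} → List Bool → Vec Bool n → Bool
hit []      _         = false
hit (s ∷ _) []        = false
hit (s ∷ t) (b ∷ row) = (s ∧ b) ∨ hit t row

-- The first argument lists the decisions on the earlier vertices, in the order of the columns, so
-- that `hit` can compare it with the beginning of a row.
greedy : ∀ {m n} → List Bool → Vec (Vec Bool n) m → Vec Bool m
greedy s []        = []
greedy s (row ∷ M) = let b = not (hit s row) in b ∷ greedy (s ++ [ b ]) M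

greedySize : ∀ {n} → Matrix n → ℕ
greedySize M = ∣ greedy [] M ∣

lookup-greedy : ∀ {m n} s (M : Vec (Vec Bool n) m) v →
  lookup (greedy s M) v ≡ not (hit (s ++ List.take (toℕ v) (toList (greedy s M))) (lookup M v))
lookup-greedy s (row ∷ M) zero    = cong (λ t → not (hit t row)) (sym (List.++-identityʳ s))
lookup-greedy s (row ∷ M) (suc v) = let b = not (hit s row) in trans (lookup-greedy (s ++ [ b ]) M v)
  (cong (λ t → not (hit t (lookup M v))) (List.++-assoc s [ b ] _))

hit-sound : ∀ {n} t (S row : Vec Bool n) → hit (List.take t (toList S)) row ≡ true →
            ∃[ u ] lookup S u ≡ true × lookup row u ≡ true
hit-sound (suc t) (s ∷ S) (b ∷ row) h with s ∧ b in e
... | true  = zero , Bool.∧-conicalˡ s b e , Bool.∧-conicalʳ s b e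
... | false = let u , h₁ , h₂ = hit-sound t S row h in suc u , h₁ , h₂

hit-complete : ∀ {n} t (S row : Vec Bool n) u → toℕ u < t → lookup S u ≡ true → lookup row u ≡ true →
               hit (List.take t (toList S)) row ≡ true
hit-complete (suc t) (s ∷ S) (b ∷ row) zero    l       refl refl = refl
hit-complete (suc t) (s ∷ S) (b ∷ row) (suc u) (s≤s l) h₁ h₂ with s ∧ b
... | true  = refl
... | false = hit-complete t S row u l h₁ h₂

-- A vertex was rejected because of a selected neighbour, which dominates it; of two adjacent
-- selected vertices the later one would have been rejected. Symmetry is used because only the row
-- of the later vertex is inspected.
greedy-kernel : ∀ {n} (M : Matrix n) → IsAdjacency M → Kernel (entry M) (greedy [] M)
greedy-kernel M (symm , irrefl) = record { independent = ind ; dominating = dom }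
  where
  S = greedy [] M
  earlier : ∀ u v → toℕ u < toℕ v → lookup S u ≡ true → lookup S v ≡ true → entry M v u ≡ false
  earlier u v u<v hu hv = Bool.¬-not λ e → contradiction
    (trans (sym hv) (trans (lookup-greedy [] M v)
      (cong not (hit-complete (toℕ v) S (lookup M v) u u<v hu e)))) λ ()
  ind : ∀ u v → lookup S u ≡ true → lookup S v ≡ true → entry M u v ≡ false
  ind u v hu hv with ℕ.<-cmp (toℕ u) (toℕ v)
  ... | tri< u<v _ _ = trans (symm u v) (earlier u v u<v hu hv)
  ... | tri≈ _ u≡v _ = trans (cong (entry M u) (sym (Fin.toℕ-injective u≡v))) (irrefl u)
  ... | tri> _ _ v<u = earlier v u v<u hv hu
  dom : ∀ v → lookup S v ≡ false → ∃[ u ] lookup S u ≡ true × entry M u v ≡ true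
  dom v hv = let u , h₁ , h₂ = hit-sound (toℕ v) S (lookup M v) (Bool.not-injective (trans (sym (lookup-greedy [] M v)) hv)) in
    u , h₁ , trans (symm u v) h₂

-- Additional registers: Sel, Sel′ hold the vertices selected so far, and Cnt, Dup their number.
pattern Sel  = suc (suc (suc (suc (suc (suc (suc (suc (suc zero))))))))
pattern Sel′ = suc (suc (suc (suc (suc (suc (suc (suc (suc (suc zero)))))))))
pattern Hit  = suc (suc (suc (suc (suc (suc (suc (suc (suc (suc (suc zero))))))))))
pattern Cnt  = suc (suc (suc (suc (suc (suc (suc (suc (suc (suc (suc (suc zero)))))))))))
pattern Cnt′ = suc (suc (suc (suc (suc (suc (suc (suc (suc (suc (suc (suc (suc zero))))))))))))
pattern Dup  = suc (suc (suc (suc (suc (suc (suc (suc (suc (suc (suc (suc (suc (suc zero)))))))))))))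
pattern Dup′ = suc (suc (suc (suc (suc (suc (suc (suc (suc (suc (suc (suc (suc (suc (suc zero))))))))))))))

scanBit : ∀ {d} → Prog 16 d
scanBit = case X skip λ b → pop X ⨾ case Sel′ skip λ s → pop Sel′ ⨾ push Sel s ⨾ setIf (s ∧ b) Hit

selectVertex : ∀ {d} → Prog 16 d
selectVertex = case Hit (push Sel true ⨾ push Cnt true ⨾ push Dup true) λ _ → pop Hit ⨾ push Sel false

-- `Sel` has the latest decision on top. Pouring it into `Sel′` brings the decisions into the order
-- of the row, and the scan pours them back.
greedyStep : ∀ {d} → Prog 16 (suc (suc d))
greedyStep = move∗ Sel Sel′ ⨾ each B B′ scanBit ⨾ selectVertex

greedyPass : Prog 16 3
greedyPass = each A A′ greedyStep

Scan : Set
Scan = List Bool × List Bool × List Bool × Bool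

scan : Scan → Scan
scan ([]    , s , s′     , h) = [] , s , s′ , h
scan (b ∷ x , s , []     , h) = x , s , [] , h
scan (b ∷ x , s , t ∷ s′ , h) = x , t ∷ s , s′ , h ∨ (t ∧ b)

-- There are decisions only on the earlier vertices; the bits of the row beyond them are read and
-- dropped.
scan-row : ∀ {n} (row : Vec Bool n) x s s′ h → length s′ ≤ n →
           iter n scan (encodeAll [_] row ++ x , s , s′ , h) ≡ (x , s′ ʳ++ s , [] , h ∨ hit s′ row)
scan-row []        x s []       h l       = cong (λ h → x , s , [] , h) (sym (Bool.∨-identityʳ h))
scan-row (b ∷ row) x s []       h l       = scan-row row x s [] h z≤n
scan-row (b ∷ row) x s (t ∷ s′) h (s≤s l) = trans (scan-row row x (t ∷ s) s′ (h ∨ (t ∧ b)) l)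
  (cong (λ h → x , s′ ʳ++ (t ∷ s) , [] , h) (Bool.∨-assoc h (t ∧ b) (hit s′ row)))

-- The decisions so far, the rows not yet read, and the number of selected vertices.
Selection : ℕ → Set
Selection n = List Bool × List (Vec Bool n) × ℕ

select : ∀ {n} → Selection n → Selection n
select (s , []         , j) = s , [] , j
select (s , row ∷ rows , j) = s ++ [ not (hit s row) ] , rows , (if hit s row then j else suc j)

select-greedy : ∀ {m n} s (M : Vec (Vec Bool n) m) j →
                iter m select (s , toList M , j) ≡ (s ++ toList (greedy s M) , [] , ∣ greedy s M ∣ + j)
select-greedy s [] j = cong (λ t → t , [] , j) (sym (List.++-identityʳ s))
select-greedy s (row ∷ M) j with hit s row
... | true  = trans (select-greedy (s ++ [ false ]) M j) (cong (λ t → t , [] , ∣ greedy (s ++ [ false ]) M ∣ + j) (List.++-assoc s [ false ] _))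
... | false = trans (select-greedy (s ++ [ true ]) M (suc j)) (cong₂ (λ t j → t , [] , j) (List.++-assoc s [ true ] _) (ℕ.+-suc _ j))

joinRegs : (x y a a′ b b′ s s′ h : List Bool) → ℕ → Vec (List Bool) 16
joinRegs x y a a′ b b′ s s′ h j = regs x y [] a a′ b b′ [] [] (s ∷ s′ ∷ h ∷ ones j ∷ [] ∷ ones j ∷ [] ∷ [])

module _ {N n : ℕ} {y o : List Bool} (n≤N : n ≤ N) where

  private
    ones≤N : length (ones n) ≤ N
    ones≤N = length-ones n≤N

    scanning : ∀ {a a′ j} → List Bool → List Bool → Scan → Store 16
    scanning {a} {a′} {j} b b′ (x , s , s′ , h) = joinRegs x y a a′ b b′ s s′ (flag h) j , o

    exec-scanBit : ∀ {a a′ j d} b b′ i → exec N (scanBit {d}) (scanning {a} {a′} {j} b b′ i) ≡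
      scanning {a} {a′} {j} b b′ (scan i)
    exec-scanBit b b′ ([]        , s , s′         , h)     = refl
    exec-scanBit b b′ (c ∷ x     , s , []         , h)     = refl
    exec-scanBit b b′ (c ∷ x     , s , false ∷ s′ , false) = refl
    exec-scanBit b b′ (c ∷ x     , s , false ∷ s′ , true)  = refl
    exec-scanBit b b′ (true ∷ x  , s , true ∷ s′  , false) = refl
    exec-scanBit b b′ (true ∷ x  , s , true ∷ s′  , true)  = refl
    exec-scanBit b b′ (false ∷ x , s , true ∷ s′  , false) = refl
    exec-scanBit b b′ (false ∷ x , s , true ∷ s′  , true)  = refl

    selecting : List Bool → List Bool → Selection n → Store 16
    selecting a a′ (s , rows , j) =
      joinRegs (List.concatMap (encodeAll [_]) rows) y a a′ (ones n) [] (reverse s) [] [] j , o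

    exec-scanRow : ∀ {d a a′ j x} (row : Vec Bool n) s → length s ≤ n →
      exec N (each B B′ (scanBit {suc d}))
        (joinRegs (encodeAll [_] row ++ x) y a a′ (ones n) [] [] s [] j , o)
      ≡ (joinRegs x y a a′ (ones n) [] (reverse s) [] (flag (hit s row)) j , o)
    exec-scanRow {d} {a} {a′} {j} {x} row s l = trans
      (exec-each {d = d} B B′ scanBit (scanning {a} {a′} {j}) scan (λ _ _ _ → refl)
        (λ b i → exec-move {d = suc d} B′ B (λ ()) _ o) (λ c b b′ i → exec-scanBit b (c ∷ b′) i) (ones n)
          (encodeAll [_] row ++ x , [] , s , false) ones≤N)
      (cong (scanning {a} {a′} {j} (ones n) [])
        (trans (cong (λ k → iter k scan (encodeAll [_] row ++ x , [] , s , false)) (List.length-replicate n))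
        (scan-row row x [] s false l)))

    exec-greedyStep : ∀ {a a′ j} row rows s → length s ≤ n →
      exec N (greedyStep {0}) (selecting a a′ (s , row ∷ rows , j)) ≡
        selecting a a′ (select (s , row ∷ rows , j))
    exec-greedyStep {a} {a′} {j} row rows s l = begin
      exec N (greedyStep {0}) (selecting a a′ (s , row ∷ rows , j))
        ≡⟨ cong (exec N (each B B′ (scanBit {1}) ⨾ selectVertex)) (exec-move {d = 1} Sel Sel′ (λ ()) _ o
             (ℕ.≤-trans (ℕ.≤-reflexive (List.length-reverse s)) (ℕ.≤-trans l n≤N))) ⟩
      exec N (each B B′ (scanBit {1}) ⨾ selectVertex)
        (joinRegs (encodeAll [_] row ++ x) y a a′ (ones n) [] [] (reverse (reverse s)) [] j , o)
        ≡⟨ cong (λ s → exec N (each B B′ (scanBit {1}) ⨾ selectVertex)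
          (joinRegs (encodeAll [_] row ++ x) y a a′ (ones n) [] [] s [] j , o)) (List.reverse-involutive s) ⟩
      exec N (each B B′ (scanBit {1}) ⨾ selectVertex)
        (joinRegs (encodeAll [_] row ++ x) y a a′ (ones n) [] [] s [] j , o)
        ≡⟨ cong (exec N (selectVertex {2})) (exec-scanRow {0} row s l) ⟩
      exec N (selectVertex {2}) (joinRegs x y a a′ (ones n) [] (reverse s) [] (flag (hit s row)) j , o)
        ≡⟨ selected (hit s row) ⟩
      selecting a a′ (select (s , row ∷ rows , j)) ∎
      where
      open ≡-Reasoning
      x = List.concatMap (encodeAll [_]) rows
      selected : ∀ h → exec N (selectVertex {2}) (joinRegs x y a a′ (ones n) [] (reverse s) [] (flag h) j , o)
                       ≡ selecting a a′ (s ++ [ not h ] , rows , (if h then j else suc j))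
      selected true  = cong (λ s → joinRegs x y a a′ (ones n) [] s [] [] j , o)
        (sym (List.reverse-++ s [ false ]))
      selected false = cong (λ s → joinRegs x y a a′ (ones n) [] s [] [] (suc j) , o)
        (sym (List.reverse-++ s [ true ]))

  exec-greedyPass : (M : Matrix n) → ∃[ s ] Exec N greedyPass
    (joinRegs (encodeRows M) y (ones n) [] (ones n) [] [] [] [] 0 , o)
    (joinRegs [] y (ones n) [] (ones n) [] s [] [] (greedySize M) , o)
  exec-greedyPass M = _ , exec≡ (begin
    exec N greedyPass (joinRegs (encodeRows M) y (ones n) [] (ones n) [] [] [] [] 0 , o)
      ≡⟨ cong (λ x → exec N greedyPass (joinRegs x y (ones n) [] (ones n) [] [] [] [] 0 , o)) (rows≡ M) ⟩
    exec N greedyPass (selecting (ones n) [] (unselected M))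
      ≡⟨ exec-each-invariant {d = 1} A A′ greedyStep selecting select (λ _ _ _ → refl)
           (λ a y → exec-move {d = 2} A′ A (λ ()) _ o) P next (ones n) (unselected M) ones≤N (initial M) ⟩
    selecting (ones n) [] (iter (length (ones n)) select (unselected M))
      ≡⟨ cong (selecting (ones n) [])
        (trans (cong (λ k → iter k select (unselected M)) (List.length-replicate n)) (select-greedy [] M 0)) ⟩
    selecting (ones n) [] (toList (greedy [] M) , [] , greedySize M + 0)
      ≡⟨ cong (λ j → selecting (ones n) [] (toList (greedy [] M) , [] , j)) (ℕ.+-identityʳ (greedySize M)) ⟩
    selecting (ones n) [] (toList (greedy [] M) , [] , greedySize M) ∎)
    where
    open ≡-Reasoning
    unselected : Matrix n → Selection n
    unselected M = [] , toList M , 0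
    rows≡ : ∀ {m} (M : Vec (Vec Bool n) m) → encodeRows M ≡ List.concatMap (encodeAll [_]) (toList M)
    rows≡ []        = refl
    rows≡ (row ∷ M) = cong (encodeAll [_] row ++_) (rows≡ M)
    P : ℕ → Selection n → Set
    P j (s , rows , _) = length rows ≡ j × length s + j ≤ n
    initial : ∀ M → P (length (ones n)) (unselected M)
    initial M rewrite List.length-replicate n {true} = Vec.length-toList M , ℕ.≤-refl
    next : ∀ b a a′ y → P (suc (length a)) y →
           exec N (pop A ⨾ push A′ b ⨾ greedyStep) (selecting (b ∷ a) a′ y) ≡
             selecting a (b ∷ a′) (select y) × P (length a) (select y)
    next b a a′ (s , row ∷ rows , j) (e , l) =
      exec-greedyStep row rows s (ℕ.≤-trans (ℕ.m≤m+n _ _) l) , ℕ.suc-injective e ,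
      ℕ.≤-trans (ℕ.≤-reflexive (trans (cong (_+ length a) (trans (List.length-++ s) (ℕ.+-comm _ 1)))
        (sym (ℕ.+-suc (length s) _)))) l

emitDup : ∀ {d} → Bool → Prog 16 (suc (suc d))
emitDup c = each Dup Dup′ (emit c)

exec-emitDup : ∀ {N d} c {x y z a a′ b b′ f e s s′ h k k′ j o} → j ≤ N →
  exec N (emitDup {d} c) (regs x y z a a′ b b′ f e (s ∷ s′ ∷ h ∷ k ∷ k′ ∷ ones j ∷ [] ∷ []) , o)
  ≡ (regs x y z a a′ b b′ f e (s ∷ s′ ∷ h ∷ k ∷ k′ ∷ ones j ∷ [] ∷ []) , o ++ replicate j c)
exec-emitDup {N} {d} c {x} {y} {z} {a} {a′} {b} {b′} {f} {e} {s} {s′} {h} {k} {k′} {j} {o} j≤N = trans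
  (exec-each {d = d} Dup Dup′ (emit c)
    (λ l l′ o → regs x y z a a′ b b′ f e (s ∷ s′ ∷ h ∷ k ∷ k′ ∷ l ∷ l′ ∷ []) , o) (_++ [ c ]) (λ _ _ _ → refl)
    (λ l o → exec-move {d = suc d} Dup′ Dup (λ ()) _ o) (λ _ _ _ _ → refl) (ones j) o
    (length-ones j≤N))
  (cong (regs x y z a a′ b b′ f e (s ∷ s′ ∷ h ∷ k ∷ k′ ∷ ones j ∷ [] ∷ []) ,_)
    (trans (iter-snoc (length (ones j)) c o) (cong (λ k → o ++ replicate k c) (List.length-replicate j))))

-- Writes k rows ending in k zeros each: a loop over k inside a loop over k. While one register is
-- being traversed it is split in two, so the inner loop needs its own copy of k, which is `Dup`.
joinBottom : Prog 16 3
joinBottom = each Cnt Cnt′ (emitB true ⨾ emitDup false)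

iter-rows : ∀ m n j (o : List Bool) → iter m (λ o → (o ++ ones n) ++ replicate j false) o
            ≡ o ++ encodeAll (λ row → ones n ++ encodeAll [_] row) (Vec.replicate m (Vec.replicate j false))
iter-rows zero    n j o = sym (List.++-identityʳ o)
iter-rows (suc m) n j o = trans (iter-rows m n j ((o ++ ones n) ++ replicate j false)) (trans
  (cong (_++ rest) (trans (List.++-assoc o (ones n) _)
    (cong (λ t → o ++ ones n ++ t) (sym (encodeAll-replicate j false)))))
  (List.++-assoc o (ones n ++ encodeAll [_] (Vec.replicate j false)) rest))
  where rest = encodeAll (λ row → ones n ++ encodeAll [_] row) (Vec.replicate m (Vec.replicate j false))

exec-joinBottom : ∀ {N n j s o} → n ≤ N → j ≤ N →
  exec N joinBottom (joinRegs [] [] (ones n) [] (ones n) [] s [] [] j , o)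
  ≡ (joinRegs [] [] (ones n) [] (ones n) [] s [] [] j ,
    o ++ encodeAll (λ row → ones n ++ encodeAll [_] row) (edgeless j))
exec-joinBottom {N} {n} {j} {s} {o} n≤N j≤N = trans
  (exec-each {d = 1} Cnt Cnt′ (emitB true ⨾ emitDup false) st (λ o → (o ++ ones n) ++ replicate j false)
    (λ _ _ _ → refl)
    (λ k o → exec-move {d = 2} Cnt′ Cnt (λ ()) _ o) row (ones j) o (length-ones j≤N))
  (cong (joinRegs [] [] (ones n) [] (ones n) [] s [] [] j ,_)
    (trans (cong (λ k → iter k (λ o → (o ++ ones n) ++ replicate j false) o) (List.length-replicate j))
      (iter-rows j n j o)))
  where
  st : List Bool → List Bool → List Bool → Store 16
  st k k′ o = regs [] [] [] (ones n) [] (ones n) [] [] [] (s ∷ [] ∷ [] ∷ k ∷ k′ ∷ ones j ∷ [] ∷ []) , o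
  row : ∀ b k k′ o → exec N (pop Cnt ⨾ push Cnt′ b ⨾ emitB {d = 0} true ⨾ emitDup {0} false) (st (b ∷ k) k′ o)
                     ≡ st k (b ∷ k′) ((o ++ ones n) ++ replicate j false)
  row b k k′ o = trans (cong (exec N (emitDup {0} false)) (exec-emitB {d = 0} true {x = []} {f = []} n≤N))
    (exec-emitDup {d = 0} false {x = []} j≤N)

joinBody : Prog 16 3
joinBody = copyY ⨾ greedyPass ⨾ emitB true ⨾ emitDup true ⨾ emit false ⨾ copyRows (emitDup true) ⨾ joinBottom

joinGreedy : Prog 16 3
joinGreedy = check noTail ⨾ case E joinBody λ _ → skip

blank7 : Vec (List Bool) 7
blank7 = Vec.replicate 7 []

joinMatrix : ∀ {n} (M : Matrix n) → Matrix (n + greedySize M)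
joinMatrix M = glueRows true M (edgeless (greedySize M))

run-joinGreedy-good : ∀ {n} (M : Matrix n) → run joinGreedy (encodeMatrix M) ≡ encodeMatrix (joinMatrix M)
run-joinGreedy-good {n} M = trans
  (cong (run joinGreedy) (cong (unary n ++_) (sym (List.++-identityʳ (encodeRows M)))))
  (trans (run-exec joinGreedy x (exec≡ checks ▷ accept
    (copy ▷ proj₂ greedyRun ▷ exec≡ (exec-emitB {d = 1} true {x = []} {z = []} {f = []} n≤N) ▷
      exec≡ (exec-emitDup {d = 1} true {x = []} {z = []} {f = []} j≤N)
      ▷ exec≡ {p = emit {d = 3} false} refl ▷ rows-exec ▷ exec≡ (exec-joinBottom {s = s} n≤N j≤N))))
    (trans (List.++-assoc _ rows bottom)
      (trans (List.++-assoc (ones n ++ ones j) [ false ] (rows ++ bottom))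
      (trans (List.++-assoc (ones n) (ones j) _)
      (trans (cong (ones n ++_) (sym (List.++-assoc (ones j) [ false ] (rows ++ bottom))))
        (sym (encodeMatrix-glue true M (edgeless j))))))))
  where
  x = unary n ++ encodeRows M ++ []
  N = length x
  j = greedySize M
  n≤N = order≤length n (encodeRows M ++ [])
  j≤N = ℕ.≤-trans (∣p∣≤n (greedy [] M)) n≤N
  checks = exec-check-good noTail {N} {o = []} {blank7} n M tt ℕ.≤-refl
  rows   = encodeAll (λ row → encodeAll [_] row ++ ones j) M
  bottom = encodeAll (λ row → ones n ++ encodeAll [_] row) (edgeless j)
  greedyRun : ∃[ s ] Exec N greedyPass
    (joinRegs (encodeRows M) (encodeRows M) (ones n) [] (ones n) [] [] [] [] 0 , [])
    (joinRegs [] (encodeRows M) (ones n) [] (ones n) [] s [] [] j , [])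
  greedyRun = exec-greedyPass n≤N M
  s = proj₁ greedyRun
  copy : Exec N copyY (checked noTail blank7 [] (encodeRows M ++ []) n false , [])
    (joinRegs (encodeRows M) (encodeRows M) (ones n) [] (ones n) [] [] [] [] 0 , [])
  copy = subst (λ y → Exec N copyY (checked noTail blank7 [] y n false , [])
    (joinRegs (encodeRows M) (encodeRows M) (ones n) [] (ones n) [] [] [] [] 0 , []))
    (sym (List.++-identityʳ (encodeRows M)))
    (exec≡ (exec-copyY {d = 2} (encodeRows M)
      (ℕ.≤-trans (List.length-++-≤ˡ (encodeRows M) {[]}) (List.length-++-≤ʳ (encodeRows M ++ []) {unary n}))))
  rows-exec : Exec N (copyRows (emitDup true))
    (joinRegs [] (encodeRows M) (ones n) [] (ones n) [] s [] [] j , ((ones n ++ ones j) ++ [ false ]))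
                (joinRegs [] [] (ones n) [] (ones n) [] s [] [] j , ((ones n ++ ones j) ++ [ false ]) ++ rows)
  rows-exec = exec≡ (exec-copyRows n≤N {d = 0} (emitDup true) (ones j) M
    (λ a a′ y o → exec-emitDup {d = 0} true {x = []} {y = y} j≤N))
  accept : ∀ {p : Prog 16 3} {q t} → Exec N p (checked noTail blank7 [] (encodeRows M ++ []) n false , []) t →
           Exec N (case E p q) (checked noTail blank7 [] (encodeRows M ++ []) n false , []) t
  accept (exec≡ e) = exec≡ e

run-joinGreedy-bad : ∀ x → ¬ Shape noTail x → run joinGreedy x ≡ []
run-joinGreedy-bad x ¬s =
  let x′ , y , n , e = exec-check-bad noTail {length x} {o = []} {blank7} x ℕ.≤-refl ¬s in
  run-exec joinGreedy x (exec≡ e ▷ exec≡ {p = case E joinBody λ _ → skip} refl)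

-- The two reductions for recognition problems

union-complete-wc : ∀ r ℓ x → rℓwc-g r ℓ x ⇔ rℓwc-g r (suc ℓ) (run (addDisjoint (completeGraph (suc r))) x)
union-complete-wc r ℓ = transform-wc {r} {ℓ} {r} {suc ℓ} (λ {n} _ → n + suc r) (λ M → glueRows false M K)
  (λ M → mk⇔ (λ a → isAdjacency-glue false M K a (isAdjacency-complete (suc r))) (isAdjacency-left false M K))
  (λ M a a′ → partition-union-complete M a a′)
  (λ M _ → mk⇔ (λ e → union-equalKernels M K e (complete-equalKernels r))
    (union-equalKernelsˡ M K (complete-kernel r)))
  (run (addDisjoint K)) (run-addDisjoint-good K) (run-addDisjoint-bad K)
  where K = completeGraph (suc r)

-- The isolated vertices make the joined edgeless graph too large to be covered by ℓ cliques.
module _ (r ℓ : ℕ) where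

  isolated : Matrix (suc ℓ)
  isolated = edgeless (suc ℓ)

  withIsolated : ∀ {n} → Matrix n → Matrix (n + suc ℓ)
  withIsolated M = glueRows false M isolated

  withIsolated-adjacency : ∀ {n} (M : Matrix n) → IsAdjacency M → IsAdjacency (withIsolated M)
  withIsolated-adjacency M a = isAdjacency-glue false M isolated a (isAdjacency-edgeless (suc ℓ))

  -- Every kernel contains all ℓ + 1 isolated vertices, as nothing dominates them; the greedy set is
  -- a kernel.
  ℓ<greedySize : ∀ {n} (M : Matrix n) → IsAdjacency M → ℓ < greedySize (withIsolated M)
  ℓ<greedySize {n} M a = bound (greedy [] (withIsolated M))
    (greedy-kernel (withIsolated M) (withIsolated-adjacency M a))
    where
    bound : ∀ S → Kernel (entry (withIsolated M)) S → ℓ < ∣ S ∣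
    bound S k with Vec.splitAt n S
    ... | S₁ , S₂ , refl = ℕ.≤-trans (ℕ.≤-reflexive (sym (∣full∣ S₂ (edgeless-full (kernel-unionʳ {M = M} {isolated} {S₁} {S₂} k)))))
      (ℕ.≤-trans (ℕ.m≤n+m (∣ S₂ ∣) (∣ S₁ ∣)) (ℕ.≤-reflexive (sym (∣++∣ S₁ S₂))))

  joinFunction : List Bool → List Bool
  joinFunction = run joinGreedy ∘ run (addDisjoint isolated)

  join-wc : ∀ x → rℓwc-g (suc r) ℓ x ⇔ rℓwc-g (suc (suc r)) ℓ (joinFunction x)
  join-wc = transform-wc {suc r} {ℓ} {suc (suc r)} {ℓ} (λ {n} M → n + suc ℓ + greedySize (withIsolated M))
    (λ M → joinMatrix (withIsolated M))
    (λ M → mk⇔ (λ a → isAdjacency-glue true (withIsolated M) (edgeless (greedySize (withIsolated M)))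
      (withIsolated-adjacency M a) (isAdjacency-edgeless (greedySize (withIsolated M))))
      (λ a → isAdjacency-left false M isolated
        (isAdjacency-left true (withIsolated M) (edgeless (greedySize (withIsolated M))) a)))
    (λ M a a′ → partition-join-edgeless (withIsolated M) (withIsolated-adjacency M a) a′ (ℓ<greedySize M a)
      ⇔-∘ partition-union-edgeless M a (withIsolated-adjacency M a))
    (λ M a → mk⇔
      (λ e → join-equalKernels (withIsolated M) (greedySize (withIsolated M)) (greedy [] (withIsolated M))
        (greedy-kernel (withIsolated M) (withIsolated-adjacency M a)) refl
        (union-equalKernels M isolated e (edgeless-equalKernels (suc ℓ))))
      (λ e → union-equalKernelsˡ M isolated (edgeless-kernel (suc ℓ))
        (join-equalKernelsˡ (withIsolated M) (greedySize (withIsolated M)) e)))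
    joinFunction
    (λ M → trans (cong (run joinGreedy) (run-addDisjoint-good isolated M))
      (run-joinGreedy-good (withIsolated M)))
    -- The first program turns a malformed string into the empty one, which the second finds
    -- malformed again.
    (λ x ¬s → trans (cong (run joinGreedy) (run-addDisjoint-bad isolated x ¬s))
      (run-joinGreedy-bad [] λ { (zero , _ , _ , ()) ; (suc _ , _ , _ , ()) }))

module _ (In : Language → Set₁) where

  -- The reductions do not depend on the class, so `In` is left open and later instantiated with
  -- `InNP` and `InCoNP`.
  Hard : Language → Set₁
  Hard L = ∀ C → In C → C ≤ₚ L

  hard-clique : ∀ r ℓ → Hard (rℓwc-g r ℓ) → Hard (rℓwc-g r (suc ℓ))
  hard-clique r ℓ hard C C∈ = reduce {L = rℓwc-g r ℓ} {rℓwc-g r (suc ℓ)} (addDisjoint (completeGraph (suc r)))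
    (union-complete-wc r ℓ) (hard C C∈)

  hard-independent : ∀ r ℓ → Hard (rℓwc-g (suc r) ℓ) → Hard (rℓwc-g (suc (suc r)) ℓ)
  hard-independent r ℓ hard C C∈ = let f , f-poly , e = hard C C∈ in
    joinFunction r ℓ ∘ f , PolyTime-run joinGreedy (PolyTime-run (addDisjoint (isolated r ℓ)) f-poly) , λ x →
      join-wc r ℓ (f x) ⇔-∘ e x

-- A certificate consists of two vertex sets S and T.  It refutes an instance if S and T are
-- kernels of different sizes, or singletons {u}, {v} at which symmetry, irreflexivity or a
-- condition on the part of u and v is violated.

rU rS rS′ rT rT′ rRS rRT rHS rHT rNK rST rTS rMeet rCS rCT rQS rQT rClq rDiff rNone rDC : Fin 30
rU    = # 9
rS    = # 10
rS′   = # 11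
rT    = # 12
rT′   = # 13
rRS   = # 14
rRT   = # 15
rHS   = # 16
rHT   = # 17
rNK   = # 18
rST   = # 19
rTS   = # 20
rMeet = # 21
rCS   = # 22
rCT   = # 23
rQS   = # 24
rQT   = # 25
rClq  = # 26
rDiff = # 27
rNone = # 28
rDC   = # 29

exec-setIf : ∀ {k d N} b (i : Fin k) f s o → lookup s i ≡ flag f →
             exec N (setIf {d = d} b i) (s , o) ≡ (s [ i ]%= (λ _ → flag (f ∨ b)) , o)
exec-setIf false i f s o e = cong (_, o)
  (sym (Vec.updateAt-id-local i s (trans (cong flag (Bool.∨-identityʳ f)) (sym e))))
exec-setIf true i true  s o e rewrite e = cong (_, o) (sym (Vec.updateAt-id-local i s (sym e)))
exec-setIf true i false s o e rewrite e = cong (_, o) (Vec.updateAt-cong-local i s (cong (true ∷_) e))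

pushIf : ∀ {k d} → Bool → Fin k → Bool → Prog k d
pushIf b i c = if b then push i c else skip

readFlag : ∀ {k d} → Fin k → (Bool → Prog k d) → Prog k d
readFlag i p = case i (p false) λ _ → p true

exec-readFlag : ∀ {k d N} (i : Fin k) (p : Bool → Prog k d) f {s t} → lookup (proj₁ s) i ≡ flag f →
                Exec N (p f) s t → Exec N (readFlag i p) s t
exec-readFlag i p false e (exec≡ h) = exec≡ (trans (cong (λ l → peek l _ _) e) h)
exec-readFlag i p true  e (exec≡ h) = exec≡ (trans (cong (λ l → peek l _ _) e) h)

-- Phase 1: splitting the input pair

unpairStep : ∀ {d} → Prog 30 d
unpairStep = case F (case X skip λ { true  → pop X ⨾ case X skip λ b → pop X ⨾ push Z b
                                   ; false → pop X ⨾ set F }) λ _ → skip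

-- The loop leaves the certificate on `X` and the instance reversed on `Z`. The certificate travels
-- to `rU` through `rS`, so that its two reversals cancel.
unpair : Prog 30 3
unpair = loop unpairStep ⨾ pop F ⨾ move∗ X rS ⨾ move∗ rS rU ⨾ move∗ Z X

no-marks : Vec (List Bool) 20
no-marks = Vec.replicate 20 []

length-pair : ∀ x u → length x ≤ length (pair x u) × length u ≤ length (pair x u)
length-pair []      u = z≤n , ℕ.n≤1+n _
length-pair (b ∷ x) u = let l₁ , l₂ = length-pair x u in s≤s (ℕ.m≤n⇒m≤1+n l₁) , ℕ.m≤n⇒m≤1+n (ℕ.m≤n⇒m≤1+n l₂)

exec-unpair : ∀ {N} x u → length (pair x u) ≤ N →
  Exec N unpair (regs (pair x u) [] [] [] [] [] [] [] [] ([] ∷ no-marks) , [])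
                (regs x [] [] [] [] [] [] [] [] (u ∷ no-marks) , [])
exec-unpair {N} x u l =
  exec≡ (go N x [] l) ▷ exec≡ {p = pop {d = 3} F} refl ▷ exec≡ (exec-move {d = 2} X rS (λ ()) _ [] u≤N) ▷
  exec≡ (exec-move {d = 2} rS rU (λ ()) _ [] (ℕ.≤-trans (ℕ.≤-reflexive (List.length-reverse u)) u≤N)) ▷
  exec≡ (trans (exec-move {d = 2} Z X (λ ()) _ [] (ℕ.≤-trans (ℕ.≤-reflexive (List.length-reverse x)) x≤N))
    (cong₂ (λ x u → regs x [] [] [] [] [] [] [] [] (u ∷ no-marks) , []) (List.reverse-involutive x)
      (List.reverse-involutive u)))
  where
  u≤N = ℕ.≤-trans (proj₂ (length-pair x u)) l
  x≤N = ℕ.≤-trans (proj₁ (length-pair x u)) l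
  st : List Bool → List Bool → Bool → Store 30
  st x z f = regs x [] z [] [] [] [] (flag f) [] ([] ∷ no-marks) , []
  go : ∀ M x z → length (pair x u) ≤ M → iter M (exec N (unpairStep {2})) (st (pair x u) z false) ≡
    st u (x ʳ++ z) true
  go (suc M) []      z (s≤s l) = iter-fix (exec N (unpairStep {2})) (st u z true) refl M
  go (suc M) (b ∷ x) z (s≤s l) = go M x (b ∷ z) (ℕ.≤-trans (ℕ.n≤1+n _) l)

-- Phase 2: reading the certificate

-- Missing bits count as `false` and surplus bits are ignored, so every string is a certificate of
-- the right format.
padTake : ∀ n → List Bool → Vec Bool n
padTake zero    u       = []
padTake (suc n) []      = false ∷ padTake n []
padTake (suc n) (b ∷ u) = b ∷ padTake n u

readCertificate : ∀ {d} → Fin 30 → Prog 30 (suc (suc d))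
readCertificate i = each A A′ (case rU (push i false) λ b → pop rU ⨾ push i b)

spreadTo : ∀ {d} → Fin 30 → Fin 30 → Fin 30 → Prog 30 (suc d)
spreadTo i j k = loop (case i skip λ b → pop i ⨾ push j b ⨾ push k b)

-- Each set is stored twice: `rS` and `rT` are scanned anew along every row, whereas `rRS` and `rRT`
-- give up one bit per row, the membership of the vertex to which the row belongs.
readSets : Prog 30 3
readSets = readCertificate rS′ ⨾ spreadTo rS′ rS rRS ⨾ readCertificate rT′ ⨾ spreadTo rT′ rT rRT

module _ {N n : ℕ} {y : List Bool} (n≤N : n ≤ N) where

  private
    loading : (a a′ u s s′ t t′ rs rt : List Bool) → Store 30
    loading a a′ u s s′ t t′ rs rt =
      regs [] y [] a a′ (ones n) [] [] [] (u ∷ s ∷ s′ ∷ t ∷ t′ ∷ rs ∷ rt ∷ Vec.replicate 14 []) , []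

    ones≤N : length (ones n) ≤ N
    ones≤N = length-ones n≤N

    take₁ : List Bool × List Bool → List Bool × List Bool
    take₁ ([]    , v) = [] , false ∷ v
    take₁ (b ∷ u , v) = u , b ∷ v

    iter-take : ∀ n u v → iter n take₁ (u , v) ≡ (drop n u , toList (padTake n u) ʳ++ v)
    iter-take zero    u       v = refl
    iter-take (suc n) []      v = trans (iter-take n [] (false ∷ v))
      (cong (_, (toList (padTake n []) ʳ++ (false ∷ v))) (drop-[] n))
      where
      drop-[] : ∀ n → drop {A = Bool} n [] ≡ []
      drop-[] zero    = refl
      drop-[] (suc n) = refl
    iter-take (suc n) (b ∷ u) v = iter-take n u (b ∷ v)

    spread-fold : ∀ z s t → List.foldl (λ (s , t) (b : Bool) → b ∷ s , b ∷ t) (s , t) z ≡ (z ʳ++ s , z ʳ++ t)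
    spread-fold []      s t = refl
    spread-fold (b ∷ z) s t = spread-fold z (b ∷ s) (b ∷ t)

    length-reversed : ∀ (S : Vec Bool n) → length (reverse (toList S)) ≤ N
    length-reversed S = ℕ.≤-trans (ℕ.≤-reflexive
      (trans (List.length-reverse (toList S)) (Vec.length-toList S))) n≤N

    exec-readS : ∀ u → Exec N (readCertificate {1} rS′) (loading (ones n) [] u [] [] [] [] [] [])
      (loading (ones n) [] (drop n u) [] (reverse (toList (padTake n u))) [] [] [] [])
    exec-readS u = exec≡ (trans
      (exec-each {d = 1} A A′ (case rU (push rS′ false) λ b → pop rU ⨾ push rS′ b) st take₁ (λ _ _ _ → refl)
        (λ a (u , s′) → exec-move {d = 2} A′ A (λ ()) _ [])
          (λ { b a a′ ([] , v) → refl ; b a a′ (c ∷ u , v) → refl }) (ones n) (u , []) ones≤N)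
      (cong (st (ones n) []) (trans (cong (λ k → iter k take₁ (u , [])) (List.length-replicate n))
        (iter-take n u []))))
      where
      st : List Bool → List Bool → List Bool × List Bool → Store 30
      st a a′ (u , s′) = loading a a′ u [] s′ [] [] [] []

    exec-readT : ∀ u s rs → Exec N (readCertificate {1} rT′) (loading (ones n) [] u s [] [] [] rs [])
      (loading (ones n) [] (drop n u) s [] [] (reverse (toList (padTake n u))) rs [])
    exec-readT u s rs = exec≡ (trans
      (exec-each {d = 1} A A′ (case rU (push rT′ false) λ b → pop rU ⨾ push rT′ b) st take₁ (λ _ _ _ → refl)
        (λ a (u , t′) → exec-move {d = 2} A′ A (λ ()) _ [])
          (λ { b a a′ ([] , v) → refl ; b a a′ (c ∷ u , v) → refl }) (ones n) (u , []) ones≤N)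
      (cong (st (ones n) []) (trans (cong (λ k → iter k take₁ (u , [])) (List.length-replicate n))
        (iter-take n u []))))
      where
      st : List Bool → List Bool → List Bool × List Bool → Store 30
      st a a′ (u , t′) = loading a a′ u s [] [] t′ rs []

    exec-spreadS : ∀ u (S : Vec Bool n) →
      Exec N (spreadTo {2} rS′ rS rRS) (loading (ones n) [] u [] (reverse (toList S)) [] [] [] [])
      (loading (ones n) [] u (toList S) [] [] [] (toList S) [])
    exec-spreadS u S = exec≡ (trans
      (drain (exec N (case {d = 2} rS′ skip λ b → pop rS′ ⨾ push rS b ⨾ push rRS b)) st
        (λ (s , t) b → b ∷ s , b ∷ t) (λ _ → refl) (λ _ _ _ → refl) N
        (reverse (toList S)) ([] , []) (length-reversed S))
      (cong (st []) (trans (spread-fold (reverse (toList S)) [] [])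
        (cong₂ _,_ (List.reverse-involutive _) (List.reverse-involutive _)))))
      where
      st : List Bool → List Bool × List Bool → Store 30
      st z (s , rs) = loading (ones n) [] u s z [] [] rs []

    exec-spreadT : ∀ u s rs (T : Vec Bool n) →
      Exec N (spreadTo {2} rT′ rT rRT) (loading (ones n) [] u s [] [] (reverse (toList T)) rs [])
      (loading (ones n) [] u s [] (toList T) [] rs (toList T))
    exec-spreadT u s rs T = exec≡ (trans
      (drain (exec N (case {d = 2} rT′ skip λ b → pop rT′ ⨾ push rT b ⨾ push rRT b)) st
        (λ (s , t) b → b ∷ s , b ∷ t) (λ _ → refl) (λ _ _ _ → refl) N
        (reverse (toList T)) ([] , []) (length-reversed T))
      (cong (st []) (trans (spread-fold (reverse (toList T)) [] [])
        (cong₂ _,_ (List.reverse-involutive _) (List.reverse-involutive _)))))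
      where
      st : List Bool → List Bool × List Bool → Store 30
      st z (t , rt) = loading (ones n) [] u s [] t z rs rt

  exec-readSets : ∀ u → let S = toList (padTake n u) ; T = toList (padTake n (drop n u)) in
    Exec N readSets (loading (ones n) [] u [] [] [] [] [] [])
      (loading (ones n) [] (drop n (drop n u)) S [] T [] S T)
  exec-readSets u = exec-readS u ▷ exec-spreadS (drop n u) (padTake n u) ▷ exec-readT (drop n u) _ _ ▷
    exec-spreadT (drop n (drop n u)) _ _ (padTake n (drop n u))

-- Phase 3: the rows of the matrix

meets : ∀ {n} → Vec Bool n → Vec Bool n → Bool
meets []        []      = false
meets (b ∷ row) (s ∷ S) = (b ∧ s) ∨ meets row S

record Marks : Set where
  constructor marks
  field
    notKernels hitST hitTS meet : Bool
    sizeS sizeT                 : ℕ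

count : Bool → ℕ → ℕ
count b c = if b then suc c else c

-- S is a kernel of a symmetric matrix if each vertex satisfies exactly one of two conditions, lying
-- in S and having a neighbour in S; hence the `xor`. For singletons {u} and {v}, the next three
-- flags become the entries at (u, v) and (v, u) and the truth value of u = v.
markRow : (s t hs ht : Bool) → Marks → Marks
markRow s t hs ht (marks nk st ts me cs ct) =
  marks ((nk ∨ not (hs xor s)) ∨ not (ht xor t)) (st ∨ (ht ∧ s)) (ts ∨ (hs ∧ t)) (me ∨ (s ∧ t)) (count s cs)
    (count t ct)

markRows : ∀ {m n} → Vec Bool n → Vec Bool n → Vec Bool m → Vec Bool m → Vec (Vec Bool n) m → Marks → Marks
markRows S T []       []       []        k = k
markRows S T (s ∷ S₂) (t ∷ T₂) (row ∷ M) k = markRows S T S₂ T₂ M (markRow s t (meets row S) (meets row T) k)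

takeFlag : ∀ {k d} → Fin k → (Bool → Prog k d) → Prog k d
takeFlag i p = case i (p false) λ _ → pop i ⨾ p true

exec-takeFlag : ∀ {k d N} (i : Fin k) (p : Bool → Prog k d) f {s o t} → lookup s i ≡ flag f →
                Exec N (p f) (s [ i ]%= (λ _ → []) , o) t → Exec N (takeFlag i p) (s , o) t
exec-takeFlag {N = N} i p false {s} {o} e (exec≡ h) =
  exec≡ (trans (cong (λ l → peek l (exec N (p false) (s , o)) (λ _ → exec N (pop i ⨾ p true) (s , o))) e)
  (trans (cong (λ s → exec N (p false) (s , o)) (sym (Vec.updateAt-id-local i s (sym e)))) h))
exec-takeFlag {N = N} i p true {s} {o} e (exec≡ h) =
  exec≡ (trans (cong (λ l → peek l (exec N (p false) (s , o)) (λ _ → exec N (pop i ⨾ p true) (s , o))) e)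
  (trans (cong (λ s → exec N (p true) (s , o))
    (Vec.updateAt-cong-local i {f = drop 1} {g = λ _ → []} s (cong (drop 1) e))) h))

columnStep : ∀ {d} → Prog 30 d
columnStep = case rS skip λ s → pop rS ⨾ push rS′ s ⨾ case rT skip λ t → pop rT ⨾ push rT′ t ⨾
             case Y skip λ b → pop Y ⨾ setIf (b ∧ s) rHS ⨾ setIf (b ∧ t) rHT

hits : ∀ {d} → (s t : Bool) → Fin 30 → Bool → Prog 30 d
hits s t i h = setIf (not (h xor s)) rNK ⨾ setIf (h ∧ t) i

endRow : ∀ {d} → (s t : Bool) → Prog 30 d
endRow s t = takeFlag rHS (hits s t rTS) ⨾ takeFlag rHT (hits t s rST) ⨾ setIf (s ∧ t) rMeet ⨾
  pushIf s rCS true ⨾ pushIf t rCT true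

matrixStep : ∀ {d} → Prog 30 (suc d)
matrixStep = case rRS skip λ s → pop rRS ⨾ case rRT skip λ t → pop rRT ⨾
             loop columnStep ⨾ move∗ rS′ rS ⨾ move∗ rT′ rT ⨾ endRow s t

matrixPass : Prog 30 3
matrixPass = loop matrixStep

matching : (n : ℕ) (u y s s′ t t′ rs rt : List Bool) (hs ht : Bool) → Marks → Store 30
matching n u y s s′ t t′ rs rt hs ht (marks nk st ts me cs ct) =
  regs [] y [] (ones n) [] (ones n) [] [] [] (u ∷ s ∷ s′ ∷ t ∷ t′ ∷ rs ∷ rt ∷ flag hs ∷ flag ht ∷
    flag nk ∷ flag st ∷ flag ts ∷ flag me ∷ ones cs ∷ ones ct ∷ Vec.replicate 6 []) , []

module _ {N n : ℕ} {u : List Bool} (n≤N : n ≤ N) where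

  exec-columns : ∀ {d} M {m} (row S T : Vec Bool m) {y s′ t′ rs rt hs ht k} → m ≤ M →
    iter M (exec N (columnStep {d}))
      (matching n u (encodeAll [_] row ++ y) (toList S) s′ (toList T) t′ rs rt hs ht k)
    ≡ matching n u y [] (toList S ʳ++ s′) [] (toList T ʳ++ t′) rs rt (hs ∨ meets row S) (ht ∨ meets row T) k
  exec-columns {d} M [] [] [] {y} {s′} {t′} {rs} {rt} {hs} {ht} {k} l = trans
    (iter-fix (exec N (columnStep {d})) (matching n u y [] s′ [] t′ rs rt hs ht k) refl M)
    (cong₂ (λ hs ht → matching n u y [] s′ [] t′ rs rt hs ht k) (sym (Bool.∨-identityʳ hs))
      (sym (Bool.∨-identityʳ ht)))
  exec-columns {d} (suc M) (b ∷ row) (s ∷ S) (t ∷ T) {y} {s′} {t′} {rs} {rt} {hs} {ht} {k} (s≤s l) = trans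
    (cong (iter M (exec N (columnStep {d}))) (trans
      (cong (exec N (setIf {d = d} (b ∧ t) rHT))
        (exec-setIf {d = d} {N} (b ∧ s) rHS hs (proj₁ (st hs ht)) [] refl))
      (exec-setIf {d = d} {N} (b ∧ t) rHT ht (proj₁ (st (hs ∨ (b ∧ s)) ht)) [] refl)))
    (trans (exec-columns M row S T l) (cong₂ (λ hs ht → matching n u y [] _ [] _ rs rt hs ht k)
      (Bool.∨-assoc hs (b ∧ s) (meets row S)) (Bool.∨-assoc ht (b ∧ t) (meets row T))))
    where
    st : Bool → Bool → Store 30
    st hs ht = matching n u (encodeAll [_] row ++ y) (toList S) (s ∷ s′) (toList T) (t ∷ t′) rs rt hs ht k

  exec-endRow : ∀ {d} s t hs ht {y S T rs rt} k →
    Exec N (endRow {d} s t) (matching n u y S [] T [] rs rt hs ht k)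
      (matching n u y S [] T [] rs rt false false (markRow s t hs ht k))
  exec-endRow {d} s t hs ht {y} {S} {T} {rs} {rt} (marks nk st ts me cs ct) =
    exec-takeFlag rHS (hits s t rTS) hs refl
      (exec≡ (exec-setIf {d = d} {N} (not (hs xor s)) rNK nk (proj₁ (state false ht nk st ts me)) [] refl) ▷
       exec≡ (exec-setIf {d = d} {N} (hs ∧ t) rTS ts (proj₁ (state false ht nk₁ st ts me)) [] refl)) ▷
    exec-takeFlag rHT (hits t s rST) ht {proj₁ (state false ht nk₁ st ts₁ me)} refl
      (exec≡ (exec-setIf {d = d} {N} (not (ht xor t)) rNK nk₁ (proj₁ (state false false nk₁ st ts₁ me)) []
        refl) ▷
       exec≡ (exec-setIf {d = d} {N} (ht ∧ s) rST st (proj₁ (state false false nk₂ st ts₁ me)) [] refl)) ▷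
    exec≡ (exec-setIf {d = d} {N} (s ∧ t) rMeet me (proj₁ (state false false nk₂ st₁ ts₁ me)) [] refl) ▷
    exec≡ (counted s t)
    where
    state : (hs ht nk st ts me : Bool) → Store 30
    state hs ht nk st ts me = matching n u y S [] T [] rs rt hs ht (marks nk st ts me cs ct)
    nk₁ = nk ∨ not (hs xor s)
    nk₂ = nk₁ ∨ not (ht xor t)
    ts₁ = ts ∨ (hs ∧ t)
    st₁ = st ∨ (ht ∧ s)
    counted : ∀ s′ t′ → exec N (pushIf {d = d} s′ rCS true ⨾ pushIf t′ rCT true)
      (state false false nk₂ st₁ ts₁ (me ∨ (s ∧ t)))
      ≡ matching n u y S [] T [] rs rt false false
        (marks nk₂ st₁ ts₁ (me ∨ (s ∧ t)) (count s′ cs) (count t′ ct))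
    counted false false = refl
    counted false true  = refl
    counted true  false = refl
    counted true  true  = refl

  exec-rows : ∀ {d} M {m} (S T : Vec Bool n) (S₂ T₂ : Vec Bool m) (rows : Vec (Vec Bool n) m) {y k} → m ≤ M →
    iter M (exec N (matrixStep {d}))
      (matching n u (encodeRows rows ++ y) (toList S) [] (toList T) [] (toList S₂) (toList T₂) false false k)
    ≡ matching n u y (toList S) [] (toList T) [] [] [] false false (markRows S T S₂ T₂ rows k)
  exec-rows {d} M S T [] [] [] {y} {k} l =
    iter-fix (exec N (matrixStep {d})) (matching n u y (toList S) [] (toList T) [] [] [] false false k) refl M
  exec-rows {d} (suc M) S T (s ∷ S₂) (t ∷ T₂) (row ∷ rows) {y} {k} (s≤s l) =
    trans (cong (iter M (exec N (matrixStep {d}))) (trans (cong (λ y → exec N (matrixStep {d})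
      (matching n u y (toList S) [] (toList T) [] (s ∷ toList S₂) (t ∷ toList T₂) false false k))
        (List.++-assoc (encodeAll [_] row) (encodeRows rows) y)) step₁))
      (exec-rows M S T S₂ T₂ rows l)
    where
    y′ = encodeRows rows ++ y
    mid : List Bool → List Bool → List Bool → List Bool → Store 30
    mid s s′ t t′ = matching n u y′ s s′ t t′ (toList S₂) (toList T₂) (meets row S) (meets row T) k
    reversed≤N : ∀ (S : Vec Bool n) → length (reverse (toList S)) ≤ N
    reversed≤N S = ℕ.≤-trans (ℕ.≤-reflexive (trans (List.length-reverse (toList S)) (Vec.length-toList S)))
      n≤N
    body : Exec N (loop {d = d} columnStep ⨾ move∗ rS′ rS ⨾ move∗ rT′ rT ⨾ endRow s t)
      (matching n u (encodeAll [_] row ++ y′) (toList S) [] (toList T) [] (toList S₂) (toList T₂) false false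
        k)
      (matching n u y′ (toList S) [] (toList T) [] (toList S₂) (toList T₂) false false
        (markRow s t (meets row S) (meets row T) k))
    body = exec≡ (exec-columns N row S T n≤N) ▷
      exec≡ (trans (exec-move {d = d} rS′ rS (λ ()) _ [] (reversed≤N S))
        (cong (λ s → mid s [] [] (reverse (toList T))) (List.reverse-involutive (toList S)))) ▷
      exec≡ (trans (exec-move {d = d} rT′ rT (λ ()) (proj₁ (mid (toList S) [] [] (reverse (toList T)))) []
        (reversed≤N T)) (cong (λ t → mid (toList S) [] t []) (List.reverse-involutive (toList T)))) ▷
      exec-endRow s t (meets row S) (meets row T) k
    step₁ : exec N (matrixStep {d})
      (matching n u (encodeAll [_] row ++ y′) (toList S) [] (toList T) [] (s ∷ toList S₂) (t ∷ toList T₂)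
      false false k)
      ≡ matching n u y′ (toList S) [] (toList T) [] (toList S₂) (toList T₂) false false
        (markRow s t (meets row S) (meets row T) k)
    step₁ with body
    ... | exec≡ e = e

-- Phase 4: the parts

kind : ∀ {r ℓ} → Fin r ⊎ Fin ℓ → Bool
kind (inj₁ _) = false
kind (inj₂ _) = true

number : ∀ {r ℓ} → Fin r ⊎ Fin ℓ → ℕ
number (inj₁ i) = toℕ i
number (inj₂ j) = toℕ j

noted : Bool → Bool → List Bool → List Bool
noted s b q = if s then b ∷ q else q

-- For a singleton {u} the final list is the code of the part of u: its number in unary, closed by
-- its kind. Comparing two such lists decides whether u and v share a part.
notePart : ∀ {r ℓ} → Bool → Fin r ⊎ Fin ℓ → List Bool → List Bool
notePart s p q = iter (number p) (noted s true) (noted s (kind p) q)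

record Colours : Set where
  constructor colours
  field
    isClique      : Bool
    partsS partsT : List Bool

colour : ∀ {r ℓ} → Bool → Bool → Fin r ⊎ Fin ℓ → Colours → Colours
colour s t p (colours cl qs qt) = colours (cl ∨ (kind p ∧ s)) (notePart s p qs) (notePart t p qt)

colourAll : ∀ {r ℓ m} → Vec Bool m → Vec Bool m → Vec (Fin r ⊎ Fin ℓ) m → Colours → Colours
colourAll []      []      []      k = k
colourAll (s ∷ S) (t ∷ T) (p ∷ c) k = colourAll S T c (colour s t p k)

note : ∀ {d} → Bool → Bool → Bool → Prog 30 d
note s t b = pushIf s rQS b ⨾ pushIf t rQT b

copyIndex : ∀ {d} → ℕ → Bool → Bool → Prog 30 d
copyIndex zero    s t = skip
copyIndex (suc k) s t = case Y skip λ { false → pop Y ; true → pop Y ⨾ note s t true ⨾ copyIndex k s t }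

copyPart : ∀ {d} → ℕ → ℕ → Bool → Bool → Prog 30 d
copyPart r ℓ s t = case Y skip λ { false → pop Y ⨾ setIf false rClq ⨾ note s t false ⨾ copyIndex r s t
                                 ; true  → pop Y ⨾ setIf s rClq ⨾ note s t true ⨾ copyIndex ℓ s t }

partStep : ∀ {d} → ℕ → ℕ → Prog 30 d
partStep r ℓ = case rS skip λ s → pop rS ⨾ case rT skip λ t → pop rT ⨾ copyPart r ℓ s t

partPass : ℕ → ℕ → Prog 30 3
partPass r ℓ = loop (partStep r ℓ)

colouring : (n : ℕ) (u y s t : List Bool) → Marks → Colours → Store 30
colouring n u y s t (marks nk st ts me cs ct) (colours cl qs qt) =
  regs [] y [] (ones n) [] (ones n) [] [] [] (u ∷ s ∷ [] ∷ t ∷ [] ∷ [] ∷ [] ∷ [] ∷ [] ∷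
    flag nk ∷ flag st ∷ flag ts ∷ flag me ∷ ones cs ∷ ones ct ∷ qs ∷ qt ∷ flag cl ∷ [] ∷ [] ∷ [] ∷ []) , []

module _ {N n : ℕ} {u : List Bool} {k : Marks} where

  exec-note : ∀ {d} s t b {y S T cl qs qt} →
    exec N (note {d} s t b) (colouring n u y S T k (colours cl qs qt))
              ≡ colouring n u y S T k (colours cl (noted s b qs) (noted t b qt))
  exec-note false false b = refl
  exec-note false true  b = refl
  exec-note true  false b = refl
  exec-note true  true  b = refl

  exec-copyIndex : ∀ {d j} (i : Fin j) s t {y S T cl qs qt} →
    exec N (copyIndex {d} j s t) (colouring n u (unary (toℕ i) ++ y) S T k (colours cl qs qt))
    ≡ colouring n u y S T k (colours cl (iter (toℕ i) (noted s true) qs) (iter (toℕ i) (noted t true) qt))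
  exec-copyIndex zero    s t = refl
  exec-copyIndex {d} {suc j} (suc i) s t =
    trans (cong (exec N (copyIndex {d} j s t)) (exec-note {d} s t true)) (exec-copyIndex {d} i s t)

  exec-copyPart : ∀ {d r ℓ} s t (p : Fin r ⊎ Fin ℓ) {y S T} c →
    exec N (copyPart {d} r ℓ s t) (colouring n u (encodePart p ++ y) S T k c) ≡
      colouring n u y S T k (colour s t p c)
  exec-copyPart {d} {r} s t (inj₁ i) {y} {S} {T} (colours cl qs qt) =
    trans (cong (exec N (copyIndex {d} r s t)) (exec-note {d} s t false {cl = cl}))
      (trans (exec-copyIndex {d} i s t)
        (cong (λ cl → colouring n u y S T k
        (colours cl (notePart s (inj₁ {B = Fin r} i) qs) (notePart t (inj₁ {B = Fin r} i) qt)))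
        (sym (Bool.∨-identityʳ cl))))
  exec-copyPart {d} {r} {ℓ} s t (inj₂ j) {y} {S} {T} (colours cl qs qt) =
    trans (cong (exec N (note {d} s t true ⨾ copyIndex ℓ s t))
      (exec-setIf {d = d} {N} s rClq cl (proj₁ (colouring n u (unary (toℕ j) ++ y) S T k (colours cl qs qt)))
        [] refl))
      (trans (cong (exec N (copyIndex {d} ℓ s t)) (exec-note {d} s t true {cl = cl ∨ s}))
        (exec-copyIndex {d} j s t))

  exec-parts : ∀ {d r ℓ} M {m} (S T : Vec Bool m) (c : Vec (Fin r ⊎ Fin ℓ) m) {y} q → m ≤ M →
    iter M (exec N (partStep {d} r ℓ)) (colouring n u (encodeAll encodePart c ++ y) (toList S) (toList T) k q)
    ≡ colouring n u y [] [] k (colourAll S T c q)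
  exec-parts {d} {r} {ℓ} M [] [] [] {y} q l =
    iter-fix (exec N (partStep {d} r ℓ)) (colouring n u y [] [] k q) refl M
  exec-parts {d} {r} {ℓ} (suc M) (s ∷ S) (t ∷ T) (p ∷ c) {y} q (s≤s l) =
    trans (cong (λ y → iter (suc M) (exec N (partStep {d} r ℓ))
      (colouring n u y (s ∷ toList S) (t ∷ toList T) k q))
      (List.++-assoc (encodePart p) (encodeAll encodePart c) y))
      (trans (cong (iter M (exec N (partStep {d} r ℓ))) (exec-copyPart {d} s t p q)) (exec-parts M S T c _ l))

-- Phase 5: the verdict

isOne : ℕ → Bool
isOne 1 = true
isOne _ = false

differ : List Bool → List Bool → Bool
differ []      []      = false
differ []      (_ ∷ _) = true
differ (_ ∷ _) []      = true
differ (a ∷ p) (b ∷ q) = (a xor b) ∨ differ p q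

-- The flag `rNone` is set unless the count is exactly one. The count is put back, as the two counts
-- are still to be compared.
checkSingle : ∀ {d} → Fin 30 → Prog 30 d
checkSingle i = case i (set rNone) λ _ → pop i ⨾ case i (push i true) λ _ → push i true ⨾ set rNone

compareStep : ∀ {d} → Fin 30 → Fin 30 → Fin 30 → Prog 30 d
compareStep i j k = case i (case j skip λ _ → pop j ⨾ set k) λ a → pop i ⨾ case j (set k) λ b → pop j ⨾
  setIf (a xor b) k

readFlags : ∀ {k d m} → Vec (Fin k) m → (Vec Bool m → Bool) → Prog k d
readFlags []       f = emit (f [])
readFlags (i ∷ is) f = readFlag i λ b → readFlags is (f ∘ (b ∷_))

exec-readFlags : ∀ {k d N m} (is : Vec (Fin k) m) f bs {s o} → Vec.map (lookup s) is ≡ Vec.map flag bs →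
                 Exec N (readFlags {d = d} is f) (s , o) (s , o ++ [ f bs ])
exec-readFlags []       f []       e = exec≡ refl
exec-readFlags (i ∷ is) f (b ∷ bs) e =
  exec-readFlag i (λ b → readFlags is (f ∘ (b ∷_))) b (Vec.∷-injectiveˡ e)
  (exec-readFlags is (f ∘ (b ∷_)) bs (Vec.∷-injectiveʳ e))

-- First disjunct: two kernels of different sizes. Second disjunct, for singletons {u} and {v}: the
-- entries at (u, v) and (v, u) differ, or u = v carries a loop, or u and v share a part which is a
-- clique although u and v are distinct and not adjacent, or which is independent although they are
-- adjacent.
verdict : Vec Bool 8 → Bool
verdict (nk ∷ diff ∷ none ∷ st ∷ ts ∷ me ∷ dc ∷ cl ∷ []) =
  (not nk ∧ diff) ∨ (not none ∧ ((st xor ts) ∨ (me ∧ st) ∨ (not dc ∧ (if cl then not me ∧ not st else st))))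

decide : ∀ {d} → Prog 30 d
decide = readFlags (rNK ∷ rDiff ∷ rNone ∷ rST ∷ rTS ∷ rMeet ∷ rDC ∷ rClq ∷ []) verdict

conclude : Prog 30 3
conclude = checkSingle rCS ⨾ checkSingle rCT ⨾ loop (compareStep rCS rCT rDiff) ⨾
  loop (compareStep rQS rQT rDC) ⨾ decide

module _ {d N : ℕ} (i j k : Fin 30) (st : List Bool → List Bool → Bool → Store 30)
         (both : ∀ f → exec N (compareStep {d} i j k) (st [] [] f) ≡ st [] [] f)
         (short : ∀ b q f → exec N (compareStep {d} i j k) (st [] (b ∷ q) f) ≡ st [] q (f ∨ true))
         (long : ∀ a p f → exec N (compareStep {d} i j k) (st (a ∷ p) [] f) ≡ st p [] (f ∨ true))
         (next : ∀ a p b q f → exec N (compareStep {d} i j k) (st (a ∷ p) (b ∷ q) f) ≡ st p q (f ∨ (a xor b))) where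

  exec-compare : ∀ M p q f → length p ≤ M → length q ≤ M →
                 iter M (exec N (compareStep {d} i j k)) (st p q f) ≡ st [] [] (f ∨ differ p q)
  exec-compare M [] [] f l l′ = trans (iter-fix _ _ (both f) M) (cong (st [] []) (sym (Bool.∨-identityʳ f)))
  exec-compare (suc M) [] (b ∷ q) f l (s≤s l′) = trans (cong (iter M _) (short b q f))
    (trans (exec-compare M [] q _ z≤n l′) (cong (st [] []) (Bool.∨-assoc f true _)))
  exec-compare (suc M) (a ∷ p) [] f (s≤s l) l′ = trans (cong (iter M _) (long a p f))
    (trans (exec-compare M p [] _ l z≤n) (cong (st [] []) (Bool.∨-assoc f true (differ p []))))
  exec-compare (suc M) (a ∷ p) (b ∷ q) f (s≤s l) (s≤s l′) = trans (cong (iter M _) (next a p b q f))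
    (trans (exec-compare M p q _ l l′) (cong (st [] []) (Bool.∨-assoc f (a xor b) (differ p q))))

judge : Marks → Colours → Bool
judge (marks nk st ts me cs ct) (colours cl qs qt) =
  verdict (nk ∷ differ (ones cs) (ones ct) ∷ (not (isOne cs) ∨ not (isOne ct)) ∷ st ∷ ts ∷ me ∷ differ qs qt ∷
    cl ∷ [])

module _ {N n : ℕ} {u : List Bool} where

  private
    final : (nk st ts me : Bool) (cs ct qs qt : List Bool) (cl diff none dc : Bool) → Store 30
    final nk st ts me cs ct qs qt cl diff none dc =
      regs [] [] [] (ones n) [] (ones n) [] [] [] (u ∷ [] ∷ [] ∷ [] ∷ [] ∷ [] ∷ [] ∷ [] ∷ [] ∷
        flag nk ∷ flag st ∷ flag ts ∷ flag me ∷ cs ∷ ct ∷ qs ∷ qt ∷ flag cl ∷ flag diff ∷ flag none ∷ flag dc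
          ∷ []) , []

  exec-conclude : ∀ k q → Marks.sizeS k ≤ N → Marks.sizeT k ≤ N →
    length (Colours.partsS q) ≤ N → length (Colours.partsT q) ≤ N →
    ∃[ s ] Exec N conclude (colouring n u [] [] [] k q) (s , [ judge k q ])
  exec-conclude (marks nk st ts me cs ct) (colours cl qs qt) cs≤ ct≤ qs≤ qt≤ = _ ,
    (exec≡ (singleS cs) ▷ exec≡ (singleT (not (isOne cs)) ct) ▷
     exec≡ (compareC N (ones cs) (ones ct) false (subst (_≤ N) (sym (List.length-replicate cs)) cs≤)
       (subst (_≤ N) (sym (List.length-replicate ct)) ct≤)) ▷
     exec≡ (compareQ N qs qt false qs≤ qt≤) ▷
     exec-readFlags (rNK ∷ rDiff ∷ rNone ∷ rST ∷ rTS ∷ rMeet ∷ rDC ∷ rClq ∷ []) verdict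
       (nk ∷ diff ∷ none ∷ st ∷ ts ∷ me ∷ differ qs qt ∷ cl ∷ []) refl)
    where
    none = not (isOne cs) ∨ not (isOne ct)
    diff = differ (ones cs) (ones ct)
    compareC : ∀ M p q f → length p ≤ M → length q ≤ M →
      iter M (exec N (compareStep {2} rCS rCT rDiff)) (final nk st ts me p q qs qt cl f none false)
      ≡ final nk st ts me [] [] qs qt cl (f ∨ differ p q) none false
    compareQ : ∀ M p q f → length p ≤ M → length q ≤ M →
      iter M (exec N (compareStep {2} rQS rQT rDC)) (final nk st ts me [] [] p q cl diff none f)
      ≡ final nk st ts me [] [] [] [] cl diff none (f ∨ differ p q)
    singleS : ∀ c → exec N (checkSingle {3} rCS)
      (final nk st ts me (ones c) (ones ct) qs qt cl false false false)
                    ≡ final nk st ts me (ones c) (ones ct) qs qt cl false (not (isOne c)) false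
    singleS 0             = refl
    singleS 1             = refl
    singleS (suc (suc c)) = refl
    singleT : ∀ f c → exec N (checkSingle {3} rCT)
      (final nk st ts me (ones cs) (ones c) qs qt cl false f false)
                      ≡ final nk st ts me (ones cs) (ones c) qs qt cl false (f ∨ not (isOne c)) false
    singleT false 0             = refl
    singleT false 1             = refl
    singleT false (suc (suc c)) = refl
    singleT true  0             = refl
    singleT true  1             = refl
    singleT true  (suc (suc c)) = refl
    compareC = exec-compare {2} rCS rCT rDiff (λ p q f → final nk st ts me p q qs qt cl f none false)
      (λ _ → refl)
      (λ b q f → exec-setIf {d = 2} {N} true rDiff f (proj₁ (final nk st ts me [] q qs qt cl f none false)) []
        refl)
      (λ a p f → exec-setIf {d = 2} {N} true rDiff f (proj₁ (final nk st ts me p [] qs qt cl f none false)) []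
        refl)
      (λ a p b q f → exec-setIf {d = 2} {N} (a xor b) rDiff f
        (proj₁ (final nk st ts me p q qs qt cl f none false)) [] refl)
    compareQ = exec-compare {2} rQS rQT rDC (λ p q f → final nk st ts me [] [] p q cl diff none f)
      (λ _ → refl)
      (λ b q f → exec-setIf {d = 2} {N} true rDC f (proj₁ (final nk st ts me [] [] [] q cl diff none f)) []
        refl)
      (λ a p f → exec-setIf {d = 2} {N} true rDC f (proj₁ (final nk st ts me [] [] p [] cl diff none f)) []
        refl)
      (λ a p b q f → exec-setIf {d = 2} {N} (a xor b) rDC f
        (proj₁ (final nk st ts me [] [] p q cl diff none f)) [] refl)

-- The complete verifier

verify : ℕ → ℕ → Prog 30 3
verify r ℓ = unpair ⨾ check (partition r ℓ) ⨾
             case E (readSets ⨾ matrixPass ⨾ partPass r ℓ ⨾ conclude) λ _ → emit true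

noMarks : Marks
noMarks = marks false false false false 0 0

noColours : Colours
noColours = colours false [] []

refutes : ∀ {n r ℓ} → Matrix n → Vec (Fin r ⊎ Fin ℓ) n → Vec Bool n → Vec Bool n → Bool
refutes M c S T = judge (markRows S T S T M noMarks) (colourAll S T c noColours)

-- The flags, as disjunctions over all vertices

some : ∀ {n} → (Fin n → Bool) → Bool
some {zero}  P = false
some {suc n} P = P zero ∨ some (P ∘ suc)

some-sound : ∀ {n} (P : Fin n → Bool) → some P ≡ true → ∃[ i ] P i ≡ true
some-sound {suc n} P h with P zero in e
... | true  = zero , e
... | false = let i , h′ = some-sound (P ∘ suc) h in suc i , h′

some-complete : ∀ {n} (P : Fin n → Bool) → some P ≡ false → ∀ i → P i ≡ false
some-complete {suc n} P h zero    = Bool.∨-conicalˡ (P zero) _ h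
some-complete {suc n} P h (suc i) = some-complete (P ∘ suc) (Bool.∨-conicalʳ (P zero) _ h) i

some-none : ∀ {n} {P : Fin n → Bool} → (∀ i → P i ≡ false) → some P ≡ false
some-none {zero}  h = refl
some-none {suc n} h = cong₂ _∨_ (h zero) (some-none (h ∘ suc))

meets-some : ∀ {n} (row S : Vec Bool n) → meets row S ≡ some (λ v → lookup row v ∧ lookup S v)
meets-some []        []      = refl
meets-some (b ∷ row) (s ∷ S) = cong ((b ∧ s) ∨_) (meets-some row S)

marks-cong : ∀ {nk nk′ st st′ ts ts′ me me′ cs cs′ ct ct′} → nk ≡ nk′ → st ≡ st′ → ts ≡ ts′ → me ≡ me′ → cs ≡
  cs′ → ct ≡ ct′ →
             marks nk st ts me cs ct ≡ marks nk′ st′ ts′ me′ cs′ ct′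
marks-cong refl refl refl refl refl refl = refl

∣∷∣ : ∀ {n} s (S : Subset n) c → ∣ S ∣ + count s c ≡ ∣ s ∷ S ∣ + c
∣∷∣ true  S c = ℕ.+-suc ∣ S ∣ c
∣∷∣ false S c = refl

markRows-some : ∀ {m n} (S T : Vec Bool n) (S₂ T₂ : Vec Bool m) (M : Vec (Vec Bool n) m) k → let open Marks k in
  markRows S T S₂ T₂ M k ≡ marks
    (notKernels ∨ some (λ w → not (meets (lookup M w) S xor lookup S₂ w) ∨ not
      (meets (lookup M w) T xor lookup T₂ w)))
    (hitST ∨ some (λ w → meets (lookup M w) T ∧ lookup S₂ w))
      (hitTS ∨ some (λ w → meets (lookup M w) S ∧ lookup T₂ w))
    (meet ∨ some (λ w → lookup S₂ w ∧ lookup T₂ w)) (∣ S₂ ∣ + sizeS) (∣ T₂ ∣ + sizeT)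
markRows-some S T [] [] [] (marks nk st ts me cs ct) =
  marks-cong (sym (Bool.∨-identityʳ nk)) (sym (Bool.∨-identityʳ st)) (sym (Bool.∨-identityʳ ts))
    (sym (Bool.∨-identityʳ me)) refl refl
markRows-some S T (s ∷ S₂) (t ∷ T₂) (row ∷ M) (marks nk st ts me cs ct) =
  trans (markRows-some S T S₂ T₂ M (markRow s t (meets row S) (meets row T) (marks nk st ts me cs ct)))
    (marks-cong (trans (cong (_∨ _) (Bool.∨-assoc nk (not (meets row S xor s)) (not (meets row T xor t))))
      (Bool.∨-assoc nk _ _))
      (Bool.∨-assoc st _ _) (Bool.∨-assoc ts _ _) (Bool.∨-assoc me _ _) (∣∷∣ s S₂ cs) (∣∷∣ t T₂ ct))

notes : ∀ {m r ℓ} → Vec Bool m → Vec (Fin r ⊎ Fin ℓ) m → List Bool → List Bool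
notes []      []      q = q
notes (s ∷ S) (p ∷ c) q = notes S c (notePart s p q)

colours-cong : ∀ {cl cl′ qs qs′ qt qt′} → cl ≡ cl′ → qs ≡ qs′ → qt ≡ qt′ → colours cl qs qt ≡
  colours cl′ qs′ qt′
colours-cong refl refl refl = refl

colourAll-some : ∀ {m r ℓ} (S T : Vec Bool m) (c : Vec (Fin r ⊎ Fin ℓ) m) q → let open Colours q in
  colourAll S T c q ≡ colours (isClique ∨ some (λ w → kind (lookup c w) ∧ lookup S w)) (notes S c partsS)
    (notes T c partsT)
colourAll-some []      []      []      (colours cl qs qt) = colours-cong (sym (Bool.∨-identityʳ cl)) refl refl
colourAll-some (s ∷ S) (t ∷ T) (p ∷ c) (colours cl qs qt) =
  trans (colourAll-some S T c (colour s t p (colours cl qs qt)))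
  (colours-cong (Bool.∨-assoc cl _ _) refl refl)

length-notePart : ∀ {r ℓ} s (p : Fin r ⊎ Fin ℓ) q → length (notePart s p q) ≤ length (encodePart p) + length q
length-notePart s p q = ℕ.≤-trans (length-iter (number p) _)
  (ℕ.≤-trans (ℕ.+-monoʳ-≤ (number p) (length-noted s (kind p) q))
  (ℕ.≤-trans (ℕ.≤-reflexive (ℕ.+-suc (number p) (length q))) (ℕ.+-monoˡ-≤ (length q) (number<length p))))
  where
  length-noted : ∀ s b q → length (noted s b q) ≤ suc (length q)
  length-noted false b q = ℕ.n≤1+n _
  length-noted true  b q = ℕ.≤-refl
  length-iter : ∀ k q → length (iter k (noted s true) q) ≤ k + length q
  length-iter zero    q = ℕ.≤-refl
  length-iter (suc k) q = ℕ.≤-trans (length-iter k _)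
    (ℕ.≤-trans (ℕ.+-monoʳ-≤ k (length-noted s true q)) (ℕ.≤-reflexive (ℕ.+-suc k _)))
  unary-length : ∀ k → k ≤ length (unary k)
  unary-length zero    = z≤n
  unary-length (suc k) = s≤s (unary-length k)
  number<length : ∀ {r ℓ} (p : Fin r ⊎ Fin ℓ) → suc (number p) ≤ length (encodePart p)
  number<length (inj₁ i) = s≤s (unary-length (toℕ i))
  number<length (inj₂ j) = s≤s (unary-length (toℕ j))

length-notes : ∀ {m r ℓ} (S : Vec Bool m) (c : Vec (Fin r ⊎ Fin ℓ) m) q →
  length (notes S c q) ≤ length (encodeAll encodePart c) + length q
length-notes []      []      q = ℕ.≤-refl
length-notes (s ∷ S) (p ∷ c) q = ℕ.≤-trans (length-notes S c (notePart s p q))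
  (ℕ.≤-trans (ℕ.+-monoʳ-≤ (length (encodeAll encodePart c)) (length-notePart s p q))
  (ℕ.≤-reflexive (trans (solve 3 (λ a b c → a :+ (b :+ c) := b :+ a :+ c) refl
    (length (encodeAll encodePart c)) (length (encodePart p)) (length q))
    (cong (_+ length q) (sym (List.length-++ (encodePart p)))))))
  where open +-*-Solver

module _ {n r ℓ} (M : Matrix n) (c : Vec (Fin r ⊎ Fin ℓ) n) (u : List Bool) where

  private
    codes = encodeAll encodePart c
    x     = unary n ++ encodeRows M ++ codes
    S     = padTake n u
    T     = padTake n (drop n u)

  run-verify-good : run (verify r ℓ) (pair x u) ≡ [ refutes M c S T ]
  run-verify-good = run-exec (verify r ℓ) (pair x u)
    (exec-unpair x u ℕ.≤-refl ▷ exec≡ (exec-check-good (partition r ℓ) {ρ = u ∷ no-marks} n M c x≤N) ▷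
     accept (exec-readSets n≤N u ▷ exec≡ (exec-rows n≤N {d = 1} N S T S T M n≤N) ▷ parts-exec ▷
       proj₂ concluded))
    where
    N = length (pair x u)
    x≤N : length x ≤ N
    x≤N = proj₁ (length-pair x u)
    n≤N : n ≤ N
    n≤N = ℕ.≤-trans (order≤length n (encodeRows M ++ codes)) x≤N
    codes≤N : length codes ≤ N
    codes≤N = ℕ.≤-trans (List.length-++-≤ʳ codes {encodeRows M})
      (ℕ.≤-trans (List.length-++-≤ʳ (encodeRows M ++ codes) {unary n}) x≤N)
    u′ = drop n (drop n u)
    k = markRows S T S T M noMarks
    q = colourAll S T c noColours
    parts-exec : Exec N (partPass r ℓ) (colouring n u′ codes (toList S) (toList T) k noColours)
      (colouring n u′ [] [] [] k q)
    parts-exec = subst (λ y → Exec N (partPass r ℓ) (colouring n u′ y (toList S) (toList T) k noColours)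
      (colouring n u′ [] [] [] k q))
      (List.++-identityʳ codes) (exec≡ (exec-parts {d = 2} N S T c noColours n≤N))
    notes≤N : ∀ S → length (notes S c []) ≤ N
    notes≤N S = ℕ.≤-trans (length-notes S c []) (ℕ.≤-trans (ℕ.≤-reflexive (ℕ.+-identityʳ _)) codes≤N)
    size≤N : ∀ (S : Subset n) → ∣ S ∣ + 0 ≤ N
    size≤N S = ℕ.≤-trans (ℕ.≤-reflexive (ℕ.+-identityʳ _)) (ℕ.≤-trans (∣p∣≤n S) n≤N)
    concluded : ∃[ s ] Exec N conclude (colouring n u′ [] [] [] k q) (s , [ judge k q ])
    concluded = exec-conclude k q
      (subst (λ k → Marks.sizeS k ≤ N) (sym (markRows-some S T S T M noMarks)) (size≤N S))
      (subst (λ k → Marks.sizeT k ≤ N) (sym (markRows-some S T S T M noMarks)) (size≤N T))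
      (subst (λ q → length (Colours.partsS q) ≤ N) (sym (colourAll-some S T c noColours)) (notes≤N S))
      (subst (λ q → length (Colours.partsT q) ≤ N) (sym (colourAll-some S T c noColours)) (notes≤N T))
    accept : ∀ {p : Prog 30 3} {q t} →
      Exec N p (checked (partition r ℓ) (u ∷ no-marks) [] (encodeRows M ++ codes) n false , []) t →
             Exec N (case E p q) (checked (partition r ℓ) (u ∷ no-marks) [] (encodeRows M ++ codes) n false ,
               []) t
    accept (exec≡ e) = exec≡ e

run-verify-bad : ∀ r ℓ x u → ¬ Shape (partition r ℓ) x → run (verify r ℓ) (pair x u) ≡ [ true ]
run-verify-bad r ℓ x u ¬s = run-exec (verify r ℓ) (pair x u)
  (exec-unpair x u ℕ.≤-refl ▷ exec≡ (proj₂ (proj₂ (proj₂ bad))) ▷ reject)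
  where
  N = length (pair x u)
  bad = exec-check-bad (partition r ℓ) {N} {o = []} {u ∷ no-marks} x (proj₁ (length-pair x u)) ¬s
  reject : ∀ {p : Prog 30 3} {x y n} →
    Exec N (case E p λ _ → emit true) (checked (partition r ℓ) (u ∷ no-marks) x y n true , [])
                                         (checked (partition r ℓ) (u ∷ no-marks) x y n true , [ true ])
  reject = exec≡ refl

-- Singletons

record Single {n} (S : Subset n) (u : Fin n) : Set where
  constructor isSingle
  field
    member : lookup S u ≡ true
    others : ∀ v → v ≢ u → lookup S v ≡ false

single : ∀ {n} (u : Fin n) → ∃[ S ] Single S u
single u = Vec.tabulate (λ v → does (v Fin.≟ u)) ,
  isSingle (trans (Vec.lookup∘tabulate _ u) (dec-true (u Fin.≟ u) refl)) λ v v≢u →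
    trans (Vec.lookup∘tabulate _ v) (dec-false (v Fin.≟ u) v≢u)

isOne-single : ∀ {n} (S : Subset n) → isOne ∣ S ∣ ≡ true → ∃[ u ] Single S u
isOne-single (false ∷ S) h = let u , isSingle hu hS = isOne-single S h in
  suc u , isSingle hu λ { zero _ → refl ; (suc v) ne → hS v (ne ∘ cong suc) }
isOne-single (true ∷ S) h = zero ,
  isSingle refl λ { zero ne → contradiction refl ne ; (suc v) _ → empty S (none ∣ S ∣ h) v }
  where
  none : ∀ c → isOne (suc c) ≡ true → c ≡ 0
  none zero _ = refl
  empty : ∀ {n} (S : Subset n) → ∣ S ∣ ≡ 0 → ∀ v → lookup S v ≡ false
  empty (false ∷ S) h zero    = refl
  empty (false ∷ S) h (suc v) = empty S h v

-- Turns the flags, which are disjunctions over all vertices, into statements about single entries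
-- and parts.
some-single : ∀ {n} {S : Subset n} {u} (P : Fin n → Bool) → Single S u → some (λ w → P w ∧ lookup S w) ≡ P u
some-single {S = S} {u} P (isSingle hu hS) with P u in e
... | true  = Bool.¬-not λ h → contradiction (trans (sym (cong₂ _∧_ e hu)) (some-complete _ h u)) λ ()
... | false = some-none λ w → at w (w Fin.≟ u)
  where
  at : ∀ w → Dec (w ≡ u) → P w ∧ lookup S w ≡ false
  at w (yes refl) = cong (_∧ lookup S w) e
  at w (no w≢u)   = trans (cong (P w ∧_) (hS w w≢u)) (Bool.∧-zeroʳ (P w))

notes-none : ∀ {n r ℓ} (S : Vec Bool n) (c : Vec (Fin r ⊎ Fin ℓ) n) q → (∀ v → lookup S v ≡ false) →
  notes S c q ≡ q
notes-none []          []      q h = refl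
notes-none (true ∷ S)  (p ∷ c) q h = contradiction (h zero) λ ()
notes-none (false ∷ S) (p ∷ c) q h =
  trans (notes-none S c _ (h ∘ suc)) (iter-fix (noted false true) q refl (number p))

notes-single : ∀ {n r ℓ} (S : Vec Bool n) (c : Vec (Fin r ⊎ Fin ℓ) n) {u} q → Single S u → notes S c q ≡
  notePart true (lookup c u) q
notes-single (true ∷ S)  (p ∷ c) {zero}  q (isSingle hu hS) = notes-none S c _ (λ v → hS (suc v) λ ())
notes-single (true ∷ S)  (p ∷ c) {suc u} q (isSingle hu hS) = contradiction (hS zero λ ()) λ ()
notes-single (false ∷ S) (p ∷ c) {suc u} q (isSingle hu hS) = trans
  (cong (notes S c) (iter-fix (noted false true) q refl (number p)))
  (notes-single S c q (isSingle hu λ v v≢u → hS (suc v) (v≢u ∘ Fin.suc-injective)))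

differ-refl : ∀ p → differ p p ≡ false
differ-refl []          = refl
differ-refl (false ∷ p) = differ-refl p
differ-refl (true ∷ p)  = differ-refl p

differ-sound : ∀ p q → differ p q ≡ false → p ≡ q
differ-sound []          []          h = refl
differ-sound (false ∷ p) (false ∷ q) h = cong (false ∷_) (differ-sound p q h)
differ-sound (true ∷ p)  (true ∷ q)  h = cong (true ∷_) (differ-sound p q h)

notePart-injective : ∀ {r ℓ} (p p′ : Fin r ⊎ Fin ℓ) → notePart true p [] ≡ notePart true p′ [] → p ≡ p′
notePart-injective p p′ e = same p p′
  (number-kind (number p) (number p′)
  (trans (sym (iter-ones (number p) _)) (trans e (iter-ones (number p′) _))))
  where
  iter-ones : ∀ k q → iter k (true ∷_) q ≡ ones k ++ q
  iter-ones zero    q = refl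
  iter-ones (suc k) q = trans (iter-ones k (true ∷ q)) (trans (sym (List.++-assoc (ones k) [ true ] q))
    (cong (_++ q) (trans (cong (ones k ++_) refl) (snoc k))))
    where
    snoc : ∀ k → ones k ++ [ true ] ≡ true ∷ ones k
    snoc zero    = refl
    snoc (suc k) = cong (true ∷_) (snoc k)
  number-kind : ∀ k k′ {b b′ : Bool} → ones k ++ [ b ] ≡ ones k′ ++ [ b′ ] → k ≡ k′ × b ≡ b′
  number-kind zero    zero     refl = refl , refl
  number-kind zero    (suc zero)     ()
  number-kind zero    (suc (suc k′)) ()
  number-kind (suc zero)    zero     ()
  number-kind (suc (suc k)) zero     ()
  number-kind (suc k) (suc k′) e = Product.map₁ (cong suc) (number-kind k k′ (List.∷-injectiveʳ e))
  same : ∀ {r ℓ} (p p′ : Fin r ⊎ Fin ℓ) → number p ≡ number p′ × kind p ≡ kind p′ → p ≡ p′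
  same (inj₁ i) (inj₁ j) (e , _) = cong inj₁ (Fin.toℕ-injective e)
  same (inj₂ i) (inj₂ j) (e , _) = cong inj₂ (Fin.toℕ-injective e)
  same (inj₁ i) (inj₂ j) (_ , ())
  same (inj₂ i) (inj₁ j) (_ , ())

-- Correctness of the verdict

-- What the absence of refutations amounts to. A graph, a partition and well-coveredness can be
-- assembled from it.
record Valid {n r ℓ} (M : Matrix n) (c : Vec (Fin r ⊎ Fin ℓ) n) : Set where
  field
    adjacency : IsAdjacency M
    parts     : ∀ u v → lookup c u ≡ lookup c v →
                (kind (lookup c u) ≡ false → entry M u v ≡ false) ×
                  (kind (lookup c u) ≡ true → u ≢ v → entry M u v ≡ true)
    kernels   : EqualKernelsOf M

module _ {n r ℓ} (M : Matrix n) (c : Vec (Fin r ⊎ Fin ℓ) n) where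

  notKernel : Subset n → Fin n → Bool
  notKernel S w = not (meets (lookup M w) S xor lookup S w)

  notKernels : Subset n → Subset n → Bool
  notKernels S T = some (λ w → notKernel S w ∨ notKernel T w)

  clash : (st ts me dc cl : Bool) → Bool
  clash st ts me dc cl = (st xor ts) ∨ (me ∧ st) ∨ (not dc ∧ (if cl then not me ∧ not st else st))

  notSingles : Subset n → Subset n → Bool
  notSingles S T = not (isOne ∣ S ∣) ∨ not (isOne ∣ T ∣)

  clashOf : Subset n → Subset n → Bool
  clashOf S T = clash (some (λ w → meets (lookup M w) T ∧ lookup S w))
    (some (λ w → meets (lookup M w) S ∧ lookup T w))
      (some (λ w → lookup S w ∧ lookup T w)) (differ (notes S c []) (notes T c []))
        (some (λ w → kind (lookup c w) ∧ lookup S w))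

  clashAt : Fin n → Fin n → Bool → Bool
  clashAt u v me = clash (entry M u v) (entry M v u) me
    (differ (notePart true (lookup c u) []) (notePart true (lookup c v) [])) (kind (lookup c u))

  refutes-some : ∀ S T → refutes M c S T ≡
    (not (notKernels S T) ∧ differ (ones ∣ S ∣) (ones ∣ T ∣)) ∨
    (not (notSingles S T) ∧ clashOf S T)
  refutes-some S T = trans (cong₂ judge (markRows-some S T S T M noMarks) (colourAll-some S T c noColours))
    (cong₂ (λ a b → (not (notKernels S T) ∧ differ (ones a) (ones b)) ∨
      (not (not (isOne a) ∨ not (isOne b)) ∧ clashOf S T))
      (ℕ.+-identityʳ ∣ S ∣) (ℕ.+-identityʳ ∣ T ∣))

  meets-single : ∀ {T v} u → Single T v → meets (lookup M u) T ≡ entry M u v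
  meets-single {T} u hT = trans (meets-some (lookup M u) T) (some-single (entry M u) hT)

  clash-single : ∀ {S T u v} → Single S u → Single T v → clashOf S T ≡ clashAt u v (lookup S v)
  clash-single {S} {T} {u} {v} hS hT = clash-cong
    (trans (some-single (λ w → meets (lookup M w) T) hS) (meets-single u hT))
    (trans (some-single (λ w → meets (lookup M w) S) hT) (meets-single v hS))
    (some-single (lookup S) hT)
    (cong₂ differ (notes-single S c [] hS) (notes-single T c [] hT))
    (some-single (λ w → kind (lookup c w)) hS)
    where
    clash-cong : ∀ {st st′ ts ts′ me me′ dc dc′ cl cl′} → st ≡ st′ → ts ≡ ts′ → me ≡ me′ → dc ≡ dc′ → cl ≡
      cl′ →
                 clash st ts me dc cl ≡ clash st′ ts′ me′ dc′ cl′
    clash-cong refl refl refl refl refl = refl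

  -- The test makes membership and having a neighbour in S complementary at every vertex: one half
  -- is independence, the other domination. Symmetry turns the row that was scanned into the column
  -- that `dominating` speaks of.
  kernel⇒ : ∀ S → (∀ w → notKernel S w ≡ false) → IsAdjacency M → Kernel (entry M) S
  kernel⇒ S h (symm , _) = record
    { independent = λ u v hu hv → Bool.¬-not λ e → contradiction
        (trans (sym (some-complete _ (trans (sym (meets-some (lookup M u) S)) (is-not u hu)) v))
          (cong₂ _∧_ e hv)) λ ()
    ; dominating  = λ v hv → let u , e = some-sound _ (trans (sym (meets-some (lookup M v) S)) (is-not v hv)) in
        u , Bool.∧-conicalʳ (entry M v u) _ e , trans (symm u v) (Bool.∧-conicalˡ (entry M v u) _ e) }
    where
    opposite : ∀ a s → not (a xor s) ≡ false → ∀ {b} → s ≡ b → a ≡ not b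
    opposite true  false h refl = refl
    opposite false true  h refl = refl
    is-not : ∀ w {b} → lookup S w ≡ b → meets (lookup M w) S ≡ not b
    is-not w = opposite (meets (lookup M w) S) (lookup S w) (h w)

  kernel⇐ : ∀ {S} → IsAdjacency M → Kernel (entry M) S → ∀ w → notKernel S w ≡ false
  kernel⇐ {S} (symm , _) k w with lookup S w in e
  ... | true  = cong (λ a → not (a xor true)) (trans (meets-some (lookup M w) S) (some-none none))
    where
    none : ∀ v → entry M w v ∧ lookup S v ≡ false
    none v with lookup S v in e′
    ... | true  = trans (Bool.∧-identityʳ _) (Kernel.independent k w v e e′)
    ... | false = Bool.∧-zeroʳ _
  ... | false = cong (λ a → not (a xor false)) (trans (meets-some (lookup M w) S) (Bool.¬-not λ h →
    let u , hu , a = Kernel.dominating k w e in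
    contradiction (trans (sym (cong₂ _∧_ (trans (symm w u) a) hu)) (some-complete _ h u)) λ ()))

  valid⇒ : Valid M c → ∀ S T → refutes M c S T ≡ false
  valid⇒ valid S T = trans (refutes-some S T) (cong₂ _∨_ first (second (isOne ∣ S ∣) (isOne ∣ T ∣) refl refl))
    where
    open Valid valid
    first : not (notKernels S T) ∧ differ (ones ∣ S ∣) (ones ∣ T ∣) ≡ false
    first with notKernels S T in e
    ... | true  = refl
    ... | false = trans (cong (λ s → differ (ones s) (ones ∣ T ∣)) (kernels S T
      (kernel⇒ S (λ w → Bool.∨-conicalˡ _ _ (some-complete _ e w)) adjacency)
      (kernel⇒ T (λ w → Bool.∨-conicalʳ (notKernel S w) _ (some-complete _ e w)) adjacency)))
        (differ-refl (ones ∣ T ∣))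
    noClash : ∀ {u v} → Single S u → clashAt u v (lookup S v) ≡ false
    noClash {u} {v} (isSingle hu hS) =
      cong₂ _∨_ (trans (cong (_xor entry M v u) (proj₁ adjacency u v)) (Bool.xor-same (entry M v u)))
      (cong₂ _∨_ loops coloured)
      where
      loops : lookup S v ∧ entry M u v ≡ false
      loops with v Fin.≟ u
      ... | yes refl = trans (cong (lookup S v ∧_) (proj₂ adjacency v)) (Bool.∧-zeroʳ _)
      ... | no v≢u   = cong (_∧ entry M u v) (hS v v≢u)
      codes : Fin n → List Bool
      codes w = notePart true (lookup c w) []
      coloured : not (differ (codes u) (codes v)) ∧
        (if kind (lookup c u) then not (lookup S v) ∧ not (entry M u v) else entry M u v) ≡ false
      coloured with differ (codes u) (codes v) in e
      ... | true = refl
      ... | false with notePart-injective (lookup c u) (lookup c v) (differ-sound _ _ e) | kind (lookup c u) in e′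
      ... | same | false = proj₁ (parts u v same) e′
      ... | same | true with v Fin.≟ u
      -- A clique constrains only distinct vertices; for u = v the flag for a common member disables
      -- the test.
      ... | yes refl = cong (λ s → not s ∧ not (entry M v v)) hu
      ... | no v≢u   = trans (cong (λ a → not (lookup S v) ∧ not a) (proj₂ (parts u v same) e′ (v≢u ∘ sym))) (Bool.∧-zeroʳ _)
    second : ∀ a b → isOne ∣ S ∣ ≡ a → isOne ∣ T ∣ ≡ b → not (notSingles S T) ∧ clashOf S T ≡ false
    second false b     hS hT = cong (λ a → not (not a ∨ not (isOne ∣ T ∣)) ∧ clashOf S T) hS
    second true  false hS hT = trans (cong₂ (λ a b → not (not a ∨ not b) ∧ clashOf S T) hS hT) refl
    second true  true  hS hT = let u , sS = isOne-single S hS ; v , sT = isOne-single T hT in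
      trans (cong (not (notSingles S T) ∧_) (trans (clash-single sS sT) (noClash sS))) (Bool.∧-zeroʳ _)

  -- The singletons come first: they yield symmetry, which `kernel⇐` presupposes when arbitrary
  -- kernels are compared by their sizes.
  valid⇐ : (∀ S T → refutes M c S T ≡ false) → Valid M c
  valid⇐ h = record { adjacency = adjacency ; parts = same-part ; kernels = kernels }
    where
    split : ∀ S T → (not (notKernels S T) ∧ differ (ones ∣ S ∣) (ones ∣ T ∣) ≡ false) ×
      (not (notSingles S T) ∧ clashOf S T ≡ false)
    split S T = let e = trans (sym (refutes-some S T)) (h S T) in Bool.∨-conicalˡ _ _ e , Bool.∨-conicalʳ (not (notKernels S T) ∧ differ (ones ∣ S ∣) (ones ∣ T ∣)) _ e
    noClash : ∀ u v → clashAt u v (lookup (proj₁ (single u)) v) ≡ false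
    noClash u v = let S , sS = single u ; T , sT = single v in trans (sym (clash-single sS sT))
      (trans (sym (cong₂ (λ a b → not (not (isOne a) ∨ not (isOne b)) ∧ clashOf S T)
        (∣single∣ S u (Single.member sS) (Single.others sS))
        (∣single∣ T v (Single.member sT) (Single.others sT)))) (proj₂ (split S T)))
    xor-false : ∀ a b → a xor b ≡ false → a ≡ b
    xor-false true  true  _ = refl
    xor-false false false _ = refl
    later : ∀ u v → (lookup (proj₁ (single u)) v ∧ entry M u v) ∨ _ ≡ false
    later u v = Bool.∨-conicalʳ (entry M u v xor entry M v u) _ (noClash u v)
    adjacency : IsAdjacency M
    adjacency = (λ u v → xor-false _ _ (Bool.∨-conicalˡ _ _ (noClash u v))) ,
      λ v → trans (sym (cong (_∧ entry M v v) (Single.member (proj₂ (single v)))))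
        (Bool.∨-conicalˡ _ _ (later v v))
    same-part : ∀ u v → lookup c u ≡ lookup c v →
      (kind (lookup c u) ≡ false → entry M u v ≡ false) ×
        (kind (lookup c u) ≡ true → u ≢ v → entry M u v ≡ true)
    same-part u v e = (λ k → trans (sym (cong (λ k → if k then _ else entry M u v) k)) coloured) ,
      λ k u≢v → Bool.not-injective (trans
        (sym (cong (λ s → not s ∧ not (entry M u v)) (Single.others (proj₂ (single u)) v (u≢v ∘ sym))))
        (trans (sym (cong (λ k → if k then not (lookup (proj₁ (single u)) v) ∧ not (entry M u v) else entry M
          u v) k)) coloured))
      where
      coloured : (if kind (lookup c u) then not (lookup (proj₁ (single u)) v) ∧ not (entry M u v) else entry M
        u v) ≡ false
      coloured = trans (sym (cong (λ d →
        not d ∧ (if kind (lookup c u) then not (lookup (proj₁ (single u)) v) ∧ not (entry M u v) else entry M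
        u v))
          (trans (cong (λ p → differ (notePart true (lookup c u) []) (notePart true p [])) (sym e))
            (differ-refl (notePart true (lookup c u) [])))))
        (Bool.∨-conicalʳ (lookup (proj₁ (single u)) v ∧ entry M u v) _ (later u v))
    kernels : EqualKernelsOf M
    kernels S T kS kT = trans (sym (List.length-replicate ∣ S ∣))
      (trans (cong length (differ-sound (ones ∣ S ∣) (ones ∣ T ∣)
      (trans (sym (cong (λ k → not k ∧ differ (ones ∣ S ∣) (ones ∣ T ∣))
        (some-none λ w → cong₂ _∨_ (kernel⇐ adjacency kS w) (kernel⇐ adjacency kT w))))
        (proj₁ (split S T))))) (List.length-replicate ∣ T ∣))

-- Membership in coNP

headBit : List Bool → Bool
headBit []      = false
headBit (b ∷ _) = b

-- A verifier must output exactly one bit on every string, including those that are no pairs.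
-- Keeping the first bit of whatever `verify` writes, with a default, ensures this.
firstBit : Prog 1 0
firstBit = case zero (emit false) emit

run-firstBit : ∀ x → run firstBit x ≡ [ headBit x ]
run-firstBit []      = run-exec firstBit [] (exec≡ refl)
run-firstBit (b ∷ x) = run-exec firstBit (b ∷ x) (exec≡ refl)

PolyTime-cong : ∀ {f g} → (∀ x → f x ≡ g x) → PolyTime f → PolyTime g
PolyTime-cong e (M , p , c) = M , p , λ x → let t , ts , r , t≤ , o = c x in t , ts , r , t≤ , trans o (e x)

padTake-++ : ∀ {n} (S : Vec Bool n) u → padTake n (toList S ++ u) ≡ S × drop n (toList S ++ u) ≡ u
padTake-++ []      u = refl , refl
padTake-++ (s ∷ S) u = Product.map₁ (cong (s ∷_)) (padTake-++ S u)

-- The bound is twice the length of the instance: a certificate lists two vertex sets, and the order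
-- of the graph is written in unary.
Refuted : (List Bool → Bool) → Language
Refuted V x = ∃[ u ] length u ≤ eval (0 ∷ [ 2 ]) (length x) × V (pair x u) ≡ true

module _ (r ℓ : ℕ) where

  valid-refutes : ∀ G (π : Partition G r ℓ) → WellCovered G →
    Valid (adjacencyMatrix G) (Vec.tabulate (Partition.part π))
  valid-refutes G π wc = record
    { adjacency = isAdjacency-adjacencyMatrix G
    ; parts     = λ u v e → same-part u v (part u) refl
      (trans (sym (Vec.lookup∘tabulate part v)) (trans (sym e) (Vec.lookup∘tabulate part u)))
    ; kernels   = λ S T kS kT → Equivalence.to (wellCovered⇔ G) wc S T
      (kernel-cong (entry-adjacencyMatrix G) kS) (kernel-cong (entry-adjacencyMatrix G) kT) }
    where
    open Partition π
    M = adjacencyMatrix G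
    same-part : ∀ u v p → part u ≡ p → part v ≡ part u →
      (kind (lookup (Vec.tabulate part) u) ≡ false → entry M u v ≡ false) ×
      (kind (lookup (Vec.tabulate part) u) ≡ true → u ≢ v → entry M u v ≡ true)
    same-part u v p pu pv rewrite Vec.lookup∘tabulate part u | entry-adjacencyMatrix G u v | pu = go p pu (trans pv refl)
      where
      go : ∀ p → part u ≡ p → part v ≡ p → (kind p ≡ false → Graph.adj G u v ≡ false) ×
        (kind p ≡ true → u ≢ v → Graph.adj G u v ≡ true)
      go (inj₁ i) pu pv = (λ _ → Bool.¬-not (independent i pu pv)) , λ ()
      go (inj₂ j) pu pv = (λ ()) , λ _ → clique j pu pv

  module _ (V : List Bool → Bool)
           (V-good : ∀ {n} (M : Matrix n) (c : Vec (Fin r ⊎ Fin ℓ) n) u →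
                     V (pair (unary n ++ encodeRows M ++ encodeAll encodePart c) u) ≡
                       refutes M c (padTake n u) (padTake n (drop n u)))
           (V-bad : ∀ x u → ¬ Shape (partition r ℓ) x → V (pair x u) ≡ true) where

    -- Both directions are constructive: `Shape` is decidable and `refutes` is Boolean, so the
    -- absence of a certificate gives the value `false` for every pair of sets, which is all that
    -- `valid⇐` asks for.
    wc-rℓg-refuted : ∀ x → wc-rℓg r ℓ x ⇔ (¬ Refuted V x)
    wc-rℓg-refuted x = mk⇔ to from
      where
      to : wc-rℓg r ℓ x → ¬ Refuted V x
      to (G , π , refl , wc) (u , _ , h) =
        contradiction (trans (sym h) (trans (cong (λ x → V (pair x u)) (encodePartitioned-shape G π))
        (trans (V-good (adjacencyMatrix G) c u) (valid⇒ (adjacencyMatrix G) c (valid-refutes G π wc) S T))))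
          λ ()
        where
        n = Graph.order G
        c = Vec.tabulate (Partition.part π)
        S = padTake n u
        T = padTake n (drop n u)

      from : ¬ Refuted V x → wc-rℓg r ℓ x
      from ¬r with shape? (partition r ℓ) x
      ... | no ¬s = ⊥-elim (¬r ([] , z≤n , V-bad x [] ¬s))
      ... | yes (n , M , c , refl) = graph M adjacency , π , e , Equivalence.from (wellCovered⇔ (graph M adjacency)) kernels
        where
        unrefuted : ∀ S T → refutes M c S T ≡ false
        unrefuted S T = Bool.¬-not λ h →
          ¬r (u , short , trans (V-good M c u) (trans (cong₂ (refutes M c) S≡ T≡) h))
          where
          u  = toList S ++ toList T
          u₂ = trans (proj₂ (padTake-++ S (toList T))) (sym (List.++-identityʳ (toList T)))
          S≡ : padTake n u ≡ S
          S≡ = proj₁ (padTake-++ S (toList T))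
          T≡ : padTake n (drop n u) ≡ T
          T≡ = trans (cong (padTake n) u₂) (proj₁ (padTake-++ T []))
          short : length u ≤ eval (0 ∷ [ 2 ]) (length x)
          short = ℕ.≤-trans (ℕ.≤-reflexive
            (trans (List.length-++ (toList S)) (trans (cong₂ _+_ (Vec.length-toList S) (Vec.length-toList T))
              (solve 1 (λ n → n :+ n := n :* con 2) refl n))))
            (ℕ.≤-trans (ℕ.*-monoˡ-≤ 2 (order≤length n (encodeRows M ++ encodeAll encodePart c)))
              (ℕ.≤-reflexive (cong (length x *_) (sym (cong (2 +_) (ℕ.*-zeroʳ (length x)))))))
            where open +-*-Solver
        open Valid (valid⇐ M c unrefuted)
        π : Partition (graph M adjacency) r ℓ
        π = record
          { part        = lookup c
          ; independent = λ i {u} {v} pu pv a →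
            contradiction (trans (sym a) (proj₁ (parts u v (trans pu (sym pv))) (cong kind pu))) λ ()
          ; clique      = λ j {u} {v} pu pv → proj₂ (parts u v (trans pu (sym pv))) (cong kind pu) }
        e : encodePartitioned (graph M adjacency) π ≡ x
        e = trans (cong₂ _++_ (encodeGraph-graph M adjacency)
          (trans (sym (encodeAll-tabulate encodePart (lookup c)))
          (cong (encodeAll encodePart) (Vec.tabulate∘lookup c))))
          (List.++-assoc (unary n) (encodeRows M) _)

  verifier : List Bool → Bool
  verifier = headBit ∘ run (verify r ℓ)

  verifier-polyTime : PolyTime ([_] ∘ verifier)
  verifier-polyTime = PolyTime-cong (run-firstBit ∘ run (verify r ℓ))
    (PolyTime-run firstBit (PolyTime-run (verify r ℓ) PolyTime-id))

  wc-rℓg-inCoNP : InCoNP (wc-rℓg r ℓ)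
  wc-rℓg-inCoNP = Refuted verifier , (0 ∷ [ 2 ] , verifier , verifier-polyTime , λ x → mk⇔ id id) ,
    wc-rℓg-refuted verifier (λ M c u → cong headBit (run-verify-good M c u))
      (λ x u ¬s → cong headBit (run-verify-bad r ℓ x u ¬s))

theorem1 : (r ℓ : ℕ) →
    (CoNPComplete (wc-rℓg r ℓ) →
    CoNPComplete (wc-rℓg (suc r) ℓ) × CoNPComplete (wc-rℓg r (suc ℓ)))
    ×
    ((NPHard (rℓwc-g r ℓ) → NPHard (rℓwc-g r (suc ℓ))) ×
    (CoNPHard (rℓwc-g r ℓ) → CoNPHard (rℓwc-g r (suc ℓ))))
    ×
    (1 ≤ r →
    (NPHard (rℓwc-g r ℓ) → NPHard (rℓwc-g (suc r) ℓ)) ×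
    (CoNPHard (rℓwc-g r ℓ) → CoNPHard (rℓwc-g (suc r) ℓ)))
theorem1 r ℓ =
  (λ (_ , hard) → (wc-rℓg-inCoNP (suc r) ℓ , widen-hard inject₁ id Fin.toℕ-inject₁ (λ _ → refl) hard) ,
                  (wc-rℓg-inCoNP r (suc ℓ) , widen-hard id inject₁ (λ _ → refl) Fin.toℕ-inject₁ hard)) ,
  (hard-clique InNP r ℓ , hard-clique InCoNP r ℓ) ,
  -- The pattern rebinds `r` to the predecessor, in accordance with `hard-independent`, which starts
  -- from `suc r` independent parts.
  λ { (s≤s {n = r} _) → hard-independent InNP r ℓ , hard-independent InCoNP r ℓ }
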